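{- Let $n\geq 12$ be an even integer. Among all binary trees on $n$ vertices, the distance between center and subtree core is maximized by a crg tree; that is, there is a crg tree $T^*$ on $n$ vertices such that $d_T(C(T),S_c(T))\leq d_{T^*}(C(T^*),S_c(T^*))$ for every binary tree $T$ on $n$ vertices.
   Context: All graphs are finite, simple, connected and undirected. A pendant vertex is a vertex of degree $1$. A binary tree is a tree in which every non-pendant vertex has degree $3$ (so its number of vertices is even). Center and subtree core: the eccentricity of $v\in V(T)$ is $e(v)=\max_{u}d_T(u,v)$; the center $C(T)$ is the set of vertices of minimum eccentricity. A subtree of $T$ is a (nonempty) connected subgraph of $T$; $f_T(v)$ is the number of subtrees of $T$ containing $v$; the subtree core $S_c(T)$ is the set of vertices $v$ for which $f_T(v)$ is maximum. For $X,Y\subseteq V(T)$, $d_T(X,Y)=\min\{d_T(x,y):x\in X,y\in Y\}$. Rooted binary trees: a rooted binary tree is a rooted tree whose root has degree $2$ and in which every other vertex has degree $1$ or $3$; the single-vertex rooted tree is also allowed. The height (level) of a vertex is its distance to the root. A rooted binary tree is ordered if the vertices of each level $l\ge 1$ are linearly ordered so that two vertices at level $l+1$ with different parents are ordered as their parents are at level $l$. A rooted binary tree is rgood if (i) the heights of any two of its pendant vertices differ by at most $1$, and (ii) it can be ordered so that the parents of the pendant vertices at the highest level form a final segment in the ordering of the vertices at the next-to-highest level. For each odd $l$ there is, up to isomorphism, exactly one rgood binary tree on $l$ vertices, denoted $T_{rg}^l$. Crg trees: a binary caterpillar is a binary tree having a path such that every vertex not on the path is adjacent to a vertex of the path. For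 even $n\ge 4$ and odd $l$ with $3\le l<n$, the crg tree $T_{rg}^{n,l}$ is the tree on $n$ vertices obtained by identifying the root of $T_{rg}^l$ with a vertex of maximum eccentricity of a binary caterpillar on $n-l+1$ vertices. -}

module Defs where

open import Data.Bool.Base using (Bool; true; false; T)
open import Data.Bool.Properties using (T?) renaming (_≟_ to _≟ᵇ_)
open import Data.Fin.Base using (Fin)
open import Data.Fin.Properties using (all?; any?) renaming (_≟_ to _≟ᶠ_)
open import Data.Fin.Subset using (Subset; inside; outside; ∣_∣) renaming (_∈_ to _∈ˢ_)
open import Data.Fin.Subset.Properties using () renaming (_∈?_ to _∈ˢ?_)
open import Data.List.Base
  using (List; []; _∷_; _++_; length; map; filter; allFin; upTo; cartesianProduct; cartesianProductWith)
open import Data.List.Extrema.Nat using (min; max)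
open import Data.List.Membership.Propositional using (_∈_; _∉_)
open import Data.List.Membership.Propositional.Properties using (∈-allFin)
open import Data.List.Relation.Unary.Any using (here; there)
open import Data.List.Relation.Unary.Linked using (Linked)
open import Data.List.Relation.Unary.Unique.Propositional using (Unique)
open import Data.Nat.Base using (ℕ; zero; suc; _+_; _∸_; _≤_; _<_; ∣_-_∣)
open import Data.Nat.Divisibility using (_∣_; _∤_)
open import Data.Nat.Properties using (_≤?_)
open import Data.Product.Base using (Σ-syntax; ∃-syntax; _×_; _,_; proj₁; proj₂)
open import Data.Sum.Base using (_⊎_; inj₁; inj₂)
open import Data.Vec.Base using (Vec; []; _∷_; lookup; tabulate)
open import Function.Base using (_on_)
open import Function.Bundles using (_⇔_)
open import Function.Definitions using (Injective)
open import Level using (0ℓ)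
open import Relation.Binary.Construct.Closure.ReflexiveTransitive using (Star; ε; _◅_; _◅◅_)
open import Relation.Binary.Core using (Rel)
open import Relation.Binary.Definitions using (Decidable)
open import Relation.Binary.PropositionalEquality.Core using (_≡_; _≢_; refl)
open import Relation.Binary.Structures using (IsStrictTotalOrder)
open import Relation.Nullary.Decidable using (Dec; map′; _×-dec_; _⊎-dec_; _→-dec_)
open import Relation.Nullary.Negation.Core using (¬_)

record Graph (n : ℕ) : Set where
  field
    adj    : Fin n → Fin n → Bool
    sym    : ∀ u v → adj u v ≡ adj v u
    irrefl : ∀ v → adj v v ≡ false

module _ {n : ℕ} (G : Graph n) where
  open Graph G

  Adj : Rel (Fin n) 0ℓ
  Adj u v = T (adj u v)

  adj? : Decidable Adj
  adj? u v = T? (adj u v)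

  neighbours : Fin n → Subset n
  neighbours v = tabulate (adj v)

  degree : Fin n → ℕ
  degree v = ∣ neighbours v ∣

  IsPendant : Fin n → Set
  IsPendant v = degree v ≡ 1

  Connected : Set
  Connected = ∀ u v → Star Adj u v

  IsPath : List (Fin n) → Set
  IsPath vs = Linked Adj vs × Unique vs

  -- The cycle through v , vs, whose last vertex is adjacent to v.
  IsCycle : Fin n → List (Fin n) → Set
  IsCycle v vs = 2 ≤ length vs × Unique (v ∷ vs) × Linked Adj ((v ∷ vs) ++ v ∷ [])

  IsTree : Set
  IsTree = Connected × (∀ v vs → ¬ IsCycle v vs)

  IsBinaryTree : Set
  IsBinaryTree = IsTree × (∀ v → ¬ IsPendant v → degree v ≡ 3)

  Walk : ℕ → Rel (Fin n) 0ℓ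
  Walk zero    u v = u ≡ v
  Walk (suc k) u v = ∃[ w ] (Adj u w × Walk k w v)

  walk? : ∀ k → Decidable (Walk k)
  walk? zero    u v = u ≟ᶠ v
  walk? (suc k) u v = any? (λ w → adj? u w ×-dec walk? k w v)

  -- In a connected graph a shortest walk has length < n, so the default
  -- value n is only taken when there is no walk at all.
  dist : Fin n → Fin n → ℕ
  dist u v = min n (filter (λ k → walk? k u v) (upTo n))

  ecc : Fin n → ℕ
  ecc v = max 0 (map (dist v) (allFin n))

  InCenter : Fin n → Set
  InCenter v = ∀ u → ecc v ≤ ecc u

  inCenter? : ∀ v → Dec (InCenter v)
  inCenter? v = all? (λ u → ecc v ≤? ecc u)

  center : List (Fin n)
  center = filter inCenter? (allFin n)

  -- The default value n only matters when X or Y is empty.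
  setDist : List (Fin n) → List (Fin n) → ℕ
  setDist X Y = min n (cartesianProductWith dist X Y)

-- Warshall's algorithm: ReachVia R ws u v says that v can be reached from u
-- with all intermediate vertices in ws.  It is used only to decide Star R.
module _ {n : ℕ} (R : Rel (Fin n) 0ℓ) where

  ReachVia : List (Fin n) → Rel (Fin n) 0ℓ
  ReachVia []       u v = u ≡ v ⊎ R u v
  ReachVia (w ∷ ws) u v = ReachVia ws u v ⊎ (ReachVia ws u w × ReachVia ws w v)

  reachVia⇒star : ∀ ws {u v} → ReachVia ws u v → Star R u v
  reachVia⇒star []       (inj₁ refl)    = ε
  reachVia⇒star []       (inj₂ r)       = r ◅ ε
  reachVia⇒star (w ∷ ws) (inj₁ p)       = reachVia⇒star ws p
  reachVia⇒star (w ∷ ws) (inj₂ (p , q)) = reachVia⇒star ws p ◅◅ reachVia⇒star ws q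

  edge⇒reachVia : ∀ ws {u v} → u ≡ v ⊎ R u v → ReachVia ws u v
  edge⇒reachVia []       e = e
  edge⇒reachVia (w ∷ ws) e = inj₁ (edge⇒reachVia ws e)

  reachVia-trans : ∀ {x} ws {u v} → x ∈ ws → ReachVia ws u x → ReachVia ws x v → ReachVia ws u v
  reachVia-trans (w ∷ ws) (here refl) p q = inj₂ (to p , from q)
    where
    to : ∀ {u} → ReachVia (w ∷ ws) u w → ReachVia ws u w
    to (inj₁ r)       = r
    to (inj₂ (r , _)) = r
    from : ∀ {v} → ReachVia (w ∷ ws) w v → ReachVia ws w v
    from (inj₁ r)       = r
    from (inj₂ (_ , r)) = r
  reachVia-trans (w ∷ ws) (there i) (inj₁ p)       (inj₁ q)        = inj₁ (reachVia-trans ws i p q)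
  reachVia-trans (w ∷ ws) (there i) (inj₁ p)       (inj₂ (q , q′)) = inj₂ (reachVia-trans ws i p q , q′)
  reachVia-trans (w ∷ ws) (there i) (inj₂ (p , p′)) (inj₁ q)       = inj₂ (p , reachVia-trans ws i p′ q)
  reachVia-trans (w ∷ ws) (there i) (inj₂ (p , _)) (inj₂ (_ , q))  = inj₂ (p , q)

  star⇒reachVia : ∀ {u v} → Star R u v → ReachVia (allFin n) u v
  star⇒reachVia ε                  = edge⇒reachVia (allFin n) (inj₁ refl)
  star⇒reachVia (_◅_ {j = w} r rs) =
    reachVia-trans (allFin n) (∈-allFin w) (edge⇒reachVia (allFin n) (inj₂ r)) (star⇒reachVia rs)

  module _ (R? : Decidable R) where

    reachVia? : ∀ ws → Decidable (ReachVia ws)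
    reachVia? []       u v = (u ≟ᶠ v) ⊎-dec R? u v
    reachVia? (w ∷ ws) u v = reachVia? ws u v ⊎-dec (reachVia? ws u w ×-dec reachVia? ws w v)

    star? : Decidable (Star R)
    star? u v = map′ (reachVia⇒star (allFin n)) star⇒reachVia (reachVia? (allFin n) u v)

-- A vertex set together with a candidate edge set, the latter given as an
-- adjacency matrix: the entry (u , v) says whether uv is one of the edges.
-- Subsets and matrices are vectors so that _≡_ is equality of subgraphs.
SubgraphData : ℕ → Set
SubgraphData n = Subset n × Vec (Subset n) n

allVecs : ∀ {A : Set} → List A → ∀ n → List (Vec A n)
allVecs xs zero    = [] ∷ []
allVecs xs (suc n) = cartesianProductWith _∷_ xs (allVecs xs n)

allSubsets : ∀ n → List (Subset n)
allSubsets = allVecs (outside ∷ inside ∷ [])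

allSubgraphData : ∀ n → List (SubgraphData n)
allSubgraphData n = cartesianProduct (allSubsets n) (allVecs (allSubsets n) n)

module _ {n : ℕ} (S : Subset n) (E : Vec (Subset n) n) where

  SubAdj : Rel (Fin n) 0ℓ
  SubAdj u v = T (lookup (lookup E u) v)

  subAdj? : Decidable SubAdj
  subAdj? u v = T? (lookup (lookup E u) v)

  IsSubgraphOf : Graph n → Set
  IsSubgraphOf G = ∀ u v → SubAdj u v → (SubAdj v u × Adj G u v × u ∈ˢ S × v ∈ˢ S)

  isSubgraphOf? : ∀ G → Dec (IsSubgraphOf G)
  isSubgraphOf? G = all? λ u → all? λ v → subAdj? u v →-dec
    (subAdj? v u ×-dec adj? G u v ×-dec u ∈ˢ? S ×-dec v ∈ˢ? S)

  SubConnected : Set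
  SubConnected = ∀ u v → u ∈ˢ S → v ∈ˢ S → Star SubAdj u v

  subConnected? : Dec SubConnected
  subConnected? = all? λ u → all? λ v → u ∈ˢ? S →-dec v ∈ˢ? S →-dec star? SubAdj subAdj? u v

module _ {n : ℕ} (G : Graph n) where

  IsSubtreeContaining : Fin n → SubgraphData n → Set
  IsSubtreeContaining v (S , E) = v ∈ˢ S × IsSubgraphOf S E G × SubConnected S E

  isSubtreeContaining? : ∀ v H → Dec (IsSubtreeContaining v H)
  isSubtreeContaining? v (S , E) = v ∈ˢ? S ×-dec isSubgraphOf? S E G ×-dec subConnected? S E

  subtreeCount : Fin n → ℕ
  subtreeCount v = length (filter (isSubtreeContaining? v) (allSubgraphData n))

  InSubtreeCore : Fin n → Set
  InSubtreeCore v = ∀ u → subtreeCount u ≤ subtreeCount v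

  inSubtreeCore? : ∀ v → Dec (InSubtreeCore v)
  inSubtreeCore? v = all? (λ u → subtreeCount u ≤? subtreeCount v)

  subtreeCore : List (Fin n)
  subtreeCore = filter inSubtreeCore? (allFin n)

module _ {n : ℕ} (G : Graph n) (root : Fin n) where

  IsRootedBinaryTree : Set
  IsRootedBinaryTree = IsTree G ×
    (n ≡ 1 ⊎ (degree G root ≡ 2 × (∀ v → v ≢ root → degree G v ≡ 1 ⊎ degree G v ≡ 3)))

  height : Fin n → ℕ
  height v = dist G root v

  IsParentOf : Rel (Fin n) 0ℓ
  IsParentOf p v = Adj G p v × height v ≡ suc (height p)

  Level : ℕ → Set
  Level h = Σ[ v ∈ Fin n ] height v ≡ h

  -- Only the comparisons of _≺_ within one level are relevant.
  record IsOrdering (_≺_ : Rel (Fin n) 0ℓ) : Set where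
    field
      linear     : ∀ h → 1 ≤ h → IsStrictTotalOrder {A = Level h} (_≡_ on proj₁) (_≺_ on proj₁)
      compatible : ∀ {u v p q} → height u ≡ height v → IsParentOf p u → IsParentOf q v →
                   p ≢ q → (u ≺ v ⇔ p ≺ q)

  -- ecc G root is the highest level.
  IsParentOfTopPendant : Fin n → Set
  IsParentOfTopPendant p = ∃[ v ] (IsParentOf p v × IsPendant G v × height v ≡ ecc G root)

  record IsRgood : Set₁ where
    field
      isRootedBinaryTree : IsRootedBinaryTree
      balanced           : ∀ u v → IsPendant G u → IsPendant G v → ∣ height u - height v ∣ ≤ 1
      _≺_                : Rel (Fin n) 0ℓ
      isOrdering         : IsOrdering _≺_
      finalSegment       : ∀ p q → IsParentOfTopPendant p → suc (height q) ≡ ecc G root →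
                           p ≺ q → IsParentOfTopPendant q

IsBinaryCaterpillar : ∀ {n} → Graph n → Set
IsBinaryCaterpillar G = IsBinaryTree G ×
  ∃[ vs ] (IsPath G vs × (∀ v → v ∉ vs → ∃[ u ] (u ∈ vs × Adj G v u)))

-- G is, up to isomorphism, obtained from the disjoint union of A and B by
-- identifying the vertex x of A with the vertex y of B.
record IsIdentification {a b n} (A : Graph a) (x : Fin a) (B : Graph b) (y : Fin b)
                        (G : Graph n) : Set where
  field
    inA         : Fin a → Fin n
    inB         : Fin b → Fin n
    inA-inj     : Injective _≡_ _≡_ inA
    inB-inj     : Injective _≡_ _≡_ inB
    identified  : inA x ≡ inB y
    disjoint    : ∀ {i j} → inA i ≡ inB j → i ≡ x × j ≡ y
    covers      : ∀ v → (∃[ i ] inA i ≡ v) ⊎ (∃[ j ] inB j ≡ v)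
    edges       : ∀ u v → Adj G u v ⇔
                  ((∃[ i ] ∃[ i′ ] (inA i ≡ u × inA i′ ≡ v × Adj A i i′)) ⊎
                   (∃[ j ] ∃[ j′ ] (inB j ≡ u × inB j′ ≡ v × Adj B j j′)))

record IsCrg (n l : ℕ) (G : Graph n) : Set₁ where
  field
    n-even           : 2 ∣ n
    4≤n              : 4 ≤ n
    l-odd            : 2 ∤ l
    3≤l              : 3 ≤ l
    l<n              : l < n
    R                : Graph l
    root             : Fin l
    isRgood          : IsRgood R root
    K                : Graph (n ∸ l + 1)
    isCaterpillar    : IsBinaryCaterpillar K
    end              : Fin (n ∸ l + 1)
    end-maxEcc       : ∀ u → ecc K u ≤ ecc K end
    isIdentification : IsIdentification R root K end G

IsCrgTree : ∀ {n} → Graph n → Set₁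
IsCrgTree {n} G = ∃[ l ] IsCrg n l G

centerCoreDist : ∀ {n} → Graph n → ℕ
centerCoreDist G = setDist G (center G) (subtreeCore G)

{-# OPTIONS --safe #-}

-- For a rooted binary tree t let x(t) be one more than the number of subtrees containing the root, so that
-- x is 2 for a leaf and 1 + x(l) x(r) for a root with branches l and r. Removing an edge uv of a binary tree
-- leaves branches t and t' at u and v with f(u) = (x(t) - 1) x(t'), so f(u) > f(v) if and only if x(t) > x(t').
-- Suppose that the centre and the core of T are at distance D > 0, and let ps be the last edge of a shortest
-- path from the centre to the core, with branches t at p and t' at s. Then x(t) < x(t'), and following the
-- heights of the two branches along the path gives height(t) >= 2D - 1 + height(t'). Among the rooted binary
-- trees with a given number of leaves, x is maximal for the complete (rgood) tree and minimal for the
-- caterpillar. So in the crg tree with as many vertices in its two parts as t' and t have, the rgood part is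
-- still the heavier one and contains the core, while the caterpillar is so long that the centre stays at
-- distance at least D from the rgood part. Hence one of the finitely many crg trees on n vertices dominates.

module Submission where

open import Defs
open import Data.Bool.Base using (Bool; true; false; T; _∧_; _∨_)
open import Data.Bool.Properties using (T?; T-∧; T-∨; T-≡; ∨-comm)
open import Data.Empty using (⊥; ⊥-elim)
open import Data.Fin.Base using (Fin; toℕ; fromℕ<) renaming (zero to fzero; suc to fsuc)
open import Data.Fin.Properties using (any?; toℕ<n; toℕ-fromℕ<; toℕ-injective) renaming (_≟_ to _≟ᶠ_; <-isStrictTotalOrder to <ᶠ-isStrictTotalOrder)
open import Data.Fin.Subset using (Subset; ∣_∣) renaming (_∈_ to _∈ˢ_)
open import Data.Fin.Subset.Properties using () renaming (_∈?_ to _∈ˢ?_)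
open import Data.List.Base as List using (List; []; _∷_; _++_; length; map; filter; allFin; upTo; cartesianProduct; cartesianProductWith)
open import Data.List.Extrema.Nat using (argmin; argmax; f[argmin]≤f[xs]; f[xs]≤f[argmax]; min≤⊤; min≤xs; v≤min⁺; max≤v⁺; xs≤max)
open import Data.List.Membership.Propositional using (_∈_; _∉_)
open import Data.List.Membership.Propositional.Properties
open import Data.List.Properties using (length-++; length-map; length-tabulate)
open import Data.List.Relation.Unary.All as All using ([]; _∷_)
open import Data.List.Relation.Unary.AllPairs using ([]; _∷_)
open import Data.List.Relation.Unary.Any using (here; there)
open import Data.List.Relation.Unary.Linked using (Linked; [-]; _∷_)
open import Data.List.Relation.Unary.Unique.Propositional using (Unique)
open import Data.Nat.Base
open import Data.Nat.Divisibility using (_∣_; divides)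
open import Data.Nat.Induction using (<-rec)
open import Data.Nat.Logarithm using (⌊log₂_⌋; ⌊log₂⌋-mono-≤; ⌊log₂[2^n]⌋≡n; ⌊log₂⌊n/2⌋⌋≡⌊log₂n⌋∸1)
open import Data.Nat.Properties
open import Data.Nat.Tactic.RingSolver using (solve-∀)
open import Data.Product.Base using (Σ-syntax; ∃-syntax; _×_; _,_; proj₁; proj₂)
open import Data.Sum.Base as Sum using (_⊎_; inj₁; inj₂)
open import Data.Vec.Base as Vec using (Vec; lookup; tabulate)
open import Data.Vec.Properties as Vec using (tabulate∘lookup; tabulate-cong; lookup∘tabulate; []=⇒lookup; lookup⇒[]=)
open import Function.Base using (_∘_; id; flip)
open import Function.Bundles using (Equivalence; mk⇔)
open import Relation.Binary.Construct.Closure.ReflexiveTransitive as Star using (Star; ε; _◅_; _◅◅_)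
open import Relation.Binary.Definitions using (tri<; tri≈; tri>)
open import Relation.Binary.PropositionalEquality
open import Relation.Nullary
open import Relation.Nullary.Decidable using (_×-dec_; _⊎-dec_; isYes; toWitness; fromWitness)
import Data.List.Membership.DecPropositional as DecMembership
import Data.List.Relation.Unary.Unique.Propositional.Properties as Unique
import Relation.Binary.Construct.Flip.EqAndOrd as Flip
import Relation.Binary.Construct.On as On

-- Weights of rooted binary trees

-- The main obstacle is the maximality of complete trees. It amounts to the superadditivity
-- `1 + best a * best b ≤ best (a + b)`, and moving leaves from one branch to the other is awkward
-- because a weight is one plus a product. Hence products of weights are compared first, for trees
-- of equal level, then of consecutive levels, then in general; sums are controlled through
-- products. Heights favour the crg tree on both sides. A branch has at least as many internal
-- vertices as its height, and a caterpillar turns all of them into length; a complete tree is as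
-- low as its number of leaves permits. Passing to the crg tree whose parts have the orders of the
-- two branches thus lengthens the centre's side and flattens the core's side, if it changes them at
-- all, while the extremal weights keep the core where it is. Which crg tree is best is never
-- determined: each binary tree with positive distance is compared only with the crg tree of its own
-- two orders.

rearrange : ∀ {a b x y} → a ≤ b → x ≤ y → a * y + b * x ≤ a * x + b * y
rearrange {a} {b} {x} {y} a≤b x≤y with m≤n⇒∃[o]m+o≡n a≤b | m≤n⇒∃[o]m+o≡n x≤y
... | (d , refl) | (e , refl) = begin
  a * (x + e) + (a + d) * x           ≤⟨ m≤m+n _ (d * e) ⟩
  a * (x + e) + (a + d) * x + d * e   ≡⟨ eq a d x e ⟩
  a * x + (a + d) * (x + e)           ∎
  where
  open ≤-Reasoning
  eq : ∀ a d x e → a * (x + e) + (a + d) * x + d * e ≡ a * x + (a + d) * (x + e)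
  eq = solve-∀

-- Expanding `(u - p)(v - p) ≥ 0` gives `p(u + v) ≤ p² + uv`. Sums derived from products in this way
-- are what the summand 1 of a weight calls for, since `1+-product` needs both.
sum≤-extreme-min : ∀ {p s u v} → 1 ≤ p → p ≤ u → p ≤ v → u * v ≤ p * s → u + v ≤ p + s
sum≤-extreme-min {p@(suc _)} {s} {u} {v} _ p≤u p≤v uv≤ps = *-cancelˡ-≤ p (begin
  p * (u + v)      ≡⟨ eq p u v ⟩
  p * v + u * p    ≤⟨ rearrange p≤u p≤v ⟩
  p * p + u * v    ≤⟨ +-monoʳ-≤ (p * p) uv≤ps ⟩
  p * p + p * s    ≡⟨ sym (*-distribˡ-+ p p s) ⟩
  p * (p + s)      ∎)
  where
  open ≤-Reasoning
  eq : ∀ p u v → p * (u + v) ≡ p * v + u * p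
  eq = solve-∀

-- The same expansion, for `(s - u)(s - v) ≥ 0`.
sum≤-extreme-max : ∀ {p s u v} → 1 ≤ s → u ≤ s → v ≤ s → u * v ≤ p * s → u + v ≤ p + s
sum≤-extreme-max {p} {s@(suc _)} {u} {v} _ u≤s v≤s uv≤ps = *-cancelˡ-≤ s (begin
  s * (u + v)      ≡⟨ eq s u v ⟩
  u * s + s * v    ≤⟨ rearrange u≤s v≤s ⟩
  u * v + s * s    ≤⟨ +-monoˡ-≤ (s * s) uv≤ps ⟩
  p * s + s * s    ≡⟨ eq′ p s ⟩
  s * (p + s)      ∎)
  where
  open ≤-Reasoning
  eq : ∀ s u v → s * (u + v) ≡ u * s + s * v
  eq = solve-∀
  eq′ : ∀ p s → p * s + s * s ≡ s * (p + s)
  eq′ = solve-∀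

1+-product : ∀ {a b a′ b′} → a + b ≤ a′ + b′ → a * b ≤ a′ * b′ → suc a * suc b ≤ suc a′ * suc b′
1+-product {a} {b} {a′} {b′} s p = begin
  suc a * suc b           ≡⟨ eq a b ⟩
  suc (a + b + a * b)     ≤⟨ s≤s (+-mono-≤ s p) ⟩
  suc (a′ + b′ + a′ * b′) ≡⟨ sym (eq a′ b′) ⟩
  suc a′ * suc b′         ∎
  where
  open ≤-Reasoning
  eq : ∀ a b → suc a * suc b ≡ suc (a + b + a * b)
  eq = solve-∀

scale-product : ∀ a b {u v s t} → u * v ≤ s * t → (a * u) * (b * v) ≤ (a * s) * (b * t)
scale-product a b {u} {v} {s} {t} h = begin
  (a * u) * (b * v)   ≡⟨ eq a b u v ⟩
  (a * b) * (u * v)   ≤⟨ *-monoʳ-≤ (a * b) h ⟩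
  (a * b) * (s * t)   ≡⟨ sym (eq a b s t) ⟩
  (a * s) * (b * t)   ∎
  where
  open ≤-Reasoning
  eq : ∀ a b u v → (a * u) * (b * v) ≡ (a * b) * (u * v)
  eq = solve-∀

scale-sum : ∀ {a b u v s t} → a ≤ b → v ≤ t → u + v ≤ s + t → a * u + b * v ≤ a * s + b * t
scale-sum {a} {b} {u} {v} {s} {t} a≤b v≤t h with m≤n⇒∃[o]m+o≡n v≤t
... | (e , refl) = begin
  a * u + b * v              ≤⟨ +-monoˡ-≤ (b * v) (*-monoʳ-≤ a u≤s+e) ⟩
  a * (s + e) + b * v        ≡⟨ eq a s e b v ⟩
  a * s + (b * v + a * e)    ≤⟨ +-monoʳ-≤ (a * s) (+-monoʳ-≤ (b * v) (*-monoˡ-≤ e a≤b)) ⟩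
  a * s + (b * v + b * e)    ≡⟨ cong (a * s +_) (sym (*-distribˡ-+ b v e)) ⟩
  a * s + b * (v + e)        ∎
  where
  open ≤-Reasoning
  eq : ∀ a s e b v → a * (s + e) + b * v ≡ a * s + (b * v + a * e)
  eq = solve-∀
  eq′ : ∀ s v e → s + (v + e) ≡ s + e + v
  eq′ = solve-∀
  u≤s+e : u ≤ s + e
  u≤s+e = +-cancelʳ-≤ v u (s + e) (subst (u + v ≤_) (eq′ s v e) h)

-- X k j is the weight (defined below) of the complete binary tree with 2 ^ k + j leaves, where j ≤ 2 ^ k.
X : ℕ → ℕ → ℕ
X zero    zero    = 2
X zero    (suc _) = 5
X (suc k) j       = 1 + X k (j ⊓ 2 ^ k) * X k (j ∸ 2 ^ k)

X-mono : ∀ k {i j} → i ≤ j → X k i ≤ X k j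
X-mono zero    {zero}  {zero}  _ = ≤-refl
X-mono zero    {zero}  {suc j} _ = s≤s (s≤s z≤n)
X-mono zero    {suc i} {suc j} _ = ≤-refl
X-mono (suc k) {i} {j} i≤j =
  s≤s (*-mono-≤ (X-mono k (⊓-monoˡ-≤ (2 ^ k) i≤j)) (X-mono k (∸-monoˡ-≤ (2 ^ k) i≤j)))

X-pos : ∀ k j → 1 ≤ X k j
X-pos zero    zero    = s≤s z≤n
X-pos zero    (suc j) = s≤s z≤n
X-pos (suc k) j       = s≤s z≤n

-- As long as the last level is at most half filled, it lies in one branch, and the other branch is
-- perfect.
X-low : ∀ k {j} → j ≤ 2 ^ k → X (suc k) j ≡ 1 + X k 0 * X k j
X-low k {j} j≤P rewrite m≤n⇒m⊓n≡m j≤P | m≤n⇒m∸n≡0 j≤P = cong suc (*-comm (X k j) (X k 0))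

X-high : ∀ k j → X (suc k) (2 ^ k + j) ≡ 1 + X k (2 ^ k) * X k j
X-high k j rewrite m≥n⇒m⊓n≡n (m≤m+n (2 ^ k) j) | m+n∸m≡n (2 ^ k) j = refl

2^suc : ∀ k → 2 ^ suc k ≡ 2 ^ k + 2 ^ k
2^suc k = cong (2 ^ k +_) (+-identityʳ (2 ^ k))

-- A perfect tree can be read in two ways, with a full last level or with an empty one below it.
X-full : ∀ k → X k (2 ^ k) ≡ X (suc k) 0
X-full zero    = refl
X-full (suc k) = begin
  X (suc k) (2 ^ suc k)                ≡⟨ cong (X (suc k)) (2^suc k) ⟩
  X (suc k) (2 ^ k + 2 ^ k)            ≡⟨ X-high k (2 ^ k) ⟩
  1 + X k (2 ^ k) * X k (2 ^ k)        ≡⟨ cong (λ z → 1 + z * z) (X-full k) ⟩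
  1 + X (suc k) 0 * X (suc k) 0        ≡⟨ sym (X-low (suc k) z≤n) ⟩
  X (suc (suc k)) 0                    ∎
  where open ≡-Reasoning

X-0≤full : ∀ k → X k 0 ≤ X k (2 ^ k)
X-0≤full k = X-mono k z≤n

data Split (p i : ℕ) : Set where
  low  : i ≤ p → Split p i
  high : ∀ j → i ≡ p + j → Split p i

split : ∀ p i → Split p i
split p i with ≤-total i p
... | inj₁ i≤p = low i≤p
... | inj₂ p≤i = high (i ∸ p) (sym (m+[n∸m]≡n p≤i))

-- For given i + j the product X k i * X k j is largest if i or j is one of the extreme values 0 and 2 ^ k.
ExtremesDominate : ℕ → Set
ExtremesDominate k = ∀ {i j} → i ≤ 2 ^ k → j ≤ 2 ^ k →
  (i + j ≤ 2 ^ k → X k i * X k j ≤ X k 0 * X k (i + j)) ×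
  (∀ e → i + j ≡ 2 ^ k + e → X k i * X k j ≤ X k e * X k (2 ^ k))

-- By `X-low` and `X-high` a weight at level `suc k` is one plus a fixed factor, `c` or `c′`, times
-- a weight at level `k`. Through `1+-product` each case becomes a product inequality, supplied by
-- the hypothesis for `k`, and a sum inequality, which follows from it.
module ExtremesStep (k : ℕ) (IH : ExtremesDominate k) where
  private
    P  = 2 ^ k
    c  = X k 0
    c′ = X k P

  prodLow : ∀ {i j} → i + j ≤ P → X k i * X k j ≤ c * X k (i + j)
  prodLow {i} {j} h = proj₁ (IH (≤-trans (m≤m+n i j) h) (≤-trans (m≤n+m j i) h)) h

  prodHigh : ∀ {i j e} → i ≤ P → j ≤ P → i + j ≡ P + e → X k i * X k j ≤ X k e * c′
  prodHigh i≤ j≤ h = proj₂ (IH i≤ j≤) _ h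

  sumLow : ∀ {i j} → i + j ≤ P → X k i + X k j ≤ c + X k (i + j)
  sumLow {i} {j} h = sum≤-extreme-min (X-pos k 0) (X-mono k z≤n) (X-mono k z≤n) (prodLow h)

  sumHigh : ∀ {i j e} → i ≤ P → j ≤ P → i + j ≡ P + e → X k i + X k j ≤ X k e + c′
  sumHigh {e = e} i≤ j≤ h =
    sum≤-extreme-max {p = X k e} (X-pos k P) (X-mono k i≤) (X-mono k j≤) (prodHigh i≤ j≤ h)

  Goal : ℕ → ℕ → Set
  Goal i j = (i + j ≤ 2 ^ suc k → X (suc k) i * X (suc k) j ≤ X (suc k) 0 * X (suc k) (i + j)) ×
    (∀ e → i + j ≡ 2 ^ suc k + e → X (suc k) i * X (suc k) j ≤ X (suc k) e * X (suc k) (2 ^ suc k))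

  full : X (suc k) (2 ^ suc k) ≡ suc (c′ * c′)
  full = trans (cong (X (suc k)) (2^suc k)) (X-high k P)

  ext : ∀ {a b c d A B C D : ℕ} → a ≡ suc A → b ≡ suc B → c ≡ suc C → d ≡ suc D →
        A + B ≤ C + D → A * B ≤ C * D → a * b ≤ c * d
  ext {A = A} {B} {C} {D} refl refl refl refl h h′ = 1+-product {A} {B} {C} {D} h h′

  half : ∀ {x} → P + x ≤ 2 ^ suc k → x ≤ P
  half {x} h = +-cancelˡ-≤ P x P (subst (P + x ≤_) (2^suc k) h)

  e≤ : ∀ {i j e} → i ≤ P → j ≤ P → i + j ≡ P + e → e ≤ P
  e≤ {i} {j} {e} i≤ j≤ h = +-cancelˡ-≤ P e P (subst (_≤ P + P) h (+-mono-≤ i≤ j≤))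

  low-low : ∀ {i j} → i ≤ P → j ≤ P → Goal i j
  low-low {i} {j} i≤ j≤ = case-≤ , case-≥
    where
    u = X k i
    v = X k j
    case-≤ : i + j ≤ 2 ^ suc k → _
    case-≤ _ with split P (i + j)
    ... | low h = ext (X-low k i≤) (X-low k j≤) (X-low k z≤n) (X-low k h)

            (subst₂ _≤_ (*-distribˡ-+ c u v) (*-distribˡ-+ c c (X k (i + j))) (*-monoʳ-≤ c (sumLow h)))
            (scale-product c c {u = u} {s = c} (prodLow h))
    ... | high e h = ext (X-low k i≤) (X-low k j≤) (X-low k z≤n)
          (trans (cong (X (suc k)) h) (X-high k e))
          sums prods
      where
      w = X k e
      open ≤-Reasoning
      eq : ∀ c w d → c * (w + d) ≡ c * d + c * w
      eq = solve-∀
      eq₂ : ∀ c d w → c * d + c * w ≡ c * d + w * c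
      eq₂ = solve-∀
      sums : c * u + c * v ≤ c * c + c′ * w
      sums = begin
        c * u + c * v     ≡⟨ sym (*-distribˡ-+ c u v) ⟩
        c * (u + v)       ≤⟨ *-monoʳ-≤ c (sumHigh i≤ j≤ h) ⟩
        c * (w + c′)      ≡⟨ *-distribˡ-+ c w c′ ⟩
        c * w + c * c′    ≡⟨ cong (c * w +_) (*-comm c c′) ⟩
        c * w + c′ * c    ≤⟨ rearrange (X-0≤full k) (X-mono k z≤n) ⟩
        c * c + c′ * w    ∎
      prods : c * u * (c * v) ≤ c * c * (c′ * w)
      prods = begin
        c * u * (c * v)     ≤⟨ scale-product c c {u = u} {s = w} (prodHigh i≤ j≤ h) ⟩
        c * w * (c * c′)    ≡⟨ eq′ c w c′ ⟩
        c * c * (c′ * w)    ∎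
        where
        eq′ : ∀ c w d → c * w * (c * d) ≡ c * c * (d * w)
        eq′ = solve-∀
    case-≥ : ∀ e → i + j ≡ 2 ^ suc k + e → _
    -- Here `i + j ≤ 2 ^ suc k`, so `e` is 0 and `i + j` is `2 ^ suc k`. At this boundary the two
    -- halves of `Goal` say the same.
    case-≥ e h = subst (λ z → lhs ≤ X (suc k) e * X (suc k) z) top
                   (subst (λ z → lhs ≤ X (suc k) z * X (suc k) (i + j)) (sym e≡0) (case-≤ S≤))
      where
      lhs = X (suc k) i * X (suc k) j
      S≤ : i + j ≤ 2 ^ suc k
      S≤ = subst (i + j ≤_) (sym (2^suc k)) (+-mono-≤ i≤ j≤)
      e≡0 : e ≡ 0
      e≡0 = n≤0⇒n≡0 (+-cancelˡ-≤ (2 ^ suc k) e 0 (subst₂ _≤_ h (sym (+-identityʳ (2 ^ suc k))) S≤))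
      top : i + j ≡ 2 ^ suc k
      top = trans h (trans (cong (2 ^ suc k +_) e≡0) (+-identityʳ (2 ^ suc k)))

  low-high : ∀ {i j} → i ≤ P → j ≤ P → Goal i (P + j)
  low-high {i} {j} i≤ j≤ = case-≤ , case-≥
    where
    u = X k i
    v = X k j
    shift : ∀ i P j → i + (P + j) ≡ P + (i + j)
    shift = solve-∀
    case-≤ : i + (P + j) ≤ 2 ^ suc k → _
    case-≤ h = ext (X-low k i≤) (X-high k j) (X-low k z≤n)
      (trans (cong (X (suc k)) (shift i P j)) (X-high k (i + j)))

        (scale-sum {u = u} {s = c} (X-0≤full k) (X-mono k (m≤n+m j i)) (sumLow h′))
        (scale-product c c′ {u = u} {s = c} (prodLow h′))
      where
      h′ : i + j ≤ P
      h′ = +-cancelˡ-≤ P (i + j) P (subst₂ _≤_ (shift i P j) (2^suc k) h)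
    case-≥ : ∀ e → i + (P + j) ≡ 2 ^ suc k + e → _
    case-≥ e h = ext (X-low k i≤) (X-high k j) (X-low k (e≤ i≤ j≤ h′)) full

        (scale-sum {u = u} {s = w} (X-0≤full k) (X-mono k j≤) (sumHigh i≤ j≤ h′))
        (scale-product c c′ {u = u} {s = w} (prodHigh i≤ j≤ h′))
      where
      w = X k e
      h′ : i + j ≡ P + e
      h′ = +-cancelˡ-≡ P (i + j) (P + e)
        (trans (sym (shift i P j)) (trans h (trans (cong (_+ e) (2^suc k)) (+-assoc P P e))))

  high-high : ∀ {i j} → i ≤ P → j ≤ P → Goal (P + i) (P + j)
  high-high {i} {j} i≤ j≤ = case-≤ , case-≥
    where
    u = X k i
    v = X k j
    shift : ∀ i P j → (P + i) + (P + j) ≡ P + P + (i + j)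
    shift = solve-∀
    case-≥ : ∀ e → (P + i) + (P + j) ≡ 2 ^ suc k + e → _
    case-≥ e h with +-cancelˡ-≡ (P + P) (i + j) e
                      (trans (sym (shift i P j)) (trans h (cong (_+ e) (2^suc k))))
    ... | refl with split P (i + j)
    ...   | low h′ = ext (X-high k i) (X-high k j) (X-low k h′) full sums prods
      where
      open ≤-Reasoning
      w = X k (i + j)
      sums : c′ * u + c′ * v ≤ c * w + c′ * c′
      sums = begin
        c′ * u + c′ * v   ≡⟨ sym (*-distribˡ-+ c′ u v) ⟩
        c′ * (u + v)      ≤⟨ *-monoʳ-≤ c′ (sumLow h′) ⟩
        c′ * (c + w)      ≡⟨ eq c c′ w ⟩
        c * c′ + c′ * w   ≤⟨ rearrange (X-0≤full k) (X-mono k h′) ⟩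
        c * w + c′ * c′   ∎
        where
        eq : ∀ c d w → d * (c + w) ≡ c * d + d * w
        eq = solve-∀
      prods : c′ * u * (c′ * v) ≤ c * w * (c′ * c′)
      prods = begin
        c′ * u * (c′ * v)   ≤⟨ scale-product c′ c′ {u = u} {s = c} (prodLow h′) ⟩
        c′ * c * (c′ * w)   ≡⟨ eq c c′ w ⟩
        c * w * (c′ * c′)   ∎
        where
        eq : ∀ c d w → d * c * (d * w) ≡ c * w * (d * d)
        eq = solve-∀
    ...   | high e h′ = ext (X-high k i) (X-high k j) (trans (cong (X (suc k)) h′) (X-high k e)) full

        (subst₂ _≤_ (*-distribˡ-+ c′ u v) (*-distribˡ-+ c′ w c′) (*-monoʳ-≤ c′ (sumHigh i≤ j≤ h′)))
        (scale-product c′ c′ {u = u} {s = w} (prodHigh i≤ j≤ h′))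
      where w = X k e
    case-≤ : (P + i) + (P + j) ≤ 2 ^ suc k → _
    -- Both summands are at least `P`, so `i + j` is 0: again the boundary shared by the two halves.
    case-≤ h = ≤-trans (case-≥ 0 top) (≤-reflexive (cong (λ z → X (suc k) 0 * X (suc k) z) (sym top′)))
      where
      s≤0 : i + j ≤ 0
      s≤0 = +-cancelˡ-≤ (P + P) (i + j) 0
              (subst₂ _≤_ (shift i P j) (trans (2^suc k) (sym (+-identityʳ (P + P)))) h)
      top′ : (P + i) + (P + j) ≡ 2 ^ suc k
      top′ = trans (shift i P j) (trans (cong (P + P +_) (n≤0⇒n≡0 s≤0))
               (trans (+-identityʳ (P + P)) (sym (2^suc k))))
      top : (P + i) + (P + j) ≡ 2 ^ suc k + 0
      top = trans top′ (sym (+-identityʳ (2 ^ suc k)))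

  swapGoal : ∀ {i j} → Goal i j → Goal j i
  swapGoal {i} {j} (f , g) =
    (λ h → subst₂ _≤_ (*-comm (X (suc k) i) (X (suc k) j)) (cong (λ z → X (suc k) 0 * X (suc k) z) (+-comm i j))
             (f (subst (_≤ 2 ^ suc k) (+-comm j i) h))) ,
    (λ e h → subst (_≤ X (suc k) e * X (suc k) (2 ^ suc k)) (*-comm (X (suc k) i) (X (suc k) j))
             (g e (trans (+-comm i j) h)))

  extremes-dominate-suc : ExtremesDominate (suc k)
  extremes-dominate-suc {i} {j} i≤ j≤ with split P i | split P j
  ... | low a        | low b        = low-low a b
  ... | low a        | high j′ refl = low-high a (half j≤)
  ... | high i′ refl | low b        = swapGoal (low-high b (half i≤))
  ... | high i′ refl | high j′ refl = high-high (half i≤) (half j≤)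

extremes-dominate : ∀ k → ExtremesDominate k
extremes-dominate zero {zero}  {zero}  _ _ = (λ _ → ≤-refl) , (λ e ())
extremes-dominate zero {zero}  {suc zero}  _ _ = (λ _ → ≤-refl) , (λ { zero _ → ≤-refl })
extremes-dominate zero {suc zero}  {zero}  _ _ = (λ _ → ≤-refl) , (λ { zero _ → ≤-refl })
extremes-dominate zero {suc zero}  {suc zero}  _ _ = (λ { (s≤s ()) }) , (λ { (suc zero) _ → ≤-refl })
extremes-dominate zero {suc (suc i)} (s≤s ()) _
extremes-dominate zero {_} {suc (suc i)} _ (s≤s ())
extremes-dominate (suc k) = ExtremesStep.extremes-dominate-suc k (extremes-dominate k)

-- At an extreme value one of the two branches is perfect, and then the joined tree is complete.
merge-same : ∀ k {i j} → i ≤ 2 ^ k → j ≤ 2 ^ k → 1 + X k i * X k j ≤ X (suc k) (i + j)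
merge-same k {i} {j} i≤ j≤ with split (2 ^ k) (i + j)
... | low h = ≤-trans (s≤s (proj₁ (extremes-dominate k i≤ j≤) h)) (≤-reflexive (sym (X-low k h)))
... | high e h = ≤-trans (s≤s (proj₂ (extremes-dominate k i≤ j≤) e h))
      (≤-reflexive (sym (trans (cong (X (suc k)) h) (trans (X-high k e) (cong suc (*-comm (X k (2 ^ k)) (X k e)))))))

module _ (k : ℕ) where
  private
    P  = 2 ^ k
    c  = X k 0
    c′ = X k P

    c′≡ : c′ ≡ 1 + c * c
    c′≡ = trans (X-full k) (X-low k z≤n)

    -- Multiplying out the weight `1 + a * u` of the larger tree leaves the product `u * v` of two
    -- trees of equal level, to which `extremes-dominate` applies.
    absorb : ∀ a {u v r B} → u * v ≤ r → v ≤ B → (1 + a * u) * v ≤ B + a * r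
    absorb a {u} {v} {r} {B} h v≤ = begin
      (1 + a * u) * v     ≡⟨ eq a u v ⟩
      v + a * (u * v)     ≤⟨ +-mono-≤ v≤ (*-monoʳ-≤ a h) ⟩
      B + a * r           ∎
      where
      open ≤-Reasoning
      eq : ∀ a u v → (1 + a * u) * v ≡ v + a * (u * v)
      eq = solve-∀

    half≤ : ∀ {x} → P + x ≤ 2 ^ suc k → x ≤ P
    half≤ {x} h = +-cancelˡ-≤ P x P (subst (P + x ≤_) (2^suc k) h)

    shift : ∀ P i j e → P + i + j ≡ P + e → i + j ≡ e
    shift P i j e h = +-cancelˡ-≡ P (i + j) e (trans (sym (+-assoc P i j)) h)

  -- The right-hand side is the product of the weights of the two branches of the complete tree with
  -- `(2 ^ suc k + i) + (2 ^ k + j)` leaves. That tree still has level `suc k` here; in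
  -- `product-next-high` it has reached the next one.
  product-next-low : ∀ {i j} → j ≤ P → i + j ≤ P → X (suc k) i * X k j ≤ c′ * X k (i + j)
  product-next-low {i} {j} j≤ h = begin
    X (suc k) i * v          ≡⟨ cong (_* v) (X-low k i≤) ⟩
    (1 + c * X k i) * v      ≤⟨ absorb c (proj₁ (extremes-dominate k i≤ j≤) h) (X-mono k (m≤n+m j i)) ⟩
    w + c * (c * w)          ≡⟨ eq c w ⟩
    (1 + c * c) * w          ≡⟨ cong (_* w) (sym c′≡) ⟩
    c′ * w                   ∎
    where
    open ≤-Reasoning
    v = X k j
    w = X k (i + j)
    i≤ : i ≤ P
    i≤ = ≤-trans (m≤m+n i j) h
    eq : ∀ c w → w + c * (c * w) ≡ (1 + c * c) * w
    eq = solve-∀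

  product-next-high : ∀ {i j e} → i ≤ 2 ^ suc k → j ≤ P → i + j ≡ P + e → X (suc k) i * X k j ≤ c′ * X (suc k) e
  product-next-high {i} {j} {e} i≤ j≤ h with split P i
  ... | low i≤P = begin
    X (suc k) i * v          ≡⟨ cong (_* v) (X-low k i≤P) ⟩
    (1 + c * X k i) * v      ≤⟨ absorb c (proj₂ (extremes-dominate k i≤P j≤) e h) (X-mono k j≤) ⟩
    c′ + c * (X k e * c′)    ≡⟨ eq c c′ (X k e) ⟩
    c′ * (1 + c * X k e)     ≡⟨ cong (c′ *_) (sym (X-low k e≤P)) ⟩
    c′ * X (suc k) e         ∎
    where
    open ≤-Reasoning
    v = X k j
    e≤P : e ≤ P
    e≤P = +-cancelˡ-≤ P e P (subst (_≤ P + P) h (+-mono-≤ i≤P j≤))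
    eq : ∀ c d w → d + c * (w * d) ≡ d * (1 + c * w)
    eq = solve-∀
  ... | high i′ refl with shift P i′ j e h | split P e
  ...   | refl | low e≤P = begin
    X (suc k) (P + i′) * v   ≡⟨ cong (_* v) (X-high k i′) ⟩
    (1 + c′ * X k i′) * v    ≤⟨ absorb c′ (proj₁ (extremes-dominate k (half≤ i≤) j≤) e≤P) (X-mono k j≤) ⟩
    c′ + c′ * (c * w)        ≡⟨ eq c c′ w ⟩
    c′ * (1 + c * w)         ≡⟨ cong (c′ *_) (sym (X-low k e≤P)) ⟩
    c′ * X (suc k) (i′ + j)  ∎
    where
    open ≤-Reasoning
    v = X k j
    w = X k (i′ + j)
    eq : ∀ c d w → d + d * (c * w) ≡ d * (1 + c * w)
    eq = solve-∀
  ...   | refl | high e′ h′ = begin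
    X (suc k) (P + i′) * v   ≡⟨ cong (_* v) (X-high k i′) ⟩
    (1 + c′ * X k i′) * v    ≤⟨ absorb c′ (proj₂ (extremes-dominate k (half≤ i≤) j≤) e′ h′) (X-mono k j≤) ⟩
    c′ + c′ * (w * c′)       ≡⟨ eq c′ w ⟩
    c′ * (1 + c′ * w)        ≡⟨ cong (c′ *_) (sym (trans (cong (X (suc k)) h′) (X-high k e′))) ⟩
    c′ * X (suc k) (i′ + j)  ∎
    where
    open ≤-Reasoning
    v = X k j
    w = X k e′
    eq : ∀ d w → d + d * (w * d) ≡ d * (1 + d * w)
    eq = solve-∀

log₂-unique : ∀ k j → j < 2 ^ k → ⌊log₂ (2 ^ k + j) ⌋ ≡ k
log₂-unique zero    zero _ = refl
log₂-unique zero    (suc j) (s≤s ())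
log₂-unique (suc k) j j< = begin
  L                     ≡⟨ sym (m+[n∸m]≡n 1≤L) ⟩
  1 + (L ∸ 1)           ≡⟨ cong suc (sym (⌊log₂⌊n/2⌋⌋≡⌊log₂n⌋∸1 N)) ⟩
  1 + ⌊log₂ ⌊ N /2⌋ ⌋   ≡⟨ cong (λ z → suc ⌊log₂ z ⌋) halves ⟩
  1 + ⌊log₂ (2 ^ k + ⌊ j /2⌋) ⌋ ≡⟨ cong suc (log₂-unique k ⌊ j /2⌋ j/2<) ⟩
  suc k                 ∎
  where
  open ≡-Reasoning
  N = 2 ^ suc k + j
  L = ⌊log₂ N ⌋
  1≤L : 1 ≤ L
  1≤L = ≤-trans (s≤s z≤n) (≤-trans (≤-reflexive (sym (⌊log₂[2^n]⌋≡n (suc k)))) (⌊log₂⌋-mono-≤ (m≤m+n (2 ^ suc k) j)))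
  double-half : ∀ a j → ⌊ (a + a) + j /2⌋ ≡ a + ⌊ j /2⌋
  double-half zero    j = refl
  double-half (suc a) j rewrite +-suc a a = cong suc (double-half a j)
  halves : ⌊ N /2⌋ ≡ 2 ^ k + ⌊ j /2⌋
  halves = trans (cong (λ z → ⌊ z + j /2⌋) (2^suc k)) (double-half (2 ^ k) j)
  j/2< : ⌊ j /2⌋ < 2 ^ k
  j/2< = ≰⇒> λ P≤ → <⇒≱ j< (≤-trans (≤-reflexive (2^suc k)) (≤-trans (+-mono-≤ P≤ (≤-trans P≤ (⌊n/2⌋≤⌈n/2⌉ j)))
            (≤-reflexive (⌊n/2⌋+⌈n/2⌉≡n j))))

-- The weight of the complete tree with n leaves; junk value at n = 0.
best : ℕ → ℕ
best n = X ⌊log₂ n ⌋ (n ∸ 2 ^ ⌊log₂ n ⌋)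

-- At `j = 2 ^ k` the logarithm has already moved on to `suc k`; `X-full` bridges the jump, so that
-- the bounds from `split`, which permit equality, can be used directly.
best-level : ∀ k {j} → j ≤ 2 ^ k → best (2 ^ k + j) ≡ X k j
best-level k {j} j≤ with m≤n⇒m<n∨m≡n j≤
... | inj₁ j< rewrite log₂-unique k j j< | m+n∸m≡n (2 ^ k) j = refl
... | inj₂ refl rewrite sym (2^suc k) | ⌊log₂[2^n]⌋≡n (suc k) | n∸n≡0 (2 ^ suc k) = sym (X-full k)

record Dyadic (n : ℕ) : Set where
  constructor dyadic
  field
    k j   : ℕ
    j<    : j < 2 ^ k
    n≡    : n ≡ 2 ^ k + j

dyadicForm : ∀ n → 1 ≤ n → Dyadic n
dyadicForm (suc zero) _ = dyadic 0 0 (s≤s z≤n) refl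
dyadicForm (suc n@(suc _)) _ with dyadicForm n (s≤s z≤n)
... | dyadic k j j< n≡ with m≤n⇒m<n∨m≡n j<
...   | inj₁ sj< = dyadic k (suc j) sj< (trans (cong suc n≡) (sym (+-suc (2 ^ k) j)))
...   | inj₂ sj≡ = dyadic (suc k) 0 (m^n>0 2 (suc k))
        (trans (cong suc n≡) (trans (sym (+-suc (2 ^ k) j))
          (trans (cong (2 ^ k +_) sj≡) (trans (sym (2^suc k)) (sym (+-identityʳ (2 ^ suc k)))))))

merge-sameᴳ : ∀ k {i j} → i ≤ 2 ^ k → j ≤ 2 ^ k → 1 + best (2 ^ k + i) * best (2 ^ k + j) ≤ best ((2 ^ k + i) + (2 ^ k + j))
merge-sameᴳ k {i} {j} i≤ j≤ = begin
  1 + best (P + i) * best (P + j)  ≡⟨ cong₂ (λ a b → 1 + a * b) (best-level k i≤) (best-level k j≤) ⟩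
  1 + X k i * X k j          ≤⟨ merge-same k i≤ j≤ ⟩
  X (suc k) (i + j)          ≡⟨ sym (best-level (suc k) (subst (i + j ≤_) (sym (2^suc k)) (+-mono-≤ i≤ j≤))) ⟩
  best (2 ^ suc k + (i + j))    ≡⟨ cong best (trans (cong (_+ (i + j)) (2^suc k)) (eq P i j)) ⟩
  best ((P + i) + (P + j))      ∎
  where
  open ≤-Reasoning
  P = 2 ^ k
  eq : ∀ P i j → P + P + (i + j) ≡ (P + i) + (P + j)
  eq = solve-∀

merge-nextᴳ : ∀ k {i j} → i ≤ 2 ^ suc k → j ≤ 2 ^ k →
              1 + best (2 ^ suc k + i) * best (2 ^ k + j) ≤ best ((2 ^ suc k + i) + (2 ^ k + j))
merge-nextᴳ k {i} {j} i≤ j≤ with split (2 ^ k) (i + j)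
... | low h = begin
  1 + best (2 ^ suc k + i) * best (P + j)  ≡⟨ cong₂ (λ a b → 1 + a * b) (best-level (suc k) i≤) (best-level k j≤) ⟩
  1 + X (suc k) i * X k j            ≤⟨ s≤s (product-next-low k j≤ h) ⟩
  1 + X k P * X k (i + j)            ≡⟨ sym (X-high k (i + j)) ⟩
  X (suc k) (P + (i + j))            ≡⟨ sym (best-level (suc k) (subst (P + (i + j) ≤_) (sym (2^suc k)) (+-monoʳ-≤ P h))) ⟩
  best (2 ^ suc k + (P + (i + j)))      ≡⟨ cong best (eq (2 ^ suc k) P i j) ⟩
  best ((2 ^ suc k + i) + (P + j))      ∎
  where
  open ≤-Reasoning
  P = 2 ^ k
  eq : ∀ Q P i j → Q + (P + (i + j)) ≡ (Q + i) + (P + j)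
  eq = solve-∀
... | high e h = begin
  1 + best (Q + i) * best (P + j)          ≡⟨ cong₂ (λ a b → 1 + a * b) (best-level (suc k) i≤) (best-level k j≤) ⟩
  1 + X (suc k) i * X k j            ≤⟨ s≤s (product-next-high k i≤ j≤ h) ⟩
  1 + X k P * X (suc k) e            ≡⟨ cong (λ z → 1 + z * X (suc k) e) (X-full k) ⟩
  1 + X (suc k) 0 * X (suc k) e      ≡⟨ sym (X-low (suc k) e≤Q) ⟩
  X (suc (suc k)) e                  ≡⟨ sym (best-level (suc (suc k)) (≤-trans e≤Q (^-monoʳ-≤ 2 (n≤1+n (suc k))))) ⟩
  best (2 ^ suc (suc k) + e)            ≡⟨ cong best total ⟩
  best ((Q + i) + (P + j))              ∎
  where
  open ≤-Reasoning
  P = 2 ^ k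
  Q = 2 ^ suc k
  e≤Q : e ≤ Q
  e≤Q = +-cancelˡ-≤ P e Q (≤-trans (≤-reflexive (sym h)) (≤-trans (+-mono-≤ i≤ j≤) (≤-reflexive (+-comm Q P))))
  eq₁ : ∀ Q P e → Q + (P + P) + e ≡ Q + P + (P + e)
  eq₁ = solve-∀
  eq₂ : ∀ Q P i j → Q + P + (i + j) ≡ (Q + i) + (P + j)
  eq₂ = solve-∀
  total : 2 ^ suc (suc k) + e ≡ (Q + i) + (P + j)
  total = trans (cong (_+ e) (trans (2^suc (suc k)) (cong (Q +_) (2^suc k))))
            (trans (eq₁ Q P e) (trans (cong (Q + P +_) (sym h)) (eq₂ Q P i j)))

-- Two trees whose levels differ by at least two are merged by first merging the smaller one with the smaller
-- branch of the larger one.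
superadd-≥ : ∀ f a b → a + b ≤ f → 1 ≤ b → b ≤ a → 1 + best a * best b ≤ best (a + b)
superadd-≥ zero    a b a+b≤ 1≤b _ with ≤-trans 1≤b (≤-trans (m≤n+m b a) a+b≤)
... | ()
superadd-≥ (suc f) a b a+b≤ 1≤b b≤a with dyadicForm a (≤-trans 1≤b b≤a) | dyadicForm b 1≤b
... | dyadic ka i i< refl | dyadic kb j j< refl with <-cmp ka kb
...   | tri< ka<kb _ _ = ⊥-elim (<⇒≱ (<-≤-trans (subst (2 ^ ka + i <_) (sym (2^suc ka)) (+-monoʳ-< (2 ^ ka) i<))
                           (≤-trans (^-monoʳ-≤ 2 ka<kb) (m≤m+n (2 ^ kb) j))) b≤a)
...   | tri≈ _ refl _ = merge-sameᴳ ka (<⇒≤ i<) (<⇒≤ j<)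
...   | tri> _ _ kb<ka with m≤n⇒m<n∨m≡n kb<ka
...     | inj₂ refl = merge-nextᴳ kb (<⇒≤ i<) (<⇒≤ j<)
superadd-≥ (suc f) .(2 ^ ka + i) b a+b≤ 1≤b b≤a | dyadic ka@(suc k) i i< refl | dyadic kb j j< refl
        | tri> _ _ _ | inj₁ (s≤s kb<k) = begin
  1 + best (2 ^ suc k + i) * y        ≡⟨ cong (λ z → 1 + z * y) (best-level (suc k) (<⇒≤ i<)) ⟩
  1 + (1 + X k i₁ * X k i₂) * y    ≡⟨ cong₂ (λ u v → 1 + (1 + u * v) * y) (sym G₁) (sym G₂) ⟩
  1 + (1 + x₁ * x₂) * y            ≤⟨ s≤s (begin
    (1 + x₁ * x₂) * y              ≡⟨ eq x₁ x₂ y ⟩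
    y + x₁ * (x₂ * y)              ≤⟨ +-monoˡ-≤ _ y≤x₁ ⟩
    x₁ + x₁ * (x₂ * y)             ≡⟨ sym (*-suc x₁ (x₂ * y)) ⟩
    x₁ * (1 + x₂ * y)              ≤⟨ *-monoʳ-≤ x₁ (superadd-≥ f (P + i₂) b smaller 1≤b b≤a₂) ⟩
    x₁ * best (P + i₂ + b)            ∎) ⟩
  1 + x₁ * best (P + i₂ + b)          ≤⟨ last ⟩
  best ((P + i₁) + (P + i₂ + b))      ≡⟨ cong best (trans (eq′ P i₁ i₂ b) (cong (_+ b) (sym total))) ⟩
  best (2 ^ suc k + i + b)            ∎
  where
  open ≤-Reasoning
  P = 2 ^ k
  y = best b
  i₁ = i ⊓ P
  i₂ = i ∸ P
  i₁≤ : i₁ ≤ P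
  i₁≤ = m⊓n≤n i P
  i₂≤ : i₂ ≤ P
  i₂≤ = m≤n+o⇒m∸n≤o i P (subst (i ≤_) (2^suc k) (<⇒≤ i<))
  G₁ = best-level k i₁≤
  G₂ = best-level k i₂≤
  x₁ = best (P + i₁)
  x₂ = best (P + i₂)
  total : 2 ^ suc k + i ≡ (P + P) + (i₁ + i₂)
  total = cong₂ _+_ (2^suc k) (sym (trans (cong (_+ i₂) (⊓-comm i P)) (m⊓n+n∸m≡n P i)))
  eq : ∀ x₁ x₂ y → (1 + x₁ * x₂) * y ≡ y + x₁ * (x₂ * y)
  eq = solve-∀
  eq′ : ∀ P i₁ i₂ b → (P + i₁) + (P + i₂ + b) ≡ (P + P) + (i₁ + i₂) + b
  eq′ = solve-∀
  kb≤ : 2 ^ suc kb ≤ P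
  kb≤ = ^-monoʳ-≤ 2 kb<k
  b≤P : b ≤ P
  b≤P = ≤-trans (+-monoʳ-≤ (2 ^ kb) (<⇒≤ j<)) (≤-trans (≤-reflexive (sym (2^suc kb))) kb≤)
  b≤a₂ : b ≤ P + i₂
  b≤a₂ = ≤-trans b≤P (m≤m+n P i₂)
  X0-mono : ∀ {k k′} → k ≤′ k′ → X k 0 ≤ X k′ 0
  X0-mono ≤′-refl = ≤-refl
  X0-mono {k} {suc k′} (≤′-step p) =
    ≤-trans (X0-mono p) (≤-trans (X-0≤full k′) (≤-reflexive (X-full k′)))
  y≤x₁ : y ≤ x₁
  y≤x₁ = begin
    best (2 ^ kb + j)    ≡⟨ best-level kb (<⇒≤ j<) ⟩
    X kb j            ≤⟨ X-mono kb (<⇒≤ j<) ⟩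
    X kb (2 ^ kb)     ≡⟨ X-full kb ⟩
    X (suc kb) 0      ≤⟨ X0-mono (≤⇒≤′ kb<k) ⟩
    X k 0             ≤⟨ X-mono k z≤n ⟩
    X k i₁            ≡⟨ sym G₁ ⟩
    x₁                ∎
  smaller : P + i₂ + b ≤ f
  smaller = s≤s⁻¹ (<-≤-trans (+-monoˡ-< b (<-≤-trans (+-monoʳ-≤ (suc P) (m≤n+m i₂ i₁))
              (≤-trans (+-monoˡ-≤ (i₁ + i₂) (+-monoˡ-≤ P (m^n>0 2 k))) (≤-reflexive (sym total))))) a+b≤)
  last : 1 + x₁ * best (P + i₂ + b) ≤ best ((P + i₁) + (P + i₂ + b))
  last with split P (i₂ + b)
  ... | low h rewrite +-assoc P i₂ b = merge-sameᴳ k i₁≤ h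
  ... | high e h = subst (λ z → 1 + x₁ * best z ≤ best ((P + i₁) + z)) size
          (subst₂ _≤_ (cong suc (*-comm (best (2 ^ suc k + e)) x₁)) (cong best (+-comm (2 ^ suc k + e) (P + i₁)))
            (merge-nextᴳ k (≤-trans e≤ (^-monoʳ-≤ 2 (n≤1+n k))) i₁≤))
    where
    e≤ : e ≤ P
    e≤ = +-cancelˡ-≤ P e P (subst (_≤ P + P) h (+-mono-≤ i₂≤ b≤P))
    size : 2 ^ suc k + e ≡ P + i₂ + b
    size = trans (cong (_+ e) (2^suc k)) (trans (+-assoc P P e) (trans (cong (P +_) (sym h)) (sym (+-assoc P i₂ b))))

superadd : ∀ a b → 1 ≤ a → 1 ≤ b → 1 + best a * best b ≤ best (a + b)
superadd a b 1≤a 1≤b with ≤-total b a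
... | inj₁ b≤a = superadd-≥ (a + b) a b ≤-refl 1≤b b≤a
... | inj₂ a≤b = subst₂ _≤_ (cong suc (*-comm (best b) (best a))) (cong best (+-comm b a)) (superadd-≥ (b + a) b a ≤-refl 1≤a a≤b)

-- Rooted binary trees: extreme weights and heights

data Tree (A : Set) : Set where
  leaf : A → Tree A
  node : A → Tree A → Tree A → Tree A

module _ {A : Set} where

  -- One more than the number of subtrees containing the root.
  weight : Tree A → ℕ
  weight (leaf _)     = 2
  weight (node _ l r) = 1 + weight l * weight r

  internals : Tree A → ℕ
  internals (leaf _)     = 0
  internals (node _ l r) = suc (internals l + internals r)

  depth : Tree A → ℕ
  depth (leaf _)     = 0
  depth (node _ l r) = suc (depth l ⊔ depth r)

  -- A tree has one leaf more than internal vertices, and `superadd` handles the joining of two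
  -- branches.
  weight≤complete : ∀ t → weight t ≤ best (suc (internals t))
  weight≤complete (leaf _)     = ≤-refl
  weight≤complete (node _ l r) = begin
    1 + weight l * weight r                          ≤⟨ s≤s (*-mono-≤ (weight≤complete l) (weight≤complete r)) ⟩
    1 + best (suc (internals l)) * best (suc (internals r)) ≤⟨ superadd (suc (internals l)) (suc (internals r)) (s≤s z≤n) (s≤s z≤n) ⟩
    best (suc (internals l) + suc (internals r))        ≡⟨ cong (λ z → best (suc z)) (+-suc (internals l) (internals r)) ⟩
    best (suc (suc (internals l + internals r)))        ∎
    where open ≤-Reasoning

  weight≥2 : ∀ t → 2 ≤ weight t
  weight≥2 (leaf _)     = ≤-refl
  weight≥2 (node _ l r) = s≤s (≤-trans (s≤s z≤n) (*-mono-≤ (weight≥2 l) (weight≥2 r)))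

  weight-node≥5 : ∀ {a} l r → 5 ≤ weight (node a l r)
  weight-node≥5 l r = s≤s (*-mono-≤ (weight≥2 l) (weight≥2 r))

  -- Equality holds for the caterpillar.
  weight≥caterpillar : ∀ t → 3 * 2 ^ internals t ≤ suc (weight t)
  weight≥caterpillar (leaf _)     = ≤-refl
  weight≥caterpillar (node _ l r) = begin
    3 * (2 * 2 ^ (internals l + internals r))            ≡⟨ cong (λ z → 3 * (2 * z)) (^-distribˡ-+-* 2 (internals l) (internals r)) ⟩
    3 * (2 * (2 ^ internals l * 2 ^ internals r))        ≤⟨ combine (2 ^ internals l) (2 ^ internals r) (weight l) (weight r) (m^n>0 2 (internals l)) (m^n>0 2 (internals r))
                                                              (weight≥caterpillar l) (weight≥caterpillar r) ⟩
    2 + weight l * weight r                              ∎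
    where
    open ≤-Reasoning
    combine : ∀ p q x y → 1 ≤ p → 1 ≤ q → 3 * p ≤ suc x → 3 * q ≤ suc y → 3 * (2 * (p * q)) ≤ 2 + x * y
    combine (suc p) (suc q) x y _ _ hx hy = begin
      3 * (2 * (suc p * suc q))                                  ≤⟨ m≤m+n _ (3 * (p * q)) ⟩
      3 * (2 * (suc p * suc q)) + 3 * (p * q)                    ≡⟨ eq p q ⟩
      2 + (2 + 3 * p) * (2 + 3 * q)                              ≤⟨ +-monoʳ-≤ 2 (*-mono-≤ (lower p hx) (lower q hy)) ⟩
      2 + x * y                                                  ∎
      where
      eq : ∀ p q → 3 * (2 * (suc p * suc q)) + 3 * (p * q) ≡ 2 + (2 + 3 * p) * (2 + 3 * q)
      eq = solve-∀
      eq₁ : ∀ p → 3 * suc p ≡ suc (2 + 3 * p)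
      eq₁ = solve-∀
      lower : ∀ {x} p → 3 * suc p ≤ suc x → 2 + 3 * p ≤ x
      lower {x} p h = s≤s⁻¹ (subst (_≤ suc x) (eq₁ p) h)

  depth≤internals : ∀ t → depth t ≤ internals t
  depth≤internals (leaf _)     = z≤n
  depth≤internals (node _ l r) = s≤s (⊔-lub (≤-trans (depth≤internals l) (m≤m+n _ _)) (≤-trans (depth≤internals r) (m≤n+m _ _)))

  leaves≤2^depth : ∀ t → suc (internals t) ≤ 2 ^ depth t
  leaves≤2^depth (leaf _)     = ≤-refl
  leaves≤2^depth (node _ l r) = begin
    suc (suc (internals l + internals r))      ≡⟨ cong suc (sym (+-suc (internals l) (internals r))) ⟩
    suc (internals l) + suc (internals r)      ≤⟨ +-mono-≤ (leaves≤2^depth l) (leaves≤2^depth r) ⟩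
    2 ^ depth l + 2 ^ depth r                  ≤⟨ +-mono-≤ (^-monoʳ-≤ 2 (m≤m⊔n (depth l) (depth r))) (^-monoʳ-≤ 2 (m≤n⊔m (depth l) (depth r))) ⟩
    2 ^ m + 2 ^ m                              ≡⟨ sym (2^suc m) ⟩
    2 ^ suc m                                  ∎
    where
    open ≤-Reasoning
    m = depth l ⊔ depth r

-- Branches of a binary tree

module _ {A B : Set} (R : A → B → Set) where

  -- A pigeonhole principle for a relation instead of a function: equality of two counts follows by
  -- applying it to one relation in both directions, without an inverse map.
  length≤-by : ∀ (xs : List A) (ys : List B) → Unique xs →
    (∀ {x} → x ∈ xs → ∃[ y ] (y ∈ ys × R x y)) →
    (∀ {x x′ y} → x ∈ xs → x′ ∈ xs → R x y → R x′ y → x ≡ x′) →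
    length xs ≤ length ys
  length≤-by [] ys _ _ _ = z≤n
  length≤-by (x ∷ xs) ys (x∉ ∷ uxs) total inj with total (here refl)
  ... | y , y∈ , Rxy with ∈-∃++ y∈
  ... | as , bs , refl = begin
    suc (length xs)              ≤⟨ s≤s (length≤-by xs (as ++ bs) uxs total′ (λ p q → inj (there p) (there q))) ⟩
    suc (length (as ++ bs))      ≡⟨ cong suc (length-++ as) ⟩
    suc (length as + length bs)  ≡⟨ sym (+-suc (length as) (length bs)) ⟩
    length as + suc (length bs)  ≡⟨ sym (length-++ as) ⟩
    length (as ++ y ∷ bs)        ∎
    where
    open ≤-Reasoning
    total′ : ∀ {x′} → x′ ∈ xs → ∃[ z ] (z ∈ as ++ bs × R x′ z)
    total′ {x′} x′∈ with total (there x′∈)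
    ... | z , z∈ , Rz with ∈-++⁻ as z∈
    ...   | inj₁ z∈as = z , ∈-++⁺ˡ z∈as , Rz
    ...   | inj₂ (there z∈bs) = z , ∈-++⁺ʳ as z∈bs , Rz
    ...   | inj₂ (here refl) = ⊥-elim (All.lookup x∉ x′∈ (inj (here refl) (there x′∈) Rxy Rz))

length-unique≤ : ∀ {A : Set} {xs ys : List A} → Unique xs → (∀ {x} → x ∈ xs → x ∈ ys) → length xs ≤ length ys
length-unique≤ {xs = xs} {ys} u sub = length≤-by _≡_ xs ys u (λ x∈ → _ , sub x∈ , refl) (λ { _ _ refl refl → refl })

length-allFin : ∀ n → length (allFin n) ≡ n
length-allFin n = length-tabulate id

-- The induction passes from `g` to `g ∘ fsuc`, hence the general `g`; degrees use `g = id`.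
∣tabulate∣ : ∀ {A : Set} {n} (P : A → Bool) (g : Fin n → A) →
             ∣ Vec.tabulate (P ∘ g) ∣ ≡ length (filter (T? ∘ P) (List.tabulate g))
∣tabulate∣ {n = zero}  P g = refl
∣tabulate∣ {n = suc n} P g with P (g fzero)
... | true  = cong suc (∣tabulate∣ P (g ∘ fsuc))
... | false = ∣tabulate∣ P (g ∘ fsuc)

module _ {n : ℕ} (G : Graph n) where

  adjacent-sym : ∀ {u v} → Adj G u v → Adj G v u
  adjacent-sym {u} {v} = subst T (Graph.sym G u v)

  adjacent-irrefl : ∀ {v} → ¬ Adj G v v
  adjacent-irrefl {v} = subst T (Graph.irrefl G v)

  neighbours-list : Fin n → List (Fin n)
  neighbours-list v = filter (adj? G v) (allFin n)

  degree≡length-neighbours-list : ∀ v → degree G v ≡ length (neighbours-list v)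
  degree≡length-neighbours-list v = ∣tabulate∣ (Graph.adj G v) id

  ∈-neighbours-list⁺ : ∀ {v x} → Adj G v x → x ∈ neighbours-list v
  ∈-neighbours-list⁺ {v} {x} e = ∈-filter⁺ (adj? G v) (∈-allFin x) e

  ∈-neighbours-list⁻ : ∀ {v x} → x ∈ neighbours-list v → Adj G v x
  ∈-neighbours-list⁻ {v} x∈ = proj₂ (∈-filter⁻ (adj? G v) {xs = allFin n} x∈)

  neighbours-list-unique : ∀ v → Unique (neighbours-list v)
  neighbours-list-unique v = Unique.filter⁺ (adj? G v) (Unique.allFin⁺ n)

module _ {A : Set} where

  root : Tree A → A
  root (leaf a)     = a
  root (node a _ _) = a

  labels : Tree A → List A
  labels (leaf a)     = a ∷ []
  labels (node a l r) = a ∷ labels l ++ labels r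

  length-labels : ∀ t → length (labels t) ≡ suc (internals t + internals t)
  length-labels (leaf _)     = refl
  length-labels (node _ l r) = cong suc (trans (length-++ (labels l))
    (trans (cong₂ _+_ (length-labels l) (length-labels r)) (eq (internals l) (internals r))))
    where
    eq : ∀ a b → suc (a + a) + suc (b + b) ≡ suc (a + b) + suc (a + b)
    eq = solve-∀

  root∈labels : ∀ t → root t ∈ labels t
  root∈labels (leaf _)     = here refl
  root∈labels (node _ _ _) = here refl

  ∈-left : ∀ {x a l r} → x ∈ labels l → x ∈ labels (node a l r)
  ∈-left p = there (∈-++⁺ˡ p)

  ∈-right : ∀ {x a} l {r} → x ∈ labels r → x ∈ labels (node a l r)
  ∈-right l p = there (∈-++⁺ʳ (labels l) p)

  data InNode (x a : A) (l r : Tree A) : Set where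
    top   : x ≡ a → InNode x a l r
    left  : x ∈ labels l → InNode x a l r
    right : x ∈ labels r → InNode x a l r

  inNode : ∀ {x a} l r → x ∈ labels (node a l r) → InNode x a l r
  inNode l r (here p)  = top p
  inNode l r (there p) with ∈-++⁻ (labels l) p
  ... | inj₁ q = left q
  ... | inj₂ q = right q

-- Walks that never turn back at once. Unlike being a path this is a local condition, so walks can
-- be prolonged edge by edge; acyclicity upgrades them to paths in `reduced⇒unique`.
data Reduced {n : ℕ} (G : Graph n) : List (Fin n) → Set where
  [_]  : ∀ x → Reduced G (x ∷ [])
  one  : ∀ {x y} → Adj G x y → Reduced G (x ∷ y ∷ [])
  cons : ∀ {x y z xs} → Adj G x y → x ≢ z → Reduced G (y ∷ z ∷ xs) → Reduced G (x ∷ y ∷ z ∷ xs)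

module Acyclic {n : ℕ} (G : Graph n) (acyclic : ∀ v vs → ¬ IsCycle G v vs) where
  private variable
    a b p s u v w x y z : Fin n
    xs : List (Fin n)
    t l r : Tree (Fin n)

  Adj-sym : Adj G u v → Adj G v u
  Adj-sym = adjacent-sym G

  private
    prefix-linked : ∀ as {x bs} → Reduced G (as ++ x ∷ bs) → Linked (Adj G) (as ++ x ∷ [])
    prefix-linked [] _ = [-]
    prefix-linked (a ∷ []) (one e) = e ∷ [-]
    prefix-linked (a ∷ []) (cons e _ _) = e ∷ [-]
    prefix-linked (a ∷ b ∷ as) nb with as | nb
    ... | []    | cons e _ nb′ = e ∷ prefix-linked (b ∷ []) nb′
    ... | c ∷ as′ | cons e _ nb′ = e ∷ prefix-linked (b ∷ c ∷ as′) nb′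

    unique-rotate : ∀ {A : Set} (as : List A) {x bs} → Unique (as ++ x ∷ bs) → Unique (x ∷ as)
    unique-rotate as {x} {bs} u = All.tabulate (λ a∈ x≡a → x∉ as u (subst (_∈ as) (sym x≡a) a∈)) ∷ init as u
      where
      x∉ : ∀ as → Unique (as ++ x ∷ bs) → x ∉ as
      x∉ (a ∷ as) (a∉ ∷ _) (here refl) = All.lookup a∉ (∈-++⁺ʳ as (here refl)) refl
      x∉ (a ∷ as) (_ ∷ u) (there p) = x∉ as u p
      init : ∀ as → Unique (as ++ x ∷ bs) → Unique as
      init [] _ = []
      init (a ∷ as) (a∉ ∷ u) = All.tabulate (λ b∈ → All.lookup a∉ (∈-++⁺ˡ b∈)) ∷ init as u

  -- The first repetition would close a cycle.
  reduced⇒unique : Reduced G xs → Unique xs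
  reduced⇒unique [ x ] = [] ∷ []
  reduced⇒unique (one e) = ((λ { refl → adjacent-irrefl G e }) ∷ []) ∷ [] ∷ []
  reduced⇒unique {xs = x ∷ y ∷ z ∷ xs} (cons e x≢z nb) =
    All.tabulate (λ w∈ x≡w → fresh (subst (_∈ _) (sym x≡w) w∈)) ∷ unique
    where
    unique = reduced⇒unique nb
    fresh : x ∉ y ∷ z ∷ xs
    fresh (here refl) = adjacent-irrefl G e
    fresh (there (here x≡z)) = x≢z x≡z
    fresh (there (there x∈)) with ∈-∃++ x∈
    ... | as , bs , refl = acyclic x (y ∷ z ∷ as)
        (s≤s (s≤s z≤n) , unique-rotate (y ∷ z ∷ as) unique , e ∷ prefix-linked (y ∷ z ∷ as) nb)

  -- Branch p t : t is the component of root t once the edge from p to root t is removed.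
  data Branch (p : Fin n) : Tree (Fin n) → Set where
    leafᵇ : Adj G p s → (∀ x → Adj G s x → x ≡ p) → Branch p (leaf s)
    nodeᵇ : Adj G p s → root l ≢ p → root r ≢ p → root l ≢ root r →
            (∀ x → Adj G s x → x ≡ p ⊎ x ≡ root l ⊎ x ≡ root r) →
            Branch s l → Branch s r → Branch p (node s l r)

  branch-edge : Branch p t → Adj G p (root t)
  branch-edge (leafᵇ e _) = e
  branch-edge (nodeᵇ e _ _ _ _ _ _) = e

  branch-closed : Branch p t → x ∈ labels t → Adj G x y → y ∈ labels t ⊎ (x ≡ root t × y ≡ p)
  branch-closed (leafᵇ _ only) (here refl) e = inj₂ (refl , only _ e)
  branch-closed {x = x} {y} (nodeᵇ {s} {l} {r} _ _ _ _ only bl br) x∈ e with inNode l r x∈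
  ... | top refl with only _ e
  ...   | inj₁ y≡p = inj₂ (refl , y≡p)
  ...   | inj₂ (inj₁ refl) = inj₁ (∈-left {l = l} (root∈labels l))
  ...   | inj₂ (inj₂ refl) = inj₁ (∈-right l (root∈labels r))
  branch-closed (nodeᵇ {s} {l} {r} _ _ _ _ only bl br) x∈ e | left x∈l with branch-closed bl x∈l e
  ...   | inj₁ y∈ = inj₁ (∈-left {l = l} y∈)
  ...   | inj₂ (_ , refl) = inj₁ (here refl)
  branch-closed (nodeᵇ {s} {l} {r} _ _ _ _ only bl br) x∈ e | right x∈r with branch-closed br x∈r e
  ...   | inj₁ y∈ = inj₁ (∈-right l y∈)
  ...   | inj₂ (_ , refl) = inj₁ (here refl)

  -- Climbing from `x` to the root of the branch never turns back, and neither does leaving through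
  -- the root. The disjointness facts below rest on this: a vertex found in two places would occur
  -- twice on a reduced walk.
  ascend : Branch p t → x ∈ labels t → Reduced G (root t ∷ p ∷ xs) →
           ∃[ ys ] (Reduced G (x ∷ ys) × (∀ {z} → z ∈ p ∷ xs → z ∈ ys))
  ascend {p} {xs = xs} (leafᵇ _ _) (here refl) nb = p ∷ xs , nb , id
  ascend {p} {xs = xs} (nodeᵇ {s} {l} {r} _ l≢p r≢p _ _ bl br) x∈ nb with inNode l r x∈
  ... | top refl = p ∷ xs , nb , id
  ... | left x∈l with ascend bl x∈l (cons (Adj-sym (branch-edge bl)) l≢p nb)
  ...   | ys , nb′ , sub = ys , nb′ , sub ∘ there
  ascend {p} {xs = xs} (nodeᵇ {s} {l} {r} _ l≢p r≢p _ _ bl br) x∈ nb | right x∈r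
    with ascend br x∈r (cons (Adj-sym (branch-edge br)) r≢p nb)
  ...   | ys , nb′ , sub = ys , nb′ , sub ∘ there

  descend : Branch p t → x ∈ labels t → ∃[ ys ] (Reduced G (p ∷ root t ∷ ys) × x ∈ root t ∷ ys)
  descend (leafᵇ e _) (here refl) = [] , one e , here refl
  descend (nodeᵇ {s} {l} {r} e l≢p r≢p _ _ bl br) x∈ with inNode l r x∈
  ... | top refl = [] , one e , here refl
  ... | left x∈l with descend bl x∈l
  ...   | ys , nb , x∈′ = root l ∷ ys , cons e (l≢p ∘ sym) nb , there x∈′
  descend (nodeᵇ {s} {l} {r} e l≢p r≢p _ _ bl br) x∈ | right x∈r with descend br x∈r
  ...   | ys , nb , x∈′ = root r ∷ ys , cons e (r≢p ∘ sym) nb , there x∈′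

  private
    head∉tail : Unique (x ∷ xs) → x ∉ xs
    head∉tail = Unique.Unique[x∷xs]⇒x∉xs

  parent∉branch : Branch p t → p ∉ labels t
  parent∉branch b p∈ with ascend b p∈ (one (Adj-sym (branch-edge b)))
  ... | _ , nb , sub = head∉tail (reduced⇒unique nb) (sub (here refl))

  siblings-disjoint : Branch s l → Branch s r → root l ≢ root r → x ∈ labels l → x ∉ labels r
  siblings-disjoint bl br l≢r x∈l x∈r with descend br x∈r
  ... | ys , nb , x∈ with ascend bl x∈l (cons (Adj-sym (branch-edge bl)) l≢r nb)
  ... | _ , nb′ , sub = head∉tail (reduced⇒unique nb′) (sub (there x∈))

  branch-unique : Branch p t → Unique (labels t)
  branch-unique (leafᵇ _ _) = [] ∷ []
  branch-unique (nodeᵇ {s} {l} {r} _ _ _ l≢r _ bl br) =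
    All.tabulate fresh ∷ Unique.++⁺ (branch-unique bl) (branch-unique br) (λ (p , q) → siblings-disjoint bl br l≢r p q)
    where
    fresh : x ∈ labels l ++ labels r → s ≢ x
    fresh x∈ refl with ∈-++⁻ (labels l) x∈
    ... | inj₁ p = parent∉branch bl p
    ... | inj₂ p = parent∉branch br p

  -- The edge from root a to root b together with the two components its removal leaves.
  record Edge (a b : Tree (Fin n)) : Set where
    constructor edge
    field
      fst : Branch (root b) a
      snd : Branch (root a) b

  flip-edge : ∀ {a b} → Edge a b → Edge b a
  flip-edge (edge f g) = edge g f

  edge-disjoint : ∀ {a b} → Edge a b → x ∈ labels a → x ∉ labels b
  edge-disjoint (edge f g) x∈a x∈b with descend g x∈b
  ... | ys , nb , x∈ with ascend f x∈a nb
  ... | _ , nb′ , sub = head∉tail (reduced⇒unique nb′) (sub x∈)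

  -- Moves the distinguished edge one step into the second side: `v` changes sides, and its other
  -- branch `r` comes along. Following a path becomes a sequence of such rotations.
  rotateˡ : ∀ {a v l r} → Edge a (node v l r) → Edge (node v a r) l
  rotateˡ (edge f (nodeᵇ e l≢p r≢p l≢r only bl br)) =
    edge (nodeᵇ (Adj-sym (branch-edge bl)) (l≢p ∘ sym) (l≢r ∘ sym) (r≢p ∘ sym) only′ f br) bl
    where
    only′ : ∀ x → _ → _
    only′ x e with only x e
    ... | inj₁ p = inj₂ (inj₁ p)
    ... | inj₂ (inj₁ p) = inj₁ p
    ... | inj₂ (inj₂ p) = inj₂ (inj₂ p)

  rotateʳ : ∀ {a v l r} → Edge a (node v l r) → Edge (node v a l) r
  rotateʳ (edge f (nodeᵇ e l≢p r≢p l≢r only bl br)) =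
    edge (nodeᵇ (Adj-sym (branch-edge br)) (r≢p ∘ sym) l≢r (l≢p ∘ sym) only′ f bl) br
    where
    only′ : ∀ x → _ → _
    only′ x e with only x e
    ... | inj₁ p = inj₂ (inj₁ p)
    ... | inj₂ (inj₁ p) = inj₂ (inj₂ p)
    ... | inj₂ (inj₂ p) = inj₁ p

module BinaryTree {n : ℕ} (G : Graph n) (isBin : IsBinaryTree G) where

  connected : Connected G
  connected = proj₁ (proj₁ isBin)

  open Acyclic G (proj₂ (proj₁ isBin)) public

  private variable
    p s u v x y : Fin n
    xs : List (Fin n)

  data Neighbours (p s : Fin n) : Set where
    pendant : (∀ x → Adj G s x → x ≡ p) → Neighbours p s
    cubic   : ∀ a b → Adj G s a → Adj G s b → a ≢ p → b ≢ p → a ≢ b →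
              (∀ x → Adj G s x → x ≡ p ⊎ x ≡ a ⊎ x ≡ b) → Neighbours p s

  neighbours-of : Adj G p s → Neighbours p s
  neighbours-of {p} {s} e = from (neighbours-list G s) (neighbours-list-unique G s)
      (λ x → ∈-neighbours-list⁺ G) (λ x → ∈-neighbours-list⁻ G) size
    where
    size : length (neighbours-list G s) ≡ 1 ⊎ length (neighbours-list G s) ≡ 3
    size with degree G s ≟ 1
    ... | yes d = inj₁ (trans (sym (degree≡length-neighbours-list G s)) d)
    ... | no d = inj₂ (trans (sym (degree≡length-neighbours-list G s)) (proj₂ isBin s d))
    from : ∀ (L : List (Fin n)) → Unique L → (∀ x → Adj G s x → x ∈ L) → (∀ x → x ∈ L → Adj G s x) →
           length L ≡ 1 ⊎ length L ≡ 3 → Neighbours p s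
    from (a ∷ []) _ mem adj (inj₁ refl) with mem p (Adj-sym e)
    ... | here refl = pendant (λ x q → single (mem x q))
      where
      single : ∀ {x} → x ∈ a ∷ [] → x ≡ a
      single (here q) = q
    from (a ∷ b ∷ c ∷ []) ((a≢b ∷ a≢c ∷ []) ∷ (b≢c ∷ []) ∷ _) mem adj (inj₂ refl) with mem p (Adj-sym e)
    ... | here refl = cubic b c (adj b (there (here refl))) (adj c (there (there (here refl)))) (a≢b ∘ sym) (a≢c ∘ sym) b≢c
          (λ x q → three (mem x q))
      where
      three : ∀ {x} → x ∈ a ∷ b ∷ c ∷ [] → x ≡ a ⊎ x ≡ b ⊎ x ≡ c
      three (here q) = inj₁ q
      three (there (here q)) = inj₂ (inj₁ q)
      three (there (there (here q))) = inj₂ (inj₂ q)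
    ... | there (here refl) = cubic a c (adj a (here refl)) (adj c (there (there (here refl)))) a≢b (b≢c ∘ sym) a≢c
          (λ x q → three (mem x q))
      where
      three : ∀ {x} → x ∈ a ∷ b ∷ c ∷ [] → x ≡ b ⊎ x ≡ a ⊎ x ≡ c
      three (here q) = inj₂ (inj₁ q)
      three (there (here q)) = inj₁ q
      three (there (there (here q))) = inj₂ (inj₂ q)
    ... | there (there (here refl)) = cubic a b (adj a (here refl)) (adj b (there (here refl))) a≢c b≢c a≢b
          (λ x q → three (mem x q))
      where
      three : ∀ {x} → x ∈ a ∷ b ∷ c ∷ [] → x ≡ c ⊎ x ≡ a ⊎ x ≡ b
      three (here q) = inj₂ (inj₁ q)
      three (there (here q)) = inj₂ (inj₂ q)
      three (there (there (here q))) = inj₁ q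

  -- `f` is fuel. Each recursive call prolongs the reduced walk by which `s` was reached, and such a
  -- walk has at most `n` vertices.
  branch : ∀ f → n < f + length xs → Reduced G (s ∷ p ∷ xs) → ∃[ t ] (root t ≡ s × Branch p t)
  branch {xs} {s} {p} zero n< nb = ⊥-elim (<⇒≱ n< (≤-trans (m≤n+m _ 2)
      (≤-trans (length-unique≤ {ys = allFin n} (reduced⇒unique nb) (λ {x} _ → ∈-allFin x)) (≤-reflexive (length-allFin n)))))
  branch {xs} {s} {p} (suc f) n< nb = go (neighbours-of (Adj-sym (first nb)))
    where
    first : ∀ {zs} → Reduced G (s ∷ p ∷ zs) → Adj G s p
    first (one e) = e
    first (cons e _ _) = e
    n<′ : n < f + length (p ∷ xs)
    n<′ = subst (n <_) (sym (+-suc f (length xs))) n<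
    go : Neighbours p s → ∃[ t ] (root t ≡ s × Branch p t)
    go (pendant only) = leaf s , refl , leafᵇ (Adj-sym (first nb)) only
    go (cubic a b ea eb a≢p b≢p a≢b only)
      with branch f n<′ (cons (Adj-sym ea) a≢p nb) | branch f n<′ (cons (Adj-sym eb) b≢p nb)
    ... | l , refl , bl | r , refl , br = node s l r , refl , nodeᵇ (Adj-sym (first nb)) a≢p b≢p a≢b only bl br

  edge-at : Adj G u v → ∃[ a ] ∃[ b ] (root a ≡ u × root b ≡ v × Edge a b)
  edge-at {u} {v} e with branch {xs = []} (suc n) (≤-reflexive (sym (+-identityʳ _))) (one e)
                       | branch {xs = []} (suc n) (≤-reflexive (sym (+-identityʳ _))) (one (Adj-sym e))
  ... | a , refl , ba | b , refl , bb = a , b , refl , refl , edge ba bb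

  -- By `branch-closed` each side can be left only across the edge between the two, so a walk from
  -- `root a` stays in their union.
  edge-complete : ∀ {a b} → Edge a b → ∀ x → x ∈ labels a ⊎ x ∈ labels b
  edge-complete {a} {b} (edge f g) x = go (connected (root a) x) (inj₁ (root∈labels a))
    where
    go : ∀ {y x} → Star (Adj G) y x → y ∈ labels a ⊎ y ∈ labels b → x ∈ labels a ⊎ x ∈ labels b
    go ε y∈ = y∈
    go (e ◅ es) (inj₁ y∈) with branch-closed f y∈ e
    ... | inj₁ z∈ = go es (inj₁ z∈)
    ... | inj₂ (_ , refl) = go es (inj₂ (root∈labels b))
    go (e ◅ es) (inj₂ y∈) with branch-closed g y∈ e
    ... | inj₁ z∈ = go es (inj₂ z∈)
    ... | inj₂ (_ , refl) = go es (inj₁ (root∈labels a))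

  edge-order : ∀ {a b} → Edge a b → length (labels a) + length (labels b) ≡ n
  edge-order {a} {b} ed@(edge f g) = begin
    length (labels a) + length (labels b)  ≡⟨ sym (length-++ (labels a)) ⟩
    length (labels a ++ labels b)          ≡⟨ ≤-antisym
        (length-unique≤ (Unique.++⁺ (branch-unique f) (branch-unique g) (λ (p , q) → edge-disjoint ed p q)) (λ {x} _ → ∈-allFin x))
        (length-unique≤ (Unique.allFin⁺ n) (λ {x} _ → mem x)) ⟩
    length (allFin n)                      ≡⟨ length-allFin n ⟩
    n                                      ∎
    where
    open ≡-Reasoning
    mem : ∀ x → x ∈ labels a ++ labels b
    mem x with edge-complete ed x
    ... | inj₁ p = ∈-++⁺ˡ p
    ... | inj₂ p = ∈-++⁺ʳ (labels a) p

-- Counting subtrees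

length-cartesianProductWith : ∀ {A B C : Set} (f : A → B → C) xs ys →
  length (cartesianProductWith f xs ys) ≡ length xs * length ys
length-cartesianProductWith f []       ys = refl
length-cartesianProductWith f (x ∷ xs) ys = trans (length-++ (map (f x) ys))
  (cong₂ _+_ (length-map (f x) ys) (length-cartesianProductWith f xs ys))

T-ext : ∀ {a b} → (T a → T b) → (T b → T a) → a ≡ b
T-ext {false} {false} _ _ = refl
T-ext {false} {true}  _ g = ⊥-elim (g _)
T-ext {true}  {false} f _ = ⊥-elim (f _)
T-ext {true}  {true}  _ _ = refl

vec-ext : ∀ {A : Set} {n} {xs ys : Vec A n} → (∀ i → lookup xs i ≡ lookup ys i) → xs ≡ ys
vec-ext {xs = xs} {ys} h = trans (sym (tabulate∘lookup xs)) (trans (tabulate-cong h) (tabulate∘lookup ys))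

∈ˢ⇒T : ∀ {n} {S : Subset n} {x} → x ∈ˢ S → T (lookup S x)
∈ˢ⇒T x∈ = Equivalence.from T-≡ ([]=⇒lookup x∈)

T⇒∈ˢ : ∀ {n} {S : Subset n} {x} → T (lookup S x) → x ∈ˢ S
T⇒∈ˢ {S = S} {x} t = lookup⇒[]= x S (Equivalence.to T-≡ t)

subset-ext : ∀ {n} {S S′ : Subset n} → (∀ {x} → x ∈ˢ S → x ∈ˢ S′) → (∀ {x} → x ∈ˢ S′ → x ∈ˢ S) → S ≡ S′
subset-ext f g = vec-ext (λ i → T-ext (∈ˢ⇒T ∘ f ∘ T⇒∈ˢ) (∈ˢ⇒T ∘ g ∘ T⇒∈ˢ))

allVecs-complete : ∀ {A : Set} (xs : List A) → (∀ x → x ∈ xs) → ∀ {n} (v : Vec A n) → v ∈ allVecs xs n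
allVecs-complete xs all Vec.[] = here refl
allVecs-complete xs all (x Vec.∷ v) = ∈-cartesianProductWith⁺ Vec._∷_ (all x) (allVecs-complete xs all v)

allVecs-unique : ∀ {A : Set} {xs : List A} → Unique xs → ∀ n → Unique (allVecs xs n)
allVecs-unique u zero = [] ∷ []
allVecs-unique u (suc n) = Unique.cartesianProductWith⁺ Vec._∷_ Vec.∷-injective u (allVecs-unique u n)

allSubgraphData-complete : ∀ {n} (H : SubgraphData n) → H ∈ allSubgraphData n
allSubgraphData-complete (S , E) = ∈-cartesianProduct⁺ (subsets S) (allVecs-complete _ subsets E)
  where
  subsets : ∀ {m} (S : Subset m) → S ∈ allSubsets m
  subsets = allVecs-complete _ λ { false → here refl ; true → there (here refl) }

allSubgraphData-unique : ∀ n → Unique (allSubgraphData n)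
allSubgraphData-unique n = Unique.cartesianProduct⁺ subsets (allVecs-unique subsets n)
  where
  subsets : ∀ {m} → Unique (allSubsets m)
  subsets = allVecs-unique (((λ ()) ∷ []) ∷ [] ∷ []) _

-- A Code t is a subtree of t that is empty or contains the root.
data Code {A : Set} : Tree A → Set where
  none : ∀ {t} → Code t
  lone : ∀ {a} → Code (leaf a)
  both : ∀ {a l r} → Code l → Code r → Code (node a l r)

data In {A : Set} (x : A) : ∀ {t} → Code t → Set where
  lone  : In x (lone {a = x})
  top   : ∀ {l r} {c : Code l} {d : Code r} → In x (both {a = x} c d)
  left  : ∀ {a l r} {c : Code l} {d : Code r} → In x c → In x (both {a = a} c d)
  right : ∀ {a l r} {c : Code l} {d : Code r} → In x d → In x (both {a = a} c d)

module _ {A : Set} where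

  codes nonempty : (t : Tree A) → List (Code t)
  codes t = none ∷ nonempty t
  nonempty (leaf a)     = lone ∷ []
  nonempty (node a l r) = cartesianProductWith both (codes l) (codes r)

  length-codes : ∀ (t : Tree A) → length (codes t) ≡ weight t
  length-codes (leaf a)     = refl
  length-codes (node a l r) = cong suc (trans (length-cartesianProductWith both (codes l) (codes r))
                                 (cong₂ _*_ (length-codes l) (length-codes r)))

  nonempty⇒≢none : ∀ t {c : Code t} → c ∈ nonempty t → c ≢ none
  nonempty⇒≢none (leaf a) (here refl) ()
  nonempty⇒≢none (node a l r) c∈ refl with ∈-cartesianProductWith⁻ both (codes l) (codes r) c∈
  ... | _ , _ , _ , _ , ()

  codes-complete : ∀ {t} (c : Code t) → c ∈ codes t
  ≢none⇒nonempty : ∀ {t} (c : Code t) → c ≢ none → c ∈ nonempty t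
  codes-complete none       = here refl
  codes-complete lone       = there (here refl)
  codes-complete (both c d) = there (≢none⇒nonempty (both c d) λ ())
  ≢none⇒nonempty none       c≢ = ⊥-elim (c≢ refl)
  ≢none⇒nonempty lone       _  = here refl
  ≢none⇒nonempty (both c d) _  = ∈-cartesianProductWith⁺ both (codes-complete c) (codes-complete d)

  codes-unique : ∀ t → Unique (codes t)
  nonempty-unique : ∀ t → Unique (nonempty t)
  codes-unique t = All.tabulate (λ c∈ none≡c → nonempty⇒≢none t c∈ (sym none≡c)) ∷ nonempty-unique t
  nonempty-unique (leaf a)     = [] ∷ []
  nonempty-unique (node a l r) =
    Unique.cartesianProductWith⁺ both (λ { refl → refl , refl }) (codes-unique l) (codes-unique r)

  In⇒∈ : ∀ {x : A} {t} {c : Code t} → In x c → x ∈ labels t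
  In⇒∈ lone      = here refl
  In⇒∈ top       = here refl
  In⇒∈ (left {l = l} p)  = ∈-left {l = l} (In⇒∈ p)
  In⇒∈ (right {l = l} p) = ∈-right l (In⇒∈ p)

  In⇒≢none : ∀ {x : A} {t} {c : Code t} → In x c → c ≢ none
  In⇒≢none () refl

  root-In : ∀ {t : Tree A} (c : Code t) → c ≢ none → In (root t) c
  root-In none       c≢ = ⊥-elim (c≢ refl)
  root-In lone       _  = lone
  root-In (both c d) _  = top

in? : ∀ {n} (x : Fin n) {t} (c : Code t) → Dec (In x c)
in? x none = no λ ()
in? x (lone {a}) with x ≟ᶠ a
... | yes refl = yes lone
... | no x≢a   = no λ { lone → x≢a refl }
in? x (both {a} c d) with x ≟ᶠ a | in? x c | in? x d
... | yes refl | _     | _     = yes top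
... | no _     | yes p | _     = yes (left p)
... | no _     | no _  | yes p = yes (right p)
... | no x≢a   | no ¬p | no ¬q = no λ { top → x≢a refl ; (left p) → ¬p p ; (right q) → ¬q q }

module Counting {n : ℕ} (G : Graph n) (isBin : IsBinaryTree G) where
  open BinaryTree G isBin
  open Graph G using (adj)

  private
    variable
      p s u v x y : Fin n
      t l r a b : Tree (Fin n)

    _∈?_ = DecMembership._∈?_ (_≟ᶠ_ {n})

  -- The labels of a branch are distinct, so the vertices of a code split uniquely among the root
  -- and the two branches below it.
  code-ext : Branch p t → (c c′ : Code t) → (∀ {x} → In x c → In x c′) → (∀ {x} → In x c′ → In x c) → c ≡ c′
  code-ext _ none none _ _ = refl
  code-ext _ none lone _ g with g lone
  ... | ()
  code-ext _ none (both _ _) _ g with g top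
  ... | ()
  code-ext _ lone none f _ with f lone
  ... | ()
  code-ext _ (both _ _) none f _ with f top
  ... | ()
  code-ext _ lone lone _ _ = refl
  code-ext (nodeᵇ {s} {l} {r} _ _ _ l≢r _ bl br) (both c d) (both c′ d′) f g =
    cong₂ both (code-ext bl c c′ (λ i → inl i (f (left i))) (λ i → inl i (g (left i))))
               (code-ext br d d′ (λ i → inr i (f (right i))) (λ i → inr i (g (right i))))
    where
    inl : ∀ {x} {c₁ c₂ : Code l} {d₂ : Code r} → In x c₁ → In x (both {a = s} c₂ d₂) → In x c₂
    inl i top       = ⊥-elim (parent∉branch bl (In⇒∈ i))
    inl i (left j)  = j
    inl i (right j) = ⊥-elim (siblings-disjoint bl br l≢r (In⇒∈ i) (In⇒∈ j))
    inr : ∀ {x} {d₁ d₂ : Code r} {c₂ : Code l} → In x d₁ → In x (both {a = s} c₂ d₂) → In x d₂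
    inr i top       = ⊥-elim (parent∉branch br (In⇒∈ i))
    inr i (left j)  = ⊥-elim (siblings-disjoint bl br l≢r (In⇒∈ j) (In⇒∈ i))
    inr i (right j) = j

  module Subtree (S : Subset n) (E : Vec (Subset n) n) (sub : IsSubgraphOf S E G) (conn : SubConnected S E) where

    -- The edge from `p` to `root t` is the only edge of `G` into the branch, so a walk from outside
    -- to inside has to use it.
    enter : Branch p t → Star (SubAdj S E) x y → x ∉ labels t → y ∈ labels t → SubAdj S E p (root t)
    enter b ε x∉ y∈ = ⊥-elim (x∉ y∈)
    enter {t = t} b (_◅_ {i = x} {j = z} e es) x∉ y∈ with z ∈? labels t
    ... | no z∉ = enter b es z∉ y∈
    ... | yes z∈ with sub _ _ e
    ...   | _ , xz , _ with branch-closed b z∈ (Adj-sym xz)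
    ...     | inj₁ x∈ = ⊥-elim (x∉ x∈)
    ...     | inj₂ (refl , refl) = e

    -- A connected subgraph of a tree is induced: removing an edge separates its ends, so a subgraph
    -- that connects them contains it.
    Adj⇒SubAdj : Adj G x y → x ∈ˢ S → y ∈ˢ S → SubAdj S E x y
    Adj⇒SubAdj e x∈ y∈ with edge-at e
    ... | a , b , refl , refl , edge f g = enter g (conn _ _ x∈ y∈) (parent∉branch g) (root∈labels b)

    Encodes : (t : Tree (Fin n)) → Code t → Set
    Encodes t c = (∀ {x} → x ∈ labels t → x ∈ˢ S → In x c) × (∀ {x} → In x c → x ∈ˢ S)

    encode : Branch p t → u ∈ˢ S → u ∉ labels t → ∃[ c ] Encodes t c
    encode-root : Branch p t → root t ∈ˢ S → ∃[ c ] (c ≢ none × Encodes t c)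
    encode {t = t} b u∈ u∉ with root t ∈ˢ? S
    ... | yes r∈ with encode-root b r∈
    ...   | c , _ , enc = c , enc
    -- The subtree contains `u` outside the branch; a vertex of it inside would force the edge at
    -- the root, and with it the root.
    encode {t = t} b u∈ u∉ | no r∉ = none , (λ x∈ x∈S → ⊥-elim (r∉
        (proj₂ (proj₂ (proj₂ (sub _ _ (enter b (conn _ _ u∈ x∈S) u∉ x∈))))))) , (λ ())
    encode-root {t = leaf s} _ r∈ = lone , (λ ()) , (λ { (here refl) _ → lone }) , (λ { lone → r∈ })
    encode-root {t = node s l r} (nodeᵇ _ _ _ _ _ bl br) r∈
      with encode bl r∈ (parent∉branch bl) | encode br r∈ (parent∉branch br)
    ... | c , f , g | d , f′ , g′ = both c d , (λ ()) , to , from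
      where
      to : x ∈ labels (node s l r) → x ∈ˢ S → In x (both c d)
      to x∈ x∈S with inNode l r x∈
      ... | top refl = top
      ... | left x∈l = left (f x∈l x∈S)
      ... | right x∈r = right (f′ x∈r x∈S)
      from : In x (both c d) → x ∈ˢ S
      from top = r∈
      from (left i) = g i
      from (right i) = g′ i

  PairCode : Tree (Fin n) → Tree (Fin n) → Set
  PairCode a b = Code a × Code b

  InPair : Fin n → PairCode a b → Set
  InPair x (c , d) = In x c ⊎ In x d

  pairs : (a b : Tree (Fin n)) → List (PairCode a b)
  pairs a b = cartesianProduct (nonempty a) (codes b)

  -- Only vertex sets are compared; by `Adj⇒SubAdj` they determine the edges of a subtree.
  record Represents (a b : Tree (Fin n)) (H : SubgraphData n) (cd : PairCode a b) : Set where
    constructor represents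
    field
      isSubtree : IsSubtreeContaining G (root a) H
      to        : ∀ {x} → x ∈ˢ proj₁ H → InPair x cd
      from      : ∀ {x} → InPair x cd → x ∈ˢ proj₁ H

  module _ (ed : Edge a b) where
    open Edge ed

    encode-pair : ∀ H → IsSubtreeContaining G (root a) H → ∃[ cd ] (cd ∈ pairs a b × Represents a b H cd)
    encode-pair (S , E) H@(r∈ , sub , conn) with Subtree.encode-root S E sub conn fst r∈
                                | Subtree.encode S E sub conn snd r∈ (parent∉branch snd)
    ... | c , c≢ , f , g | d , f′ , g′ =
      (c , d) , ∈-cartesianProduct⁺ (≢none⇒nonempty c c≢) (codes-complete d) ,
      represents H to (λ { (inj₁ i) → g i ; (inj₂ i) → g′ i })
      where
      to : x ∈ˢ S → In x c ⊎ In x d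
      to {x} x∈ with edge-complete ed x
      ... | inj₁ x∈a = inj₁ (f x∈a x∈)
      ... | inj₂ x∈b = inj₂ (f′ x∈b x∈)

    represents-injective : ∀ {H H′ cd} → Represents a b H cd → Represents a b H′ cd → H ≡ H′
    represents-injective {S , E} {S′ , E′} (represents (_ , sub , conn) f g) (represents (_ , sub′ , conn′) f′ g′)
      with subset-ext {S = S} {S′} (g′ ∘ f) (g ∘ f′)
    ... | refl = cong (S ,_) (vec-ext λ x → vec-ext λ y → T-ext (transfer E E′ sub sub′ conn′) (transfer E′ E sub′ sub conn))
      where
      transfer : ∀ E E′ → IsSubgraphOf S E G → IsSubgraphOf S E′ G → SubConnected S E′ → SubAdj S E x y → SubAdj S E′ x y
      transfer E E′ sub sub′ conn′ e with sub _ _ e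
      ... | _ , xy , x∈ , y∈ = Subtree.Adj⇒SubAdj S E′ sub′ conn′ xy x∈ y∈

    represents-functional : ∀ {H cd cd′} → Represents a b H cd → Represents a b H cd′ → cd ≡ cd′
    represents-functional {cd = c , d} {c′ , d′} (represents _ f g) (represents _ f′ g′) =
      cong₂ _,_ (code-ext fst c c′ (λ i → inA i (f′ (g (inj₁ i)))) (λ i → inA i (f (g′ (inj₁ i)))))
                (code-ext snd d d′ (λ i → inB i (f′ (g (inj₂ i)))) (λ i → inB i (f (g′ (inj₂ i)))))
      where
      inA : ∀ {x} {c₁ c₂ : Code a} {d₂ : Code b} → In x c₁ → In x c₂ ⊎ In x d₂ → In x c₂
      inA _ (inj₁ j) = j
      inA i (inj₂ j) = ⊥-elim (edge-disjoint ed (In⇒∈ i) (In⇒∈ j))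
      inB : ∀ {x} {d₁ d₂ : Code b} {c₂ : Code a} → In x d₁ → In x c₂ ⊎ In x d₂ → In x d₂
      inB _ (inj₂ j) = j
      inB i (inj₁ j) = ⊥-elim (edge-disjoint ed (In⇒∈ j) (In⇒∈ i))

    module Decode (c : Code a) (d : Code b) where

      inPair? : ∀ x → Dec (In x c ⊎ In x d)
      inPair? x = in? x c ⊎-dec in? x d

      S : Subset n
      S = tabulate (λ x → isYes (inPair? x))

      E : Vec (Subset n) n
      E = tabulate λ x → tabulate λ y → adj x y ∧ (isYes (inPair? x) ∧ isYes (inPair? y))

      S-to : x ∈ˢ S → In x c ⊎ In x d
      S-to {x} x∈ = toWitness {a? = inPair? x} (subst T (lookup∘tabulate _ x) (∈ˢ⇒T x∈))

      S-from : In x c ⊎ In x d → x ∈ˢ S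
      S-from {x} i = T⇒∈ˢ (subst T (sym (lookup∘tabulate _ x)) (fromWitness {a? = inPair? x} i))

      E-entry : ∀ x y → lookup (lookup E x) y ≡ adj x y ∧ (isYes (inPair? x) ∧ isYes (inPair? y))
      E-entry x y = trans (cong (λ row → lookup row y) (lookup∘tabulate _ x)) (lookup∘tabulate _ y)

      E-to : SubAdj S E x y → Adj G x y × x ∈ˢ S × y ∈ˢ S
      E-to {x} {y} e with Equivalence.to T-∧ (subst T (E-entry x y) e)
      ... | xy , e′ with Equivalence.to T-∧ e′
      ...   | x∈ , y∈ = xy , S-from (toWitness {a? = inPair? x} x∈) , S-from (toWitness {a? = inPair? y} y∈)

      E-from : Adj G x y → x ∈ˢ S → y ∈ˢ S → SubAdj S E x y
      E-from {x} {y} xy x∈ y∈ = subst T (sym (E-entry x y)) (Equivalence.from T-∧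
        (xy , Equivalence.from T-∧ (fromWitness {a? = inPair? x} (S-to x∈) , fromWitness {a? = inPair? y} (S-to y∈))))

      subgraph : IsSubgraphOf S E G
      subgraph x y e with E-to e
      ... | xy , x∈ , y∈ = E-from (Adj-sym xy) y∈ x∈ , xy , x∈ , y∈

      to-root : ∀ {t} → Branch p t → (e : Code t) → (∀ {x} → In x e → x ∈ˢ S) → In x e → Star (SubAdj S E) x (root t)
      to-root _ _ _ lone = ε
      to-root _ _ _ top = ε
      to-root (nodeᵇ {s} {l} {r} _ _ _ _ _ bl br) (both e e′) sub (left i) = to-root bl e (sub ∘ left) i ◅◅
        E-from (Adj-sym (branch-edge bl)) (sub (left (root-In e (In⇒≢none i)))) (sub top) ◅ ε
      to-root (nodeᵇ {s} {l} {r} _ _ _ _ _ bl br) (both e e′) sub (right i) = to-root br e′ (sub ∘ right) i ◅◅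
        E-from (Adj-sym (branch-edge br)) (sub (right (root-In e′ (In⇒≢none i)))) (sub top) ◅ ε

      module _ (c≢ : c ≢ none) where

        root∈ : root a ∈ˢ S
        root∈ = S-from (inj₁ (root-In c c≢))

        to-root-pair : x ∈ˢ S → Star (SubAdj S E) x (root a)
        to-root-pair x∈ with S-to x∈
        ... | inj₁ i = to-root fst c (S-from ∘ inj₁) i
        ... | inj₂ i = to-root snd d (S-from ∘ inj₂) i ◅◅
              E-from (branch-edge fst) (S-from (inj₂ (root-In d (In⇒≢none i)))) root∈ ◅ ε

        decoded : Represents a b (S , E) (c , d)
        decoded = represents (root∈ , subgraph , λ x y x∈ y∈ →
          to-root-pair x∈ ◅◅ Star.reverse (λ e → proj₁ (subgraph _ _ e)) (to-root-pair y∈)) S-to S-from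

    -- On the side of `a` the empty code is excluded, since the subtree contains `root a`; on the
    -- side of `b` it stands for the subtrees that avoid `b`.
    subtreeCount-edge : subtreeCount G (root a) ≡ pred (weight a) * weight b
    subtreeCount-edge = begin
      subtreeCount G (root a)                ≡⟨ ≤-antisym upper lower ⟩
      length (pairs a b)                     ≡⟨ length-cartesianProductWith _,_ (nonempty a) (codes b) ⟩
      length (nonempty a) * length (codes b) ≡⟨ cong₂ _*_ (cong pred (length-codes a)) (length-codes b) ⟩
      pred (weight a) * weight b             ∎
      where
      open ≡-Reasoning
      valid? = isSubtreeContaining? G (root a)
      subtrees = filter valid? (allSubgraphData n)
      upper : length subtrees ≤ length (pairs a b)
      upper = length≤-by (Represents a b) subtrees (pairs a b) (Unique.filter⁺ valid? (allSubgraphData-unique n))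
        (λ {H} H∈ → encode-pair H (proj₂ (∈-filter⁻ valid? {xs = allSubgraphData n} H∈)))
        (λ _ _ → represents-injective)
      lower : length (pairs a b) ≤ length subtrees
      lower = length≤-by (flip (Represents a b)) (pairs a b) subtrees
        (Unique.cartesianProduct⁺ (nonempty-unique a) (codes-unique b))
        (λ { {c , d} cd∈ → let dec = Decode.decoded c d (nonempty⇒≢none a (proj₁ (∈-cartesianProduct⁻ (nonempty a) (codes b) cd∈)))
               in _ , ∈-filter⁺ valid? (allSubgraphData-complete _) (Represents.isSubtree dec) , dec })
        (λ _ _ → represents-functional)

  private
    -- With `α` and `β` one less than the two weights, the two counts share the term `α * β`, and
    -- what remains compares the weights.
    cross<⁻ : ∀ α β → α * suc β < β * suc α → α < β
    cross<⁻ α β h = +-cancelʳ-< (α * β) α β (subst₂ _<_ (*-suc α β) (trans (*-suc β α) (cong (β +_) (*-comm β α))) h)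

    cross<⁺ : ∀ α β → α < β → α * suc β < β * suc α
    cross<⁺ α β h = subst₂ _<_ (sym (*-suc α β)) (sym (trans (*-suc β α) (cong (β +_) (*-comm β α)))) (+-monoˡ-< (α * β) h)

    suc-pred-weight : ∀ (t : Tree (Fin n)) → suc (pred (weight t)) ≡ weight t
    suc-pred-weight t = suc-pred (weight t) {{>-nonZero (≤-trans (s≤s z≤n) (weight≥2 t))}}

  module _ (ed : Edge a b) where
    private
      wa = suc-pred-weight a
      wb = suc-pred-weight b

      counts : subtreeCount G (root a) ≡ pred (weight a) * suc (pred (weight b)) ×
               subtreeCount G (root b) ≡ pred (weight b) * suc (pred (weight a))
      counts = trans (subtreeCount-edge ed) (cong (pred (weight a) *_) (sym wb)) ,
               trans (subtreeCount-edge (flip-edge ed)) (cong (pred (weight b) *_) (sym wa))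

    count<⇒weight< : subtreeCount G (root a) < subtreeCount G (root b) → weight a < weight b
    count<⇒weight< h = subst₂ _<_ wa wb (s≤s (cross<⁻ (pred (weight a)) (pred (weight b))
      (subst₂ _<_ (proj₁ counts) (proj₂ counts) h)))

    weight<⇒count< : weight a < weight b → subtreeCount G (root a) < subtreeCount G (root b)
    weight<⇒count< h = subst₂ _<_ (sym (proj₁ counts)) (sym (proj₂ counts))
      (cross<⁺ (pred (weight a)) (pred (weight b)) (s≤s⁻¹ (subst₂ _<_ (sym wa) (sym wb) h)))

-- From the centre to the subtree core

least : ∀ {P : ℕ → Set} → (∀ k → Dec (P k)) → ∀ {k} → P k → ∃[ m ] (P m × (∀ {j} → P j → m ≤ j))
least {P} P? {k} p = search k 0 (λ {j} _ → z≤n) (subst P (sym (+-identityʳ k)) p)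
  where
  search : ∀ f i → (∀ {j} → P j → i ≤ j) → P (f + i) → ∃[ m ] (P m × (∀ {j} → P j → m ≤ j))
  search zero    i below p = i , p , below
  search (suc f) i below p with P? i
  ... | yes pi = i , pi , below
  ... | no ¬pi = search f (suc i) (λ pj → ≤∧≢⇒< (below pj) (λ { refl → ¬pi pj })) (subst P (sym (+-suc f i)) p)

minimiser : ∀ {n} → 1 ≤ n → (f : Fin n → ℕ) → ∃[ c ] (∀ u → f c ≤ f u)
minimiser {suc n} _ f = argmin f fzero (allFin (suc n)) ,
  λ u → All.lookup (f[argmin]≤f[xs] {f = f} fzero (allFin (suc n))) (∈-allFin u)

maximiser : ∀ {n} → 1 ≤ n → (f : Fin n → ℕ) → ∃[ c ] (∀ u → f u ≤ f c)
maximiser {suc n} _ f = argmax f fzero (allFin (suc n)) ,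
  λ u → All.lookup (f[xs]≤f[argmax] {f = f} fzero (allFin (suc n))) (∈-allFin u)

module Distance {n : ℕ} (G : Graph n) where

  private variable
    u v w : Fin n
    k j d r : ℕ

  dist≤ : Walk G k u v → dist G u v ≤ k
  dist≤ {k} {u} {v} walk with k <? n
  ... | yes k<n = All.lookup (min≤xs n (filter (λ k → walk? G k u v) (upTo n))) (∈-filter⁺ (λ k → walk? G k u v) (∈-upTo⁺ k<n) walk)
  ... | no k≮n  = ≤-trans (min≤⊤ n (filter (λ k → walk? G k u v) (upTo n))) (≮⇒≥ k≮n)

  -- The bound `d ≤ n` takes care of the default value `n` of the minimum in `dist`.
  ≤dist : d ≤ n → (∀ {k} → Walk G k u v → d ≤ k) → d ≤ dist G u v
  ≤dist {u = u} {v} d≤n h = v≤min⁺ d≤n (All.tabulate λ k∈ → h (proj₂ (∈-filter⁻ (λ k → walk? G k u v) {xs = upTo n} k∈)))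

  dist≤ecc : dist G v u ≤ ecc G v
  dist≤ecc {v} {u} = All.lookup (xs≤max 0 (map (dist G v) (allFin n))) (∈-map⁺ (dist G v) (∈-allFin u))

  ecc≤ : (∀ u → dist G v u ≤ r) → ecc G v ≤ r
  ecc≤ {v} h = max≤v⁺ z≤n (All.tabulate bound)
    where
    bound : ∀ {d} → d ∈ map (dist G v) (allFin n) → d ≤ _
    bound d∈ with ∈-map⁻ (dist G v) d∈
    ... | u , _ , refl = h u

  centerCoreDist≤ : InCenter G u → InSubtreeCore G v → Walk G k u v → centerCoreDist G ≤ k
  centerCoreDist≤ cu sv walk = ≤-trans
    (All.lookup (min≤xs n (cartesianProductWith (dist G) (center G) (subtreeCore G)))
      (∈-cartesianProductWith⁺ (dist G) (∈-filter⁺ (inCenter? G) (∈-allFin _) cu) (∈-filter⁺ (inSubtreeCore? G) (∈-allFin _) sv)))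
    (dist≤ walk)

  ≤centerCoreDist : d ≤ n → (∀ {u v k} → InCenter G u → InSubtreeCore G v → Walk G k u v → d ≤ k) → d ≤ centerCoreDist G
  ≤centerCoreDist {d} d≤n h = v≤min⁺ d≤n (All.tabulate bound)
    where
    bound : ∀ {x} → x ∈ cartesianProductWith (dist G) (center G) (subtreeCore G) → d ≤ x
    bound x∈ with ∈-cartesianProductWith⁻ (dist G) (center G) (subtreeCore G) x∈
    ... | u , v , u∈ , v∈ , refl = ≤dist d≤n (h (proj₂ (∈-filter⁻ (inCenter? G) {xs = allFin n} u∈))
                                     (proj₂ (∈-filter⁻ (inSubtreeCore? G) {xs = allFin n} v∈)))

  -- Distances are bounded from below throughout by a potential that grows by at most one along each
  -- edge, so shortest walks need no analysis.
  lipschitz : (φ : Fin n → ℕ) → (∀ {u v} → Adj G u v → φ v ≤ suc (φ u)) → Walk G k u v → φ v ≤ k + φ u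
  lipschitz {zero}  φ lip refl = ≤-refl
  lipschitz {suc k} {u} {v} φ lip (w , e , walk) = begin
    φ v              ≤⟨ lipschitz φ lip walk ⟩
    k + φ w          ≤⟨ +-monoʳ-≤ k (lip e) ⟩
    k + suc (φ u)    ≡⟨ +-suc k (φ u) ⟩
    suc k + φ u      ∎
    where open ≤-Reasoning

  snocʷ : Walk G k u v → Adj G v w → Walk G (suc k) u w
  snocʷ {zero}  refl e = _ , e , refl
  snocʷ {suc k} (x , e′ , walk) e = x , e′ , snocʷ walk e

  reverseʷ : Walk G k u v → Walk G k v u
  reverseʷ {zero}  refl = refl
  reverseʷ {suc k} {u} (w , e , walk) = snocʷ (reverseʷ walk) (adjacent-sym G {u} {w} e)

  _++ʷ_ : Walk G k u v → Walk G j v w → Walk G (k + j) u w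
  _++ʷ_ {zero}  refl walk = walk
  _++ʷ_ {suc k} (x , e , walk) walk′ = x , e , walk ++ʷ walk′

  star⇒walk : Star (Adj G) u v → ∃[ k ] Walk G k u v
  star⇒walk ε = 0 , refl
  star⇒walk (e ◅ es) with star⇒walk es
  ... | k , walk = suc k , _ , e , walk

module Extremal {n : ℕ} (G : Graph n) (isBin : IsBinaryTree G) where
  open BinaryTree G isBin
  open Counting G isBin
  open Distance G

  private
    variable
      p s u v x y : Fin n
      k i : ℕ
      a b t : Tree (Fin n)

    _∈?_ = DecMembership._∈?_ (_≟ᶠ_ {n})

  -- Depth of x in t; junk value 0 if x does not occur in t.
  position : Tree (Fin n) → Fin n → ℕ
  position (leaf _)     x = 0
  position (node _ l r) x with x ∈? labels l | x ∈? labels r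
  ... | yes _ | _     = suc (position l x)
  ... | no _  | yes _ = suc (position r x)
  ... | no _  | no _  = 0

  position-left : ∀ {a l r} → x ∈ labels l → position (node a l r) x ≡ suc (position l x)
  position-left {x} {a} {l} {r} x∈ with x ∈? labels l | x ∈? labels r
  ... | yes _ | _ = refl
  ... | no x∉ | _ = ⊥-elim (x∉ x∈)

  position-right : ∀ {a l r} → x ∉ labels l → x ∈ labels r → position (node a l r) x ≡ suc (position r x)
  position-right {x} {a} {l} {r} x∉ x∈ with x ∈? labels l | x ∈? labels r
  ... | yes x∈l | _ = ⊥-elim (x∉ x∈l)
  ... | no _ | yes _ = refl
  ... | no _ | no x∉r = ⊥-elim (x∉r x∈)

  position-root : Branch p t → position t (root t) ≡ 0
  position-root (leafᵇ _ _) = refl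
  position-root (nodeᵇ {s} {l} {r} _ _ _ _ _ bl br) with s ∈? labels l | s ∈? labels r
  ... | yes s∈ | _      = ⊥-elim (parent∉branch bl s∈)
  ... | no _   | yes s∈ = ⊥-elim (parent∉branch br s∈)
  ... | no _   | no _   = refl

  position-lipschitz : Branch p t → x ∈ labels t → y ∈ labels t → Adj G x y → position t x ≤ suc (position t y)
  position-lipschitz (leafᵇ _ _) _ _ _ = z≤n
  position-lipschitz {x = x} {y} b@(nodeᵇ {s} {l} {r} _ _ _ l≢r _ bl br) x∈ y∈ e with inNode l r x∈
  ... | top refl = ≤-trans (≤-reflexive (position-root b)) z≤n
  ... | left x∈l with branch-closed bl x∈l e
  ...   | inj₂ (refl , refl) = ≤-trans (≤-reflexive (trans (position-left {a = s} {r = r} x∈l) (cong suc (position-root bl)))) (s≤s z≤n)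
  ...   | inj₁ y∈l = subst₂ (λ a b → a ≤ suc b) (sym (position-left {a = s} {r = r} x∈l)) (sym (position-left {a = s} {r = r} y∈l))
                       (s≤s (position-lipschitz bl x∈l y∈l e))
  position-lipschitz {x = x} {y} b@(nodeᵇ {s} {l} {r} _ _ _ l≢r _ bl br) x∈ y∈ e | right x∈r with branch-closed br x∈r e
  ...   | inj₂ (refl , refl) = ≤-trans (≤-reflexive (trans (position-right {a = s} (outside-left x∈r) x∈r) (cong suc (position-root br)))) (s≤s z≤n)
    where
    outside-left : ∀ {z} → z ∈ labels r → z ∉ labels l
    outside-left z∈r z∈l = siblings-disjoint bl br l≢r z∈l z∈r
  ...   | inj₁ y∈r = subst₂ (λ a b → a ≤ suc b) (sym (position-right {a = s} (outside-left x∈r) x∈r)) (sym (position-right {a = s} (outside-left y∈r) y∈r))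
                       (s≤s (position-lipschitz br x∈r y∈r e))
    where
    outside-left : ∀ {z} → z ∈ labels r → z ∉ labels l
    outside-left z∈r z∈l = siblings-disjoint bl br l≢r z∈l z∈r

  deepest : Branch p t → ∃[ x ] (x ∈ labels t × position t x ≡ depth t)
  deepest (leafᵇ {s} _ _) = s , here refl , refl
  deepest (nodeᵇ {s} {l} {r} _ _ _ l≢r _ bl br) with ≤-total (depth r) (depth l) | deepest bl | deepest br
  ... | inj₁ r≤l | x , x∈ , eq | _ = x , ∈-left {l = l} x∈ ,
        trans (position-left {a = s} {r = r} x∈) (cong suc (trans eq (sym (m≥n⇒m⊔n≡m r≤l))))
  ... | inj₂ l≤r | _ | x , x∈ , eq = x , ∈-right l x∈ ,
        trans (position-right {a = s} (λ x∈l → siblings-disjoint bl br l≢r x∈l x∈) x∈) (cong suc (trans eq (sym (m≤n⇒m⊔n≡n l≤r))))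

  walk-down : Branch p t → x ∈ labels t → ∃[ k ] (k ≤ depth t × Walk G k (root t) x)
  walk-down (leafᵇ _ _) (here refl) = 0 , z≤n , refl
  walk-down (nodeᵇ {s} {l} {r} _ _ _ _ _ bl br) x∈ with inNode l r x∈
  ... | top refl = 0 , z≤n , refl
  ... | left x∈l with walk-down bl x∈l
  ...   | k , k≤ , walk = suc k , s≤s (≤-trans k≤ (m≤m⊔n _ _)) , _ , branch-edge bl , walk
  walk-down (nodeᵇ {s} {l} {r} _ _ _ _ _ bl br) x∈ | right x∈r with walk-down br x∈r
  ...   | k , k≤ , walk = suc k , s≤s (≤-trans k≤ (m≤n⊔m (depth l) _)) , _ , branch-edge br , walk

  module _ (ed : Edge a b) where
    open Edge ed

    private
      -- The distance from `root a`, with the whole side of `a` collapsed to 0: a potential whose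
      -- value at a deepest vertex of `b` bounds the eccentricity from below.
      offset : Fin n → ℕ
      offset x with x ∈? labels b
      ... | yes _ = suc (position b x)
      ... | no _  = 0

      offset-in : x ∈ labels b → offset x ≡ suc (position b x)
      offset-in {x} x∈ with x ∈? labels b
      ... | yes _ = refl
      ... | no x∉ = ⊥-elim (x∉ x∈)

      offset-out : x ∉ labels b → offset x ≡ 0
      offset-out {x} x∉ with x ∈? labels b
      ... | yes x∈ = ⊥-elim (x∉ x∈)
      ... | no _ = refl

      offset-lipschitz : Adj G x y → offset y ≤ suc (offset x)
      offset-lipschitz {x} {y} e = by-cases (y ∈? labels b)
        where
        by-cases : Dec (y ∈ labels b) → offset y ≤ suc (offset x)
        by-cases (no y∉) = ≤-trans (≤-reflexive (offset-out y∉)) z≤n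
        by-cases (yes y∈) with branch-closed snd y∈ (Adj-sym e)
        ... | inj₁ x∈ = subst₂ (λ i j → i ≤ suc j) (sym (offset-in y∈)) (sym (offset-in x∈))
                          (s≤s (position-lipschitz snd y∈ x∈ (Adj-sym e)))
        ... | inj₂ (refl , refl) = ≤-trans (≤-reflexive (trans (offset-in y∈) (cong suc (position-root snd)))) (s≤s z≤n)

    depth<ecc : suc (depth b) ≤ ecc G (root a)
    depth<ecc with deepest snd
    ... | x , x∈ , eq = ≤-trans (≤dist depth<n far) dist≤ecc
      where
      open ≤-Reasoning
      far : ∀ {k} → Walk G k (root a) x → suc (depth b) ≤ k
      far {k} walk = begin
        suc (depth b)              ≡⟨ cong suc (sym eq) ⟩
        suc (position b x)         ≡⟨ sym (offset-in x∈) ⟩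
        offset x                   ≤⟨ lipschitz offset offset-lipschitz walk ⟩
        k + offset (root a)        ≡⟨ cong (k +_) (offset-out (parent∉branch snd)) ⟩
        k + 0                      ≡⟨ +-identityʳ k ⟩
        k                          ∎
      depth<n : suc (depth b) ≤ n
      depth<n = begin
        suc (depth b)                           ≤⟨ s≤s (depth≤internals b) ⟩
        suc (internals b)                       ≤⟨ s≤s (m≤m+n _ _) ⟩
        suc (internals b + internals b)         ≡⟨ sym (length-labels b) ⟩
        length (labels b)                       ≤⟨ m≤n+m _ (length (labels a)) ⟩
        length (labels a) + length (labels b)   ≡⟨ edge-order ed ⟩
        n                                       ∎

    ecc≤depth : depth a ≤ depth b → ecc G (root b) ≤ suc (depth b)
    ecc≤depth a≤b = ecc≤ bound
      where
      bound : ∀ x → dist G (root b) x ≤ suc (depth b)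
      bound x with edge-complete ed x
      ... | inj₂ x∈b with walk-down snd x∈b
      ...   | k , k≤ , walk = ≤-trans (dist≤ walk) (≤-trans k≤ (n≤1+n _))
      bound x | inj₁ x∈a with walk-down fst x∈a
      ...   | k , k≤ , walk = ≤-trans (dist≤ (_ , branch-edge fst , walk)) (s≤s (≤-trans k≤ a≤b))

  -- A shortest path of length D from the centre to the core ends with the edge between its two sides.
  record CoreEdge (D : ℕ) : Set where
    field
      centreSide coreSide : Tree (Fin n)
      isEdge  : Edge centreSide coreSide
      heavier : weight centreSide < weight coreSide
      deeper  : D + D + depth coreSide ≤ suc (depth centreSide)

  module Shortest {c s : Fin n} {D : ℕ} (cc : InCenter G c) (ss : InSubtreeCore G s)
                  (minimal : ∀ {c′ s′ k} → InCenter G c′ → InSubtreeCore G s′ → Walk G k c′ s′ → D ≤ k) where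

    -- The last hypothesis is the invariant. One edge further on, the side left behind is at least
    -- one level deeper than `a` and the remaining side at least one level shallower than `b`, so
    -- the gap grows by two. At the end `root b` is `s`, while `root a` is within `i < D` of the
    -- centre and hence outside the core, which makes the weight inequality strict.
    follow : ∀ k i → Edge a b → Walk G i c (root a) → Walk G k (root b) s → suc (i + k) ≡ D →
             depth b + (i + i) < depth a → CoreEdge D
    follow {a} {b} zero i ed walk refl eq deep = record
      { centreSide = a ; coreSide = b ; isEdge = ed
      ; heavier = count<⇒weight< ed (≰⇒> λ s≤p → <⇒≱ i<D (minimal cc (λ u → ≤-trans (ss u) s≤p) walk))
      ; deeper = begin
          D + D + depth b                     ≡⟨ cong (λ z → z + z + depth b) (sym eq) ⟩
          suc (i + 0) + suc (i + 0) + depth b ≡⟨ rearr i (depth b) ⟩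
          suc (suc (depth b + (i + i)))       ≤⟨ s≤s deep ⟩
          suc (depth a)                       ∎ }
      where
      open ≤-Reasoning
      rearr : ∀ i d → suc (i + 0) + suc (i + 0) + d ≡ suc (suc (d + (i + i)))
      rearr = solve-∀
      i<D : i < D
      i<D = ≤-reflexive (trans (cong suc (sym (+-identityʳ i))) eq)
    follow {a} {b} (suc k) i ed walk (z , e , rest) eq deep = go b ed e deep
      where
      -- Turning back would leave a walk of length `i + k`, that is `D - 2`, from the centre to the
      -- core.
      back : z ≢ root a
      back refl = <⇒≱ (≤-trans (n<1+n (i + k)) (≤-trans (n≤1+n _) (≤-reflexive (trans (cong suc (sym (+-suc i k))) eq))))
                    (minimal cc ss (walk ++ʷ rest))
      eq′ : suc (suc i + k) ≡ D
      eq′ = trans (cong suc (sym (+-suc i k))) eq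
      step : ∀ {d d′ dl dm} → d′ ≡ suc (dl ⊔ dm) → d′ + (i + i) < d → dl + (suc i + suc i) < suc (d ⊔ dm) ×
             dm + (suc i + suc i) < suc (d ⊔ dl)
      step {d} {d′} {dl} {dm} refl h = bound (m≤m⊔n dl dm) , bound (m≤n⊔m dl dm)
        where
        open ≤-Reasoning
        rearr : ∀ x i → x + (suc i + suc i) ≡ suc (suc x + (i + i))
        rearr = solve-∀
        bound : ∀ {x y} → x ≤ dl ⊔ dm → x + (suc i + suc i) < suc (d ⊔ y)
        bound {x} {y} x≤ = begin-strict
          x + (suc i + suc i)              ≡⟨ rearr x i ⟩
          suc (suc x + (i + i))            ≤⟨ s≤s (+-monoˡ-≤ (i + i) (s≤s x≤)) ⟩
          suc (suc (dl ⊔ dm) + (i + i))    ≤⟨ h ⟩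
          d                                ≤⟨ m≤m⊔n d y ⟩
          d ⊔ y                            <⟨ n<1+n _ ⟩
          suc (d ⊔ y)                      ∎
      go : ∀ b → Edge a b → Adj G (root b) z → depth b + (i + i) < depth a → CoreEdge D
      go (leaf _) (edge _ (leafᵇ _ only)) e deep = ⊥-elim (back (only z e))
      go (node v l r) ed@(edge f (nodeᵇ e₀ _ _ _ only bl br)) e deep with only z e
      ... | inj₁ z≡ = ⊥-elim (back z≡)
      ... | inj₂ (inj₁ refl) = follow k (suc i) (rotateˡ ed) (snocʷ walk e₀) rest eq′ (proj₁ (step {depth a} refl deep))
      ... | inj₂ (inj₂ refl) = follow k (suc i) (rotateʳ ed) (snocʷ walk e₀) rest eq′ (proj₂ (step {depth a} {dl = depth l} refl deep))

    core-edge : Walk G D c s → 1 ≤ D → CoreEdge D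
    core-edge walk 1≤D = start D walk refl 1≤D
      where
      start : ∀ k → Walk G k c s → k ≡ D → 1 ≤ k → CoreEdge D
      start (suc k) (w , e , rest) eq _ with edge-at e
      -- If the centre's side were not the deeper one, then `ecc G (root b) ≤ suc (depth b) ≤ ecc G
      -- (root a)`, and `root b` would be a central vertex one step closer to the core.
      ... | a , b , refl , refl , ed = follow k 0 ed refl rest eq (subst (_< depth a) (sym (+-identityʳ (depth b)))
            (≰⇒> λ a≤b → <⇒≱ (≤-reflexive eq) (minimal (λ u → ≤-trans (ecc≤depth ed a≤b) (≤-trans (depth<ecc ed) (cc u))) ss rest)))

  IsDistance : ℕ → Set
  IsDistance k = ∃[ c ] ∃[ s ] (InCenter G c × InSubtreeCore G s × Walk G k c s)

  isDistance? : ∀ k → Dec (IsDistance k)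
  isDistance? k = any? λ c → any? λ s → inCenter? G c ×-dec inSubtreeCore? G s ×-dec walk? G k c s

  isDistance-exists : 1 ≤ n → ∃[ k ] IsDistance k
  isDistance-exists 1≤n =
    let c , cc = minimiser 1≤n (ecc G) ; s , ss = maximiser 1≤n (subtreeCount G) ; k , walk = star⇒walk (connected c s)
    in k , c , s , cc , ss , walk

  core-edge-exists : 1 ≤ n → 1 ≤ centerCoreDist G → ∃[ D ] (centerCoreDist G ≤ D × CoreEdge D)
  core-edge-exists 1≤n 1≤d =
    let D , (c , s , cc , ss , walk) , min = least isDistance? (proj₂ (isDistance-exists 1≤n))
        d≤D = centerCoreDist≤ cc ss walk
    in D , d≤D , Shortest.core-edge cc ss (λ cc′ ss′ w → min (_ , _ , cc′ , ss′ , w)) walk (≤-trans 1≤d d≤D)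

  -- What is kept of the tree: `q` and `m` count the internal vertices on the core's and on the
  -- centre's side, and `H` bounds the height of the core's side. The crg tree is built from `q` and
  -- `m`; by `shallow` its rgood part has height at most `H`, and `heavy` says that the caterpillar,
  -- of weight `3 * 2 ^ m - 1`, is lighter than the complete tree.
  record Parameters (d : ℕ) : Set where
    field
      q m H   : ℕ
      order   : n ≡ (q + suc m) + (q + suc m)
      1≤q     : 1 ≤ q
      long    : d + d + H ≤ suc m
      shallow : suc q ≤ 2 ^ H
      heavy   : 3 * 2 ^ m ≤ best (suc q)

  from-core-edge : ∀ {d D} → d ≤ D → CoreEdge D → Parameters d
  from-core-edge d≤D core = record
    { q = internals coreSide ; m = internals centreSide ; H = depth coreSide
    ; order = trans (sym (edge-order isEdge)) (trans (cong₂ _+_ (length-labels centreSide) (length-labels coreSide)) (size (internals centreSide) (internals coreSide)))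
    -- A leaf has the least possible weight 2, so the heavier side is not a leaf.
    ; 1≤q = positive coreSide heavier
    ; long = ≤-trans (+-monoˡ-≤ (depth coreSide) (+-mono-≤ d≤D d≤D)) (≤-trans deeper (s≤s (depth≤internals centreSide)))
    ; shallow = leaves≤2^depth coreSide
    ; heavy = ≤-trans (weight≥caterpillar centreSide) (≤-trans heavier (weight≤complete coreSide)) }
    where
    open CoreEdge core
    size : ∀ a b → suc (a + a) + suc (b + b) ≡ (b + suc a) + (b + suc a)
    size = solve-∀
    positive : ∀ b → weight centreSide < weight b → 1 ≤ internals b
    positive (leaf _) h = ⊥-elim (<⇒≱ h (weight≥2 centreSide))
    positive (node _ _ _) _ = s≤s z≤n

  parameters : 1 ≤ n → 1 ≤ centerCoreDist G → Parameters (centerCoreDist G)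
  parameters 1≤n 1≤d = let D , d≤D , core = core-edge-exists 1≤n 1≤d in from-core-edge d≤D core

-- Trees given by a parent function

degree-by : ∀ {n} (G : Graph n) u (ys : List ℕ) → Unique ys → (∀ {y} → y ∈ ys → ∃[ v ] (toℕ v ≡ y × Adj G u v)) →
            (∀ v → Adj G u v → toℕ v ∈ ys) → degree G u ≡ length ys
degree-by G u ys uys adj mem = trans (degree≡length-neighbours-list G u) (≤-antisym
  (length≤-by (λ v y → toℕ v ≡ y) (neighbours-list G u) ys (neighbours-list-unique G u)
    (λ {v} v∈ → toℕ v , mem v (∈-neighbours-list⁻ G v∈) , refl) (λ { _ _ p q → toℕ-injective (trans p (sym q)) }))
  (length≤-by (λ y v → toℕ v ≡ y) ys (neighbours-list G u) uys
    (λ y∈ → let v , eq , e = adj y∈ in v , ∈-neighbours-list⁺ G e , eq) (λ { _ _ refl refl → refl })))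

-- The graph on 0 , … , n - 1 in which the parent of suc i is par i.
module ParentGraph (par : ℕ → ℕ) (par≤ : ∀ i → par i ≤ i) (n : ℕ) where

  data ChildOf : ℕ → ℕ → Set where
    child : ∀ i → ChildOf (suc i) (par i)

  isChildOf : ℕ → ℕ → Bool
  isChildOf zero    p = false
  isChildOf (suc i) p = par i ≡ᵇ p

  isChildOf⁺ : ∀ {c p} → ChildOf c p → T (isChildOf c p)
  isChildOf⁺ (child i) = ≡⇒≡ᵇ (par i) (par i) refl

  isChildOf⁻ : ∀ c {p} → T (isChildOf c p) → ChildOf c p
  isChildOf⁻ (suc i) {p} t = subst (ChildOf (suc i)) (≡ᵇ⇒≡ (par i) p t) (child i)

  parent< : ∀ {c p} → ChildOf c p → p < c
  parent< (child i) = s≤s (par≤ i)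

  parent-unique : ∀ {c p q} → ChildOf c p → ChildOf c q → p ≡ q
  parent-unique (child i) (child i) = refl

  isChildOf-irrefl : ∀ v → isChildOf v v ≡ false
  isChildOf-irrefl v with isChildOf v v in eq
  ... | false = refl
  ... | true = ⊥-elim (<-irrefl refl (parent< (isChildOf⁻ v {v} (subst T (sym eq) _))))

  graph : Graph n
  graph = record
    { adj = λ u v → isChildOf (toℕ u) (toℕ v) ∨ isChildOf (toℕ v) (toℕ u)
    ; sym = λ u v → ∨-comm (isChildOf (toℕ u) (toℕ v)) _
    ; irrefl = λ v → cong₂ _∨_ (isChildOf-irrefl (toℕ v)) (isChildOf-irrefl (toℕ v)) }

  private variable
    u v w x y z : Fin n
    xs : List (Fin n)

  Adj⁻ : Adj graph u v → ChildOf (toℕ u) (toℕ v) ⊎ ChildOf (toℕ v) (toℕ u)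
  Adj⁻ {u} {v} e = Sum.map (isChildOf⁻ _) (isChildOf⁻ _) (Equivalence.to T-∨ e)

  up : ChildOf (toℕ u) (toℕ v) → Adj graph u v
  up c = Equivalence.from T-∨ (inj₁ (isChildOf⁺ c))

  down : ChildOf (toℕ v) (toℕ u) → Adj graph u v
  down {v} {u} c = Equivalence.from (T-∨ {isChildOf (toℕ u) (toℕ v)}) (inj₂ (isChildOf⁺ c))

  vertex : ∀ i → i < n → Fin n
  vertex i i<n = fromℕ< i<n

  toℕ-vertex : ∀ {i} (i<n : i < n) → toℕ (vertex i i<n) ≡ i
  toℕ-vertex i<n = toℕ-fromℕ< i<n

  parent-vertex : ∀ {i} → toℕ u ≡ suc i → ∃[ p ] (toℕ p ≡ par i × Adj graph u p)
  parent-vertex {u} {i} eq = vertex (par i) p<n , toℕ-vertex p<n ,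
      up (subst₂ ChildOf (sym eq) (sym (toℕ-vertex p<n)) (child i))
    where
    p<n : par i < n
    p<n = ≤-<-trans (par≤ i) (≤-trans (n≤1+n _) (subst (_< n) eq (toℕ<n u)))

  to-origin : toℕ z ≡ 0 → ∀ i → toℕ u ≡ i → Star (Adj graph) u z
  to-origin {z} z≡0 i = <-rec (λ i → ∀ {u} → toℕ u ≡ i → Star (Adj graph) u z) go i
    where
    go : ∀ i → (∀ {j} → j < i → ∀ {u} → toℕ u ≡ j → Star (Adj graph) u z) → ∀ {u} → toℕ u ≡ i → Star (Adj graph) u z
    go zero    rec eq = subst (λ z → Star _ _ z) (toℕ-injective (trans eq (sym z≡0))) ε
    go (suc i) rec eq with parent-vertex eq
    ... | p , p≡ , e = e ◅ rec (s≤s (par≤ i)) p≡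

  symmetric : Adj graph u v → Adj graph v u
  symmetric {u} {v} = adjacent-sym graph {u} {v}

  connected : Connected graph
  connected u v = to-origin z≡0 (toℕ u) refl ◅◅ Star.reverse (λ {u} {v} → symmetric {u} {v}) (to-origin z≡0 (toℕ v) refl)
    where
    0<n : 0 < n
    0<n = ≤-<-trans z≤n (toℕ<n u)
    z≡0 : toℕ (vertex 0 0<n) ≡ 0
    z≡0 = toℕ-vertex 0<n

  private
    data EndsWith (z w : Fin n) : List (Fin n) → Set where
      here  : EndsWith z w (z ∷ w ∷ [])
      there : EndsWith z w xs → EndsWith z w (x ∷ xs)

    end∈ : EndsWith z w (x ∷ xs) → w ∈ xs
    end∈ here = here refl
    end∈ (there {xs = _ ∷ _} p) = there (end∈ p)

    second-step : Adj graph y z → x ≢ z → ChildOf (toℕ y) (toℕ x) → ChildOf (toℕ z) (toℕ y)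
    second-step e x≢z c with Adj⁻ e
    ... | inj₁ c′ = ⊥-elim (x≢z (toℕ-injective (parent-unique c c′)))
    ... | inj₂ c′ = c′

    -- After a step to a child, the only step up leads back to the vertex just left, so the walk
    -- goes on downwards and the numbers increase.
    descending : Reduced graph (x ∷ y ∷ xs) → ChildOf (toℕ y) (toℕ x) → w ∈ y ∷ xs → toℕ x < toℕ w
    descending r c (here refl) = parent< c
    descending (cons _ x≢z r@(one e)) c (there w∈) = <-trans (parent< c) (descending r (second-step e x≢z c) w∈)
    descending (cons _ x≢z r@(cons e _ _)) c (there w∈) = <-trans (parent< c) (descending r (second-step e x≢z c) w∈)

    -- By `descending` one step down makes all later steps go down. If the last step goes up, then
    -- so do all the others, and the numbers decrease.
    last-step : Reduced graph (x ∷ xs) → EndsWith z w (x ∷ xs) → ChildOf (toℕ w) (toℕ z) ⊎ toℕ w < toℕ x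
    last-step (one e) here with Adj⁻ e
    ... | inj₁ c = inj₂ (parent< c)
    ... | inj₂ c = inj₁ c
    last-step (one e) (there (there ()))
    last-step (cons e x≢z r) (there p) with last-step r p
    ... | inj₁ c = inj₁ c
    ... | inj₂ w<y with Adj⁻ e
    ...   | inj₁ c = inj₂ (<-trans w<y (parent< c))
    ...   | inj₂ c = ⊥-elim (<-asym w<y (descending r (second-step (first r) x≢z c) (end∈ p)))
      where
      first : ∀ {x y xs} → Reduced graph (x ∷ y ∷ xs) → Adj graph x y
      first (one e) = e
      first (cons e _ _) = e

    ends : ∀ y ys → ∃[ z ] (z ∈ y ∷ ys × EndsWith z w ((y ∷ ys) ++ w ∷ []))
    ends y [] = y , here refl , here
    ends y (y′ ∷ ys) with ends y′ ys
    ... | z , z∈ , p = z , there z∈ , there p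

    reduce : ∀ a vs → Linked (Adj graph) (a ∷ vs ++ w ∷ []) → Unique (a ∷ vs) → w ∉ a ∷ vs → Reduced graph (a ∷ vs ++ w ∷ [])
    reduce a [] (e ∷ _) _ _ = one e
    reduce a (b ∷ []) (e ∷ l) (_ ∷ u) w∉ = cons e (λ { refl → w∉ (here refl) }) (reduce b [] l u (w∉ ∘ there))
    reduce a (b ∷ c ∷ vs) (e ∷ l) ((_ ∷ a≢c ∷ _) ∷ u) w∉ = cons e a≢c (reduce b (c ∷ vs) l u (w∉ ∘ there))

  -- A cycle is a reduced walk from `v` back to `v`. If it starts downwards, it ends at a number
  -- above `v`. If it starts upwards, it must return from the parent of `v`, which would then occur
  -- twice on the cycle.
  acyclic : ∀ v vs → ¬ IsCycle graph v vs
  acyclic v (a ∷ []) (s≤s () , _)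
  acyclic v (a ∷ b ∷ vs) (_ , u@((_ ∷ v≢b ∷ _) ∷ (a∉ ∷ _)) , (e ∷ linked)) with ends {w = v} b vs
  ... | z , z∈ , p = contra
    where
    v∉ : v ∉ a ∷ b ∷ vs
    v∉ = Unique.Unique[x∷xs]⇒x∉xs u
    tail-unique : ∀ {x : Fin n} {xs} → Unique (x ∷ xs) → Unique xs
    tail-unique (_ ∷ u) = u
    walk : Reduced graph (v ∷ a ∷ b ∷ vs ++ v ∷ [])
    walk = cons e v≢b (reduce a (b ∷ vs) linked (tail-unique u) v∉)
    contra : ⊥
    contra with Adj⁻ e | last-step walk (there (there p))
    ... | inj₂ c | _ = <-irrefl refl (descending walk c (there (there (∈-++⁺ʳ vs (here refl)))))
    ... | inj₁ c | inj₂ v<v = <-irrefl refl v<v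
    ... | inj₁ c | inj₁ c′ = All.lookup a∉ z∈ (toℕ-injective (parent-unique c c′))

  isTree : IsTree graph
  isTree = connected , acyclic

  parents : ℕ → List ℕ
  parents zero    = []
  parents (suc i) = par i ∷ []

  degree-children : ∀ u (ch : List ℕ) → Unique ch → (∀ {y} → y ∈ ch → y < n × ChildOf y (toℕ u)) →
    (∀ {y} → y < n → ChildOf y (toℕ u) → y ∈ ch) → degree graph u ≡ length (parents (toℕ u) ++ ch)
  degree-children u ch uch sound complete = degree-by graph u (parents (toℕ u) ++ ch)
      (Unique.++⁺ (parents-unique (toℕ u)) uch (λ (p , q) → <-asym (parent< (parents⁻ (toℕ u) p)) (parent< (proj₂ (sound q)))))
      adjacent member
    where
    parents⁻ : ∀ i {y} → y ∈ parents i → ChildOf i y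
    parents⁻ (suc i) (here refl) = child i
    parents⁺ : ∀ {i y} → ChildOf i y → y ∈ parents i
    parents⁺ (child i) = here refl
    parents-unique : ∀ i → Unique (parents i)
    parents-unique zero    = []
    parents-unique (suc i) = [] ∷ []
    adjacent : ∀ {y} → y ∈ parents (toℕ u) ++ ch → ∃[ v ] (toℕ v ≡ y × Adj graph u v)
    adjacent {y} y∈ with ∈-++⁻ (parents (toℕ u)) y∈
    ... | inj₁ p = vertex y y<n , toℕ-vertex y<n , up (subst (ChildOf (toℕ u)) (sym (toℕ-vertex y<n)) (parents⁻ (toℕ u) p))
      where y<n = <-trans (parent< (parents⁻ (toℕ u) p)) (toℕ<n u)
    ... | inj₂ p with sound p
    ...   | y<n , c = vertex y y<n , toℕ-vertex y<n , down (subst (λ y → ChildOf y (toℕ u)) (sym (toℕ-vertex y<n)) c)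
    member : ∀ v → Adj graph u v → toℕ v ∈ parents (toℕ u) ++ ch
    member v e with Adj⁻ e
    ... | inj₁ c = ∈-++⁺ˡ (parents⁺ c)
    ... | inj₂ c = ∈-++⁺ʳ (parents (toℕ u)) (complete (toℕ<n v) c)

-- Parity, halving and the levels of a heap

half-double : ∀ i → ⌊ i + i /2⌋ ≡ i
half-double i = sym (n≡⌊n+n/2⌋ i)

half-suc-double : ∀ i → ⌊ suc (i + i) /2⌋ ≡ i
half-suc-double zero    = refl
half-suc-double (suc i) rewrite +-suc i i = cong suc (half-suc-double i)

data EvenOrOdd : ℕ → Set where
  even : ∀ i → EvenOrOdd (i + i)
  odd  : ∀ i → EvenOrOdd (suc (i + i))

evenOrOdd : ∀ n → EvenOrOdd n
evenOrOdd zero = even 0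
evenOrOdd (suc n) with evenOrOdd n
... | even i = odd i
... | odd i  = subst EvenOrOdd (cong suc (+-suc i i)) (even (suc i))

double-injective : ∀ {i j} → i + i ≡ j + j → i ≡ j
double-injective {i} {j} eq = trans (sym (half-double i)) (trans (cong ⌊_/2⌋ eq) (half-double j))

odd≢even : ∀ i j → suc (i + i) ≢ j + j
odd≢even i zero ()
odd≢even zero (suc j) eq with trans (suc-injective eq) (+-suc j j)
... | ()
odd≢even (suc i) (suc j) eq = odd≢even i j (suc-injective (suc-injective
  (trans (cong (suc ∘ suc) (sym (+-suc i i))) (trans eq (cong suc (+-suc j j))))))

double-< : ∀ {i j} → i + i < j + j → i < j
double-< {i} {j} h = ≰⇒> λ j≤i → <⇒≱ h (+-mono-≤ j≤i j≤i)

double-suc : ∀ {i j} → i < j → suc (suc (i + i)) ≤ j + j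
double-suc {i} {j} h = subst (_≤ j + j) (cong suc (+-suc i i)) (+-mono-≤ h h)

-- The depth of `v` in a binary heap numbered from 0: level `h` holds the vertices with
-- `2 ^ h ≤ v + 1 < 2 ^ (h + 1)`.
level-of : ℕ → ℕ
level-of v = ⌊log₂ suc v ⌋

level-of-child : ∀ i → level-of (suc i) ≡ suc (level-of ⌊ i /2⌋)
level-of-child i = begin
  ⌊log₂ suc (suc i) ⌋                  ≡⟨ sym (m+[n∸m]≡n (⌊log₂⌋-mono-≤ {2} {suc (suc i)} (s≤s (s≤s z≤n)))) ⟩
  1 + (⌊log₂ suc (suc i) ⌋ ∸ 1)        ≡⟨ cong suc (sym (⌊log₂⌊n/2⌋⌋≡⌊log₂n⌋∸1 (suc (suc i)))) ⟩
  suc (level-of ⌊ i /2⌋)               ∎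
  where open ≡-Reasoning

level-of-mono : ∀ {u v} → u ≤ v → level-of u ≤ level-of v
level-of-mono {u} {v} u≤v = ⌊log₂⌋-mono-≤ {suc u} {suc v} (s≤s u≤v)

level-of≤ : ∀ v → level-of v ≤ v
level-of≤ = <-rec (λ v → level-of v ≤ v) go
  where
  go : ∀ v → (∀ {u} → u < v → level-of u ≤ u) → level-of v ≤ v
  go zero    _   = z≤n
  go (suc i) rec = ≤-trans (≤-reflexive (level-of-child i)) (s≤s (≤-trans (rec (s≤s (⌊n/2⌋≤n i))) (⌊n/2⌋≤n i)))

∣-∣≤1 : ∀ {x a b} → x ≤ a → a ≤ suc x → x ≤ b → b ≤ suc x → ∣ a - b ∣ ≤ 1
∣-∣≤1 {x} {a} {b} x≤a a≤ x≤b b≤ with ≤-total a b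
... | inj₁ a≤b = ≤-trans (≤-reflexive (m≤n⇒∣m-n∣≡n∸m a≤b)) (m≤n+o⇒m∸n≤o b a (≤-trans b≤ (subst (suc x ≤_) (+-comm 1 a) (s≤s x≤a))))
... | inj₂ b≤a = ≤-trans (≤-reflexive (m≤n⇒∣n-m∣≡n∸m b≤a)) (m≤n+o⇒m∸n≤o a b (≤-trans a≤ (subst (suc x ≤_) (+-comm 1 b) (s≤s x≤b))))

-- The complete binary tree with q internal vertices, numbered as a binary heap.
module Heap (q : ℕ) (1≤q : 1 ≤ q) where
  open ParentGraph ⌊_/2⌋ ⌊n/2⌋≤n (suc (q + q)) public
  open Distance graph

  private
    l = suc (q + q)

    variable
      u v w : Fin l

  children : ∀ {y p} → ChildOf y p → y ≡ suc (p + p) ⊎ y ≡ suc (suc (p + p))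
  children (child i) with evenOrOdd i
  ... | even j rewrite half-double j = inj₁ refl
  ... | odd j rewrite half-suc-double j = inj₂ refl

  child₁ : ∀ p → ChildOf (suc (p + p)) p
  child₁ p = subst (ChildOf (suc (p + p))) (half-double p) (child (p + p))

  child₂ : ∀ p → ChildOf (suc (suc (p + p))) p
  child₂ p = subst (ChildOf (suc (suc (p + p)))) (half-suc-double p) (child (suc (p + p)))

  child-in-range : ∀ {y p} → y < l → ChildOf y p → p < q
  child-in-range {y} {p} y<l c = ≰⇒> λ q≤p → <⇒≱ y<l (≤-trans (s≤s (+-mono-≤ q≤p q≤p)) (first≤ (children c)))
    where
    first≤ : y ≡ suc (p + p) ⊎ y ≡ suc (suc (p + p)) → suc (p + p) ≤ y
    first≤ (inj₁ refl) = ≤-refl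
    first≤ (inj₂ refl) = n≤1+n _

  degree-internal : toℕ u < q → degree graph u ≡ length (parents (toℕ u)) + 2
  degree-internal {u} p<q = trans (degree-children u (suc (p + p) ∷ suc (suc (p + p)) ∷ [])
      ((1+n≢n ∘ sym ∷ []) ∷ [] ∷ []) sound complete) (trans (length-++ (parents p)) refl)
    where
    open import Data.List.Properties using (length-++)
    p = toℕ u
    sound : ∀ {y} → y ∈ suc (p + p) ∷ suc (suc (p + p)) ∷ [] → y < l × ChildOf y p
    sound (here refl)         = s≤s (+-mono-< p<q p<q) , child₁ p
    sound (there (here refl)) = s≤s (double-suc p<q) , child₂ p
    complete : ∀ {y} → y < l → ChildOf y p → y ∈ suc (p + p) ∷ suc (suc (p + p)) ∷ []
    complete _ c with children c
    ... | inj₁ eq = here eq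
    ... | inj₂ eq = there (here eq)

  degree-pendant : q ≤ toℕ u → degree graph u ≡ 1
  degree-pendant {u} q≤p = trans (degree-children u [] [] (λ ())
      (λ y<l c → ⊥-elim (<⇒≱ (child-in-range y<l c) q≤p))) (one-parent (toℕ u) (≤-trans 1≤q q≤p))
    where
    one-parent : ∀ p → 1 ≤ p → length (parents p ++ []) ≡ 1
    one-parent (suc p) _ = refl

  pendant⇒≥ : IsPendant graph u → q ≤ toℕ u
  pendant⇒≥ {u} d = ≮⇒≥ λ p<q → 2≢ (trans (sym (degree-internal p<q)) d)
    where
    2≢ : ∀ {k} → k + 2 ≢ 1
    2≢ {zero} ()
    2≢ {suc zero} ()
    2≢ {suc (suc _)} ()

  root₀ : Fin l
  root₀ = fzero

  degree-root : degree graph root₀ ≡ 2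
  degree-root = degree-internal 1≤q

  degree-other : ∀ v → v ≢ root₀ → degree graph v ≡ 1 ⊎ degree graph v ≡ 3
  degree-other v v≢0 with toℕ v <? q
  ... | no ≥q = inj₁ (degree-pendant (≮⇒≥ ≥q))
  ... | yes <q = inj₂ (trans (degree-internal <q) (positive (toℕ v) (λ z → v≢0 (toℕ-injective z))))
    where
    positive : ∀ p → p ≢ 0 → length (parents p) + 2 ≡ 3
    positive zero p≢0 = ⊥-elim (p≢0 refl)
    positive (suc p) _ = refl

  level-adj : Adj graph u v → level-of (toℕ v) ≤ suc (level-of (toℕ u))
  level-adj {u} {v} e with Adj⁻ {u} {v} e
  ... | inj₁ c = ≤-trans (level-of-mono (<⇒≤ (parent< c))) (n≤1+n _)
  ... | inj₂ c = go c
    where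
    go : ∀ {y p} → ChildOf y p → level-of y ≤ suc (level-of p)
    go (child i) = ≤-reflexive (level-of-child i)

  walk-from-root : ∀ v → Walk graph (level-of (toℕ v)) root₀ v
  walk-from-root v = <-rec (λ i → ∀ v → toℕ v ≡ i → Walk graph (level-of i) root₀ v) go (toℕ v) v refl
    where
    go : ∀ i → (∀ {j} → j < i → ∀ v → toℕ v ≡ j → Walk graph (level-of j) root₀ v) →
         ∀ v → toℕ v ≡ i → Walk graph (level-of i) root₀ v
    go zero    rec v eq = toℕ-injective (sym eq)
    go (suc i) rec v eq with parent-vertex {u = v} eq
    ... | p , p≡ , e = subst (λ k → Walk graph k root₀ v) (sym (level-of-child i))
          (snocʷ (rec (s≤s (⌊n/2⌋≤n i)) p p≡) (symmetric {u = v} {v = p} e))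

  height≡level : ∀ v → height graph root₀ v ≡ level-of (toℕ v)
  height≡level v = ≤-antisym (dist≤ {u = root₀} {v = v} (walk-from-root v)) (≤dist {u = root₀} {v = v} (≤-trans (level-of≤ (toℕ v)) (<⇒≤ (toℕ<n v)))
    λ {k} walk → subst (level-of (toℕ v) ≤_) (+-identityʳ k) (lipschitz (level-of ∘ toℕ) (λ {u} {v} → level-adj {u} {v}) walk))

  height≤ecc : ∀ v → level-of (toℕ v) ≤ ecc graph root₀
  height≤ecc v = ≤-trans (≤-reflexive (sym (height≡level v))) (dist≤ecc {v = root₀} {u = v})

  -- The pendant vertices are those from `q` to `q + q`, and the parent of the last one is `q - 1`;
  -- hence they occupy at most two consecutive levels.
  level-of-last : level-of (q + q) ≤ suc (level-of q)
  level-of-last = go q 1≤q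
    where
    go : ∀ q → 1 ≤ q → level-of (q + q) ≤ suc (level-of q)
    go (suc r) _ = ≤-trans (≤-reflexive (level-of-child (r + suc r)))
        (s≤s (level-of-mono (≤-trans (≤-reflexive (trans (cong ⌊_/2⌋ (+-suc r r)) (half-suc-double r))) (n≤1+n r))))

  child-of-parent : ∀ {p v} → IsParentOf graph root₀ p v → ChildOf (toℕ v) (toℕ p)
  child-of-parent {p} {v} (e , h) with Adj⁻ {p} {v} e
  ... | inj₂ c = c
  ... | inj₁ c = ⊥-elim (<⇒≱ (≤-reflexive (trans (sym (cong suc (height≡level p))) (trans (sym h) (height≡level v))))
                   (level-of-mono (<⇒≤ (parent< c))))

  -- The order is reversed because in a heap the parents of the lowest vertices form an initial segment.
  _≻_ : Fin l → Fin l → Set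
  u ≻ v = toℕ v < toℕ u

  ordering : IsOrdering graph root₀ _≻_
  ordering = record
    { linear = λ h _ → On.isStrictTotalOrder proj₁ (Flip.isStrictTotalOrder <ᶠ-isStrictTotalOrder)
    ; compatible = λ {u} {v} {p} {q} _ pu qv p≢q →
        mk⇔ (parents-< (child-of-parent qv) (child-of-parent pu) (p≢q ∘ toℕ-injective ∘ sym))
            (children-< (child-of-parent qv) (child-of-parent pu)) }
    where
    parents-< : ∀ {v q u p} → ChildOf v q → ChildOf u p → q ≢ p → v < u → q < p
    parents-< (child j) (child i) q≢p (s≤s j<i) = ≤∧≢⇒< (⌊n/2⌋-mono (<⇒≤ j<i)) q≢p
    children-< : ∀ {v q u p} → ChildOf v q → ChildOf u p → q < p → v < u
    children-< (child j) (child i) q<p = s≤s (≰⇒> λ i≤j → <⇒≱ q<p (⌊n/2⌋-mono i≤j))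

  first-child : ∀ p → toℕ p < q → ∃[ v ] (toℕ v ≡ suc (toℕ p + toℕ p) × IsParentOf graph root₀ p v)
  first-child p p<q = c , c≡ , down {v = c} {u = p} isChild ,
      trans (height≡level c) (trans (cong level-of c≡) (trans (level-of-child (toℕ p + toℕ p))
        (cong suc (trans (cong level-of (half-double (toℕ p))) (sym (height≡level p))))))
    where
    c<l : suc (toℕ p + toℕ p) < l
    c<l = s≤s (+-mono-< p<q p<q)
    c = vertex _ c<l
    c≡ = toℕ-vertex c<l
    isChild : ChildOf (toℕ c) (toℕ p)
    isChild = subst (λ y → ChildOf y (toℕ p)) (sym c≡) (child₁ (toℕ p))

  top-level⇒¬internal : ∀ w → height graph root₀ w ≡ ecc graph root₀ → ¬ toℕ w < q
  top-level⇒¬internal w top-level w<q =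
    let x , _ , (_ , hx) = first-child w w<q
    in <⇒≱ (≤-reflexive (cong suc (sym top-level)))
           (≤-trans (≤-reflexive (sym hx)) (≤-trans (≤-reflexive (height≡level x)) (height≤ecc x)))

  isRgood : IsRgood graph root₀
  isRgood = record
    { isRootedBinaryTree = isTree , inj₂ (degree-root , degree-other)
    ; balanced = λ u v pu pv → subst₂ (λ a b → ∣ a - b ∣ ≤ 1) (sym (height≡level u)) (sym (height≡level v))
        (∣-∣≤1 {level-of q} {level-of (toℕ u)} {level-of (toℕ v)}
           (level-of-mono (pendant⇒≥ {u} pu)) (≤last u) (level-of-mono (pendant⇒≥ {v} pv)) (≤last v))
    ; _≺_ = _≻_
    ; isOrdering = ordering
    ; finalSegment = final }
    where
    ≤last : ∀ v → level-of (toℕ v) ≤ suc (level-of q)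
    ≤last v = ≤-trans (level-of-mono (s≤s⁻¹ (toℕ<n v))) level-of-last
    final : ∀ p r → IsParentOfTopPendant graph root₀ p → suc (height graph root₀ r) ≡ ecc graph root₀ →
            p ≻ r → IsParentOfTopPendant graph root₀ r
    -- The number of `r` is below that of `p`, so `r` is internal. Its first child lies on the top
    -- level and is pendant, since an internal vertex there would have a child deeper still.
    final p r (v , pv , _ , _) r-level r<p =
      let w , _ , rw = first-child r (<-trans r<p (child-in-range (toℕ<n v) (child-of-parent pv)))
          top-level = trans (proj₂ rw) r-level
      in w , rw , degree-pendant (≮⇒≥ (top-level⇒¬internal w top-level)) , top-level

-- Binary caterpillars

catPar : ℕ → ℕ
catPar zero    = 0
catPar (suc j) = suc (⌊ j /2⌋ + ⌊ j /2⌋)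

half+half≤ : ∀ j → ⌊ j /2⌋ + ⌊ j /2⌋ ≤ j
half+half≤ j = ≤-trans (+-monoʳ-≤ ⌊ j /2⌋ (⌊n/2⌋≤⌈n/2⌉ j)) (≤-reflexive (⌊n/2⌋+⌈n/2⌉≡n j))

catPar≤ : ∀ i → catPar i ≤ i
catPar≤ zero    = z≤n
catPar≤ (suc j) = s≤s (half+half≤ j)

-- The spine is 0 , 1 , 3 , 5 , … and the leg at suc (i + i) is suc (suc (i + i)).
data CatEdge : ℕ → ℕ → Set where
  first : CatEdge 1 0
  leg   : ∀ i → CatEdge (suc (suc (i + i))) (suc (i + i))
  next  : ∀ i → CatEdge (suc (suc (suc (i + i)))) (suc (i + i))

catEdge : ∀ i → CatEdge (suc i) (catPar i)
catEdge zero = first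
catEdge (suc j) with evenOrOdd j
... | even i rewrite half-double i = leg i
... | odd i rewrite half-suc-double i = next i

catEdge⇒par : ∀ {i p} → CatEdge (suc i) p → catPar i ≡ p
catEdge⇒par first = refl
catEdge⇒par (leg i) = cong (λ h → suc (h + h)) (half-double i)
catEdge⇒par (next i) = cong (λ h → suc (h + h)) (half-suc-double i)

data CatView : ℕ → Set where
  base  : CatView 0
  spine : ∀ i → CatView (suc (i + i))
  leg   : ∀ i → CatView (suc (suc (i + i)))

catView : ∀ v → CatView v
catView zero = base
catView (suc k) with evenOrOdd k
... | even i = spine i
... | odd i  = leg i

spineVertex : ℕ → ℕ
spineVertex zero    = 0
spineVertex (suc i) = suc (i + i)

spine-step : ∀ a → CatEdge (spineVertex (suc a)) (spineVertex a)
spine-step zero    = first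
spine-step (suc i) = subst (λ v → CatEdge (suc (suc v)) (suc (i + i))) (sym (+-suc i i)) (next i)

-- The index of a leg is one less than that of its spine neighbour, so that index plus distance to the far end
-- of the spine is constant.
spineIndex : ℕ → ℕ
spineIndex 0                   = 0
spineIndex 1                   = 1
spineIndex 2                   = 0
spineIndex (suc (suc (suc k))) = suc (spineIndex (suc k))

spineIndex-spine : ∀ i → spineIndex (suc (i + i)) ≡ suc i
spineIndex-spine zero    = refl
spineIndex-spine (suc i) rewrite +-suc i i = cong suc (spineIndex-spine i)

spineIndex-leg : ∀ i → spineIndex (suc (suc (i + i))) ≡ i
spineIndex-leg zero    = refl
spineIndex-leg (suc i) rewrite +-suc i i = cong suc (spineIndex-leg i)

spineIndex-spineVertex : ∀ a → spineIndex (spineVertex a) ≡ a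
spineIndex-spineVertex zero    = refl
spineIndex-spineVertex (suc i) = spineIndex-spine i

spineIndex-lipschitz : ∀ {y p} → CatEdge y p → spineIndex y ≤ suc (spineIndex p) × spineIndex p ≤ suc (spineIndex y)
spineIndex-lipschitz first = ≤-refl , z≤n
spineIndex-lipschitz (leg i) rewrite spineIndex-spine i | spineIndex-leg i = ≤-trans (n≤1+n i) (n≤1+n _) , ≤-refl
spineIndex-lipschitz (next i) rewrite spineIndex-spine i = ≤-refl , ≤-trans (n≤1+n _) (n≤1+n _)

-- `m` is the number of internal vertices. The spine from `spineVertex 0` to `spineVertex M`
-- includes a pendant vertex at each end, so its length is `M`.
module Caterpillar (m n : ℕ) (n≡ : n ≡ suc m + suc m) where
  open ParentGraph catPar catPar≤ n public
  open Distance graph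

  private
    M = suc m

    variable
      u v w x : Fin n

  childOf⇒catEdge : ∀ {y p} → ChildOf y p → CatEdge y p
  childOf⇒catEdge (child i) = catEdge i

  catEdge⇒childOf : ∀ {y p} → CatEdge y p → ChildOf y p
  catEdge⇒childOf {suc i} e = subst (ChildOf (suc i)) (catEdge⇒par e) (child i)

  spineVertex<n : ∀ {a} → a ≤ M → spineVertex a < n
  spineVertex<n {zero}  _ = subst (0 <_) (sym n≡) (s≤s z≤n)
  spineVertex<n {suc i} (s≤s i≤m) = subst (suc (i + i) <_) (sym n≡)
    (subst (suc (i + i) <_) (cong suc (sym (+-suc m m))) (s≤s (s≤s (+-mono-≤ i≤m i≤m))))

  spine≤ : ∀ {i} → suc (i + i) < n → i ≤ m
  spine≤ {i} h = s≤s⁻¹ (double-< (≤-trans (n<1+n (i + i)) (<⇒≤ (subst (suc (i + i) <_) n≡ h))))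

  leg< : ∀ {i} → suc (suc (i + i)) < n → i < m
  leg< {i} h = s≤s⁻¹ (double-< {suc i} {M} (subst₂ _<_ (cong suc (sym (+-suc i i))) n≡ h))

  leg<⁻ : ∀ {i} → i < m → suc (suc (suc (i + i))) < n
  leg<⁻ {i} h = subst (suc (suc (suc (i + i))) <_) (sym n≡)
    (s≤s (≤-trans (s≤s (double-suc h)) (≤-reflexive (sym (+-suc m m)))))

  degree-0 : ∀ u → toℕ u ≡ 0 → degree graph u ≡ 1
  degree-0 u eq = trans (degree-children u (1 ∷ []) ([] ∷ [])
      (λ { (here refl) → spineVertex<n {1} (s≤s z≤n) , subst (ChildOf 1) (sym eq) (child 0) })
      (λ _ c → complete (childOf⇒catEdge (subst (ChildOf _) eq c)))) (cong (λ i → length (parents i ++ 1 ∷ [])) eq)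
    where
    complete : ∀ {y} → CatEdge y 0 → y ∈ 1 ∷ []
    complete first = here refl

  degree-1⊎3 : ∀ {i} → CatView i → ∀ u → toℕ u ≡ i → degree graph u ≡ 1 ⊎ degree graph u ≡ 3
  degree-1⊎3 base u eq = inj₁ (degree-0 u eq)
  degree-1⊎3 (spine i) u eq with i <? m
  ... | yes i<m = inj₂ (trans (degree-children u (suc (suc (i + i)) ∷ suc (suc (suc (i + i))) ∷ [])
      ((1+n≢n ∘ sym ∷ []) ∷ [] ∷ []) sound
      (λ _ c → complete refl (childOf⇒catEdge (subst (ChildOf _) eq c)))) (cong (λ i → length (parents i ++ _ ∷ _ ∷ [])) eq))
    where
    sound : ∀ {y} → y ∈ suc (suc (i + i)) ∷ suc (suc (suc (i + i))) ∷ [] → y < n × ChildOf y (toℕ u)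
    sound (here refl) = <⇒≤ (leg<⁻ i<m) , subst (ChildOf _) (sym eq) (catEdge⇒childOf (leg i))
    sound (there (here refl)) = leg<⁻ i<m , subst (ChildOf _) (sym eq) (catEdge⇒childOf (next i))
    complete : ∀ {y p} → p ≡ suc (i + i) → CatEdge y p → y ∈ suc (suc (i + i)) ∷ suc (suc (suc (i + i))) ∷ []
    complete eq (leg j) with double-injective {j} {i} (suc-injective eq)
    ... | refl = here refl
    complete eq (next j) with double-injective {j} {i} (suc-injective eq)
    ... | refl = there (here refl)
  ... | no i≮m = inj₁ (trans (degree-children u [] [] (λ ())
      (λ y<n c → ⊥-elim (complete y<n refl (childOf⇒catEdge (subst (ChildOf _) eq c))))) (cong (λ i → length (parents i ++ [])) eq))
    where
    complete : ∀ {y p} → y < n → p ≡ suc (i + i) → ¬ CatEdge y p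
    complete y<n eq (leg j) with double-injective {j} {i} (suc-injective eq)
    ... | refl = i≮m (leg< y<n)
    complete y<n eq (next j) with double-injective {j} {i} (suc-injective eq)
    ... | refl = i≮m (leg< (<⇒≤ y<n))
  degree-1⊎3 (leg i) u eq = inj₁ (trans (degree-children u [] [] (λ ())
      (λ y<n c → ⊥-elim (complete refl (childOf⇒catEdge (subst (ChildOf _) eq c))))) (cong (λ i → length (parents i ++ [])) eq))
    where
    complete : ∀ {y p} → p ≡ suc (suc (i + i)) → ¬ CatEdge y p
    complete eq (leg j) = odd≢even i j (sym (suc-injective eq))
    complete eq (next j) = odd≢even i j (sym (suc-injective eq))

  isBinaryTree : IsBinaryTree graph
  isBinaryTree = isTree , cubic
    where
    cubic : ∀ v → ¬ IsPendant graph v → degree graph v ≡ 3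
    cubic v ¬pendant with degree-1⊎3 (catView (toℕ v)) v refl
    ... | inj₁ d = ⊥-elim (¬pendant d)
    ... | inj₂ d = d

  spineAt : ∀ a → a ≤ M → Fin n
  spineAt a a≤ = vertex (spineVertex a) (spineVertex<n a≤)

  toℕ-spineAt : ∀ {a} (a≤ : a ≤ M) → toℕ (spineAt a a≤) ≡ spineVertex a
  toℕ-spineAt a≤ = toℕ-vertex (spineVertex<n a≤)

  spinePath : ∀ a → a ≤ M → List (Fin n)
  spinePath zero    a≤ = spineAt 0 a≤ ∷ []
  spinePath (suc a) a≤ = spineAt (suc a) a≤ ∷ spinePath a (<⇒≤ a≤)

  spinePath-∈ : ∀ a (a≤ : a ≤ M) b → b ≤ a → ∀ u → toℕ u ≡ spineVertex b → u ∈ spinePath a a≤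
  spinePath-∈ zero a≤ .0 z≤n u eq = here (toℕ-injective (trans eq (sym (toℕ-spineAt a≤))))
  spinePath-∈ (suc a) a≤ b b≤ u eq with m≤n⇒m<n∨m≡n b≤
  ... | inj₁ (s≤s b≤a) = there (spinePath-∈ a (<⇒≤ a≤) b b≤a u eq)
  ... | inj₂ refl = here (toℕ-injective (trans eq (sym (toℕ-spineAt a≤))))

  spineVertex-mono : ∀ {a b} → a < b → spineVertex a < spineVertex b
  spineVertex-mono {zero}  {suc b} _ = s≤s z≤n
  spineVertex-mono {suc a} {suc b} (s≤s a<b) = s≤s (+-mono-< a<b a<b)

  spinePath-≤ : ∀ a (a≤ : a ≤ M) {u} → u ∈ spinePath a a≤ → toℕ u ≤ spineVertex a
  spinePath-≤ zero a≤ (here refl) = ≤-reflexive (toℕ-spineAt a≤)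
  spinePath-≤ (suc a) a≤ (here refl) = ≤-reflexive (toℕ-spineAt a≤)
  spinePath-≤ (suc a) a≤ (there u∈) = ≤-trans (spinePath-≤ a (<⇒≤ a≤) u∈) (<⇒≤ (spineVertex-mono {a} (n<1+n a)))

  spinePath-isPath : ∀ a (a≤ : a ≤ M) → IsPath graph (spinePath a a≤)
  spinePath-isPath zero a≤ = [-] , [] ∷ []
  spinePath-isPath (suc a) a≤ with spinePath-isPath a (<⇒≤ a≤)
  ... | linked , unique = link a (<⇒≤ a≤) {a≤} linked , All.tabulate fresh ∷ unique
    where
    edge-down : ∀ a (a≤ : a ≤ M) (b≤ : suc a ≤ M) → Adj graph (spineAt (suc a) b≤) (spineAt a a≤)
    edge-down a a≤ b≤ = up {u = spineAt (suc a) b≤} {v = spineAt a a≤}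
      (subst₂ ChildOf (sym (toℕ-spineAt b≤)) (sym (toℕ-spineAt a≤)) (catEdge⇒childOf (spine-step a)))
    link : ∀ b (b≤ : b ≤ M) → {a≤ : suc b ≤ M} → Linked (Adj graph) (spinePath b b≤) →
           Linked (Adj graph) (spineAt (suc b) a≤ ∷ spinePath b b≤)
    link zero    b≤ {a≤} l = edge-down 0 b≤ a≤ ∷ l
    link (suc b) b≤ {a≤} l = edge-down (suc b) b≤ a≤ ∷ l
    fresh : ∀ {u} → u ∈ spinePath a (<⇒≤ a≤) → spineAt (suc a) a≤ ≢ u
    fresh u∈ refl = <⇒≱ (spineVertex-mono {a} (n<1+n a))
      (≤-trans (≤-reflexive (sym (toℕ-spineAt {suc a} a≤))) (spinePath-≤ a (<⇒≤ a≤) u∈))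

  isCaterpillar : IsBinaryCaterpillar graph
  isCaterpillar = isBinaryTree , spinePath M ≤-refl , spinePath-isPath M ≤-refl , λ v → attached v (catView (toℕ v)) refl
    where
    attached : ∀ v {i} → CatView i → toℕ v ≡ i → v ∉ spinePath M ≤-refl → ∃[ u ] (u ∈ spinePath M ≤-refl × Adj graph v u)
    attached v base eq v∉ = ⊥-elim (v∉ (spinePath-∈ M ≤-refl 0 z≤n v eq))
    attached v (spine i) eq v∉ = ⊥-elim (v∉ (spinePath-∈ M ≤-refl (suc i) (s≤s (spine≤ (subst (_< n) eq (toℕ<n v)))) v eq))
    attached v (leg i) eq v∉ with parent-vertex {u = v} eq
    ... | p , p≡ , e = p , spinePath-∈ M ≤-refl (suc i) (s≤s (<⇒≤ (leg< (subst (_< n) eq (toℕ<n v))))) p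
            (trans p≡ (catEdge⇒par (leg i))) , e

  walk-up : ∀ k a {u v} → toℕ u ≡ spineVertex (k + a) → toℕ v ≡ spineVertex a → Walk graph k u v
  walk-up zero    a u≡ v≡ = toℕ-injective (trans u≡ (sym v≡))
  walk-up (suc k) a {u} u≡ v≡ with parent-vertex {u = u} u≡
  ... | p , p≡ , e = p , e , walk-up k a (trans p≡ (catEdge⇒par (spine-step (k + a)))) v≡

  walk-spine : ∀ a b {u v} → toℕ u ≡ spineVertex a → toℕ v ≡ spineVertex b →
               (b ≤ a × Walk graph (a ∸ b) u v) ⊎ (a ≤ b × Walk graph (b ∸ a) u v)
  walk-spine a b u≡ v≡ with ≤-total b a
  ... | inj₁ b≤a = inj₁ (b≤a , walk-up (a ∸ b) b (trans u≡ (cong spineVertex (sym (m∸n+n≡m b≤a)))) v≡)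
  ... | inj₂ a≤b = inj₂ (a≤b , reverseʷ (walk-up (b ∸ a) a (trans v≡ (cong spineVertex (sym (m∸n+n≡m a≤b)))) u≡))

  -- The ends of the spine are at distances `a` and `M ∸ a`. A leg is no farther off than the end on
  -- its side, because it hangs from an internal vertex of the spine.
  reach : ∀ a → a ≤ M → ∀ c → toℕ c ≡ spineVertex a → ∀ x → ∃[ k ] (k ≤ a ⊔ (M ∸ a) × Walk graph k c x)
  reach a a≤ c c≡ x = go (catView (toℕ x)) refl
    where
    on-spine : ∀ b → b ≤ M → toℕ x ≡ spineVertex b → ∃[ k ] (k ≤ a ⊔ (M ∸ a) × Walk graph k c x)
    on-spine b b≤ eq with walk-spine a b c≡ eq
    ... | inj₁ (_ , walk) = _ , ≤-trans (m∸n≤m a b) (m≤m⊔n a _) , walk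
    ... | inj₂ (_ , walk) = _ , ≤-trans (∸-monoˡ-≤ a b≤) (m≤n⊔m a _) , walk
    go : ∀ {i} → CatView i → toℕ x ≡ i → ∃[ k ] (k ≤ a ⊔ (M ∸ a) × Walk graph k c x)
    go base eq = on-spine 0 z≤n eq
    go (spine i) eq = on-spine (suc i) (s≤s (spine≤ (subst (_< n) eq (toℕ<n x)))) eq
    go (leg i) eq with parent-vertex {u = x} eq
    ... | p , p≡ , e with walk-spine a (suc i) c≡ (trans p≡ (catEdge⇒par (leg i)))
    ...   | inj₁ (b≤a , walk) = _ , ≤-trans (≤-trans (s≤s (∸-monoʳ-≤ a (s≤s z≤n))) (≤-reflexive (suc-∸1 (≤-trans (s≤s z≤n) b≤a)))) (m≤m⊔n a _) ,
              snocʷ walk (symmetric {u = x} {v = p} e)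
      where
      suc-∸1 : ∀ {a} → 1 ≤ a → suc (a ∸ 1) ≡ a
      suc-∸1 (s≤s _) = refl
    ...   | inj₂ (a≤b , walk) = _ , ≤-trans (≤-trans (≤-reflexive (sym (+-∸-assoc 1 a≤b))) (∸-monoˡ-≤ a (s≤s (leg< (subst (_< n) eq (toℕ<n x)))))) (m≤n⊔m a _) ,
              snocʷ walk (symmetric {u = x} {v = p} e)

  ecc≤M : ∀ u → ecc graph u ≤ M
  ecc≤M u = ecc≤ {v = u} bound
    where
    a⊔≤ : ∀ {a} → a ≤ M → a ⊔ (M ∸ a) ≤ M
    a⊔≤ {a} a≤ = ⊔-lub a≤ (m∸n≤m M a)
    bound : ∀ x → dist graph u x ≤ M
    bound x = go (catView (toℕ u)) refl
      where
      on-spine : ∀ a → a ≤ M → toℕ u ≡ spineVertex a → dist graph u x ≤ M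
      on-spine a a≤ eq with reach a a≤ u eq x
      ... | k , k≤ , walk = ≤-trans (dist≤ {u = u} {v = x} walk) (≤-trans k≤ (a⊔≤ a≤))
      go : ∀ {i} → CatView i → toℕ u ≡ i → dist graph u x ≤ M
      go base eq = on-spine 0 z≤n eq
      go (spine i) eq = on-spine (suc i) (s≤s (spine≤ (subst (_< n) eq (toℕ<n u)))) eq
      go (leg i) eq with parent-vertex {u = u} eq
      ... | p , p≡ , e with reach (suc i) (s≤s (<⇒≤ i<m)) p (trans p≡ (catEdge⇒par (leg i))) x
        where i<m = leg< (subst (_< n) eq (toℕ<n u))
      ...   | k , k≤ , walk = ≤-trans (dist≤ {u = u} {v = x} (p , e , walk))
                (s≤s (≤-trans k≤ (⊔-lub (leg< (subst (_< n) eq (toℕ<n u))) (m∸n≤m m i))))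

  M≤n : M ≤ n
  M≤n = subst (M ≤_) (sym n≡) (m≤m+n M M)

  end : Fin n
  end = spineAt 0 z≤n

  degree-end : degree graph end ≡ 1
  degree-end = degree-0 end (toℕ-spineAt {0} z≤n)

  index-adj : Adj graph u v → spineIndex (toℕ v) ≤ suc (spineIndex (toℕ u))
  index-adj {u} {v} e with Adj⁻ {u} {v} e
  ... | inj₁ c = proj₂ (spineIndex-lipschitz (childOf⇒catEdge c))
  ... | inj₂ c = proj₁ (spineIndex-lipschitz (childOf⇒catEdge c))

  end-maxEcc : ∀ u → ecc graph u ≤ ecc graph end
  end-maxEcc u = ≤-trans (ecc≤M u) (≤-trans (≤dist {u = end} {v = far} M≤n farWalk) (dist≤ecc {v = end} {u = far}))
    where
    far = spineAt M ≤-refl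
    farWalk : ∀ {k} → Walk graph k end far → M ≤ k
    farWalk {k} walk = begin
      M                               ≡⟨ sym (trans (cong spineIndex (toℕ-spineAt ≤-refl)) (spineIndex-spineVertex M)) ⟩
      spineIndex (toℕ far)            ≤⟨ lipschitz (spineIndex ∘ toℕ) (λ {u} {v} → index-adj {u} {v}) walk ⟩
      k + spineIndex (toℕ end)        ≡⟨ cong (λ z → k + spineIndex z) (toℕ-spineAt {0} z≤n) ⟩
      k + 0                           ≡⟨ +-identityʳ k ⟩
      k                               ∎
      where open ≤-Reasoning

-- The crg trees

module _ {a b n : ℕ} {A : Graph a} {x : Fin a} {B : Graph b} {y : Fin b} {G : Graph n} where

  flip-identification : IsIdentification A x B y G → IsIdentification B y A x G
  flip-identification I = record
    { inA = inB ; inB = inA ; inA-inj = inB-inj ; inB-inj = inA-inj ; identified = sym identified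
    ; disjoint = λ eq → let p , q = disjoint (sym eq) in q , p
    ; covers = λ v → swap (covers v)
    ; edges = λ u v → mk⇔ (swap ∘ Equivalence.to (edges u v)) (Equivalence.from (edges u v) ∘ swap) }
    where
    open IsIdentification I
    swap : ∀ {P Q : Set} → P ⊎ Q → Q ⊎ P
    swap (inj₁ p) = inj₂ p
    swap (inj₂ q) = inj₁ q

  module _ (I : IsIdentification A x B y G) where
    open IsIdentification I

    Adj-inA : ∀ {i i′} → Adj A i i′ → Adj G (inA i) (inA i′)
    Adj-inA e = Equivalence.from (edges _ _) (inj₁ (_ , _ , refl , refl , e))

    walk-inA : ∀ k {i i′} → Walk A k i i′ → Walk G k (inA i) (inA i′)
    walk-inA zero    refl = refl
    walk-inA (suc k) (w , e , walk) = inA w , Adj-inA e , walk-inA k walk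

    degree-inA : ∀ {i} → i ≢ x → degree G (inA i) ≡ degree A i
    degree-inA {i} i≢x = trans (degree≡length-neighbours-list G (inA i)) (trans (≤-antisym
      (length≤-by (λ v j → inA j ≡ v) _ _ (neighbours-list-unique G (inA i)) (λ v∈ → back (∈-neighbours-list⁻ G v∈)) (λ { _ _ refl refl → refl }))
      (length≤-by (λ j v → inA j ≡ v) _ _ (neighbours-list-unique A i)
        (λ j∈ → _ , ∈-neighbours-list⁺ G (Adj-inA (∈-neighbours-list⁻ A j∈)) , refl) (λ _ _ p q → inA-inj (trans p (sym q)))))
      (sym (degree≡length-neighbours-list A i)))
      where
      back : ∀ {v} → Adj G (inA i) v → ∃[ j ] (j ∈ neighbours-list A i × inA j ≡ v)
      back e with Equivalence.to (edges _ _) e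
      ... | inj₁ (i₁ , i₂ , p , q , e′) with inA-inj p
      ...   | refl = i₂ , ∈-neighbours-list⁺ A e′ , q
      back e | inj₂ (j₁ , _ , p , _) = ⊥-elim (i≢x (proj₁ (disjoint (sym p))))

    -- No neighbour comes from both parts: it would be the identified vertex itself, and its edge a
    -- loop.
    degree-identified : degree G (inA x) ≡ degree A x + degree B y
    degree-identified = trans (degree≡length-neighbours-list G (inA x)) (trans (≤-antisym
      (length≤-by (flip Source) _ both-sides (neighbours-list-unique G (inA x)) (λ v∈ → back (∈-neighbours-list⁻ G v∈)) (λ _ _ → functional))
      (length≤-by Source both-sides _ sides-unique forth injective))
      (trans (length-++ (map inj₁ nA)) (cong₂ _+_
        (trans (length-map inj₁ nA) (sym (degree≡length-neighbours-list A x)))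
        (trans (length-map inj₂ nB) (sym (degree≡length-neighbours-list B y))))))
      where
      nA = neighbours-list A x
      nB = neighbours-list B y
      both-sides : List (Fin a ⊎ Fin b)
      both-sides = map inj₁ nA ++ map inj₂ nB
      data Source : Fin a ⊎ Fin b → Fin n → Set where
        fromA : ∀ i → Source (inj₁ i) (inA i)
        fromB : ∀ j → Source (inj₂ j) (inB j)
      sides-unique : Unique both-sides
      sides-unique = Unique.++⁺ (Unique.map⁺ (λ { refl → refl }) (neighbours-list-unique A x))
        (Unique.map⁺ (λ { refl → refl }) (neighbours-list-unique B y)) (λ (p , q) → apart (∈-map⁻ inj₁ p) (∈-map⁻ inj₂ q))
        where
        apart : ∀ {z : Fin a ⊎ Fin b} → ∃[ i ] (i ∈ nA × z ≡ inj₁ i) → ∃[ j ] (j ∈ nB × z ≡ inj₂ j) → ⊥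
        apart (_ , _ , refl) (_ , _ , ())
      functional : ∀ {v v′ z} → Source z v → Source z v′ → v ≡ v′
      functional (fromA _) (fromA _) = refl
      functional (fromB _) (fromB _) = refl
      member : ∀ {z} → z ∈ both-sides → (∃[ i ] (z ≡ inj₁ i × Adj A x i)) ⊎ (∃[ j ] (z ≡ inj₂ j × Adj B y j))
      member z∈ with ∈-++⁻ (map inj₁ nA) z∈
      ... | inj₁ p with ∈-map⁻ inj₁ p
      ...   | i , i∈ , eq = inj₁ (i , eq , ∈-neighbours-list⁻ A i∈)
      member z∈ | inj₂ p with ∈-map⁻ inj₂ p
      ...   | j , j∈ , eq = inj₂ (j , eq , ∈-neighbours-list⁻ B j∈)
      Adj-inB : ∀ {j} → Adj B y j → Adj G (inA x) (inB j)
      Adj-inB e = Equivalence.from (edges _ _) (inj₂ (_ , _ , sym identified , refl , e))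
      forth : ∀ {z} → z ∈ both-sides → ∃[ v ] (v ∈ neighbours-list G (inA x) × Source z v)
      forth z∈ with member z∈
      ... | inj₁ (i , refl , e) = inA i , ∈-neighbours-list⁺ G (Adj-inA e) , fromA i
      ... | inj₂ (j , refl , e) = inB j , ∈-neighbours-list⁺ G (Adj-inB e) , fromB j
      injective : ∀ {z z′ v} → z ∈ both-sides → z′ ∈ both-sides → Source z v → Source z′ v → z ≡ z′
      injective z∈ z′∈ s s′ = go (member z∈) (member z′∈) s s′ refl
        where
        go : ∀ {z z′ v v′} → (∃[ i ] (z ≡ inj₁ i × Adj A x i)) ⊎ (∃[ j ] (z ≡ inj₂ j × Adj B y j)) →
             (∃[ i ] (z′ ≡ inj₁ i × Adj A x i)) ⊎ (∃[ j ] (z′ ≡ inj₂ j × Adj B y j)) →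
             Source z v → Source z′ v′ → v ≡ v′ → z ≡ z′
        go _ _ (fromA i) (fromA i′) eq = cong inj₁ (inA-inj eq)
        go _ _ (fromB j) (fromB j′) eq = cong inj₂ (inB-inj eq)
        go (inj₁ (_ , refl , e)) _ (fromA i) (fromB j) eq with disjoint eq
        ... | refl , _ = ⊥-elim (adjacent-irrefl A e)
        go _ (inj₁ (_ , refl , e)) (fromB j) (fromA i) eq with disjoint (sym eq)
        ... | refl , _ = ⊥-elim (adjacent-irrefl A e)
        go (inj₂ (_ , () , _)) _ (fromA i) (fromB j) eq
        go _ (inj₂ (_ , () , _)) (fromB j) (fromA i) eq
      back : ∀ {v} → Adj G (inA x) v → ∃[ z ] (z ∈ both-sides × Source z v)
      back e with Equivalence.to (edges _ _) e
      ... | inj₁ (i₁ , i₂ , p , refl , e′) with inA-inj p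
      ...   | refl = inj₁ i₂ , ∈-++⁺ˡ (∈-map⁺ inj₁ (∈-neighbours-list⁺ A e′)) , fromA i₂
      back e | inj₂ (j₁ , j₂ , p , refl , e′) with disjoint (sym p)
      ...   | _ , refl = inj₂ j₂ , ∈-++⁺ʳ (map inj₁ nA) (∈-map⁺ inj₂ (∈-neighbours-list⁺ B e′)) , fromB j₂

module Crg (q m n : ℕ) (1≤q : 1 ≤ q) (n≡ : n ≡ (q + suc m) + (q + suc m)) where

  l = suc (q + q)

  n≡l+ : n ≡ l + suc (m + m)
  n≡l+ = trans n≡ (eq q m)
    where
    eq : ∀ q m → (q + suc m) + (q + suc m) ≡ suc (q + q) + suc (m + m)
    eq = solve-∀

  order-K : n ∸ l + 1 ≡ suc m + suc m
  order-K = trans (cong (λ z → z ∸ l + 1) n≡l+) (trans (cong (_+ 1) (m+n∸m≡n l (suc (m + m)))) (eq m))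
    where
    eq : ∀ m → suc (m + m) + 1 ≡ suc m + suc m
    eq = solve-∀

  module R = Heap q 1≤q
  module K = Caterpillar m (n ∸ l + 1) order-K

  -- The vertex of the crg tree that corresponds to vertex k of the caterpillar.
  tail : ℕ → ℕ
  tail zero    = 0
  tail (suc k) = suc (q + q + k)

  -- The heap keeps its numbers and the caterpillar is numbered after it, with 0 as the shared
  -- vertex. So the crg tree is again given by a parent function, and `ParentGraph` shows that it is
  -- a tree. The argument `i` stands for the vertex `suc i`, hence the bound `q + q` instead of `l`.
  par : ℕ → ℕ
  par i with i <? q + q
  ... | yes _ = ⌊ i /2⌋
  ... | no _  = tail (catPar (i ∸ (q + q)))

  data CrgEdge : ℕ → ℕ → Set where
    heapEdge : ∀ {i} → i < q + q → CrgEdge (suc i) ⌊ i /2⌋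
    tailEdge : ∀ k → CrgEdge (tail (suc k)) (tail (catPar k))

  par-heap : ∀ {i} → i < q + q → par i ≡ ⌊ i /2⌋
  par-heap {i} h with i <? q + q
  ... | yes _ = refl
  ... | no ¬h = ⊥-elim (¬h h)

  par-tail : ∀ k → par (q + q + k) ≡ tail (catPar k)
  par-tail k with q + q + k <? q + q
  ... | yes h = ⊥-elim (<⇒≱ h (m≤m+n (q + q) k))
  ... | no _ = cong (tail ∘ catPar) (m+n∸m≡n (q + q) k)

  data Position : ℕ → Set where
    heap : ∀ {i} → i < q + q → Position i
    rest : ∀ k → Position (q + q + k)

  position-of : ∀ i → Position i
  position-of i with i <? q + q
  ... | yes h = heap h
  ... | no ¬h = subst Position (m+[n∸m]≡n (≮⇒≥ ¬h)) (rest (i ∸ (q + q)))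

  par≤ : ∀ i → par i ≤ i
  par≤ i = go (position-of i)
    where
    tail≤ : ∀ {j k} → j ≤ k → tail j ≤ q + q + k
    tail≤ {zero} _ = z≤n
    tail≤ {suc j} {k} h = subst (_≤ q + q + k) (+-suc (q + q) j) (+-monoʳ-≤ (q + q) h)
    go : ∀ {i} → Position i → par i ≤ i
    go {i} (heap h) = subst (_≤ i) (sym (par-heap h)) (⌊n/2⌋≤n i)
    go (rest k) = subst (_≤ q + q + k) (sym (par-tail k)) (tail≤ (catPar≤ k))

  module P = ParentGraph par par≤ n
  open P using (graph)

  crgEdge : ∀ {y p} → P.ChildOf y p → CrgEdge y p
  crgEdge (P.child i) = go (position-of i)
    where
    go : ∀ {i} → Position i → CrgEdge (suc i) (par i)
    go {i} (heap h) = subst (CrgEdge (suc i)) (sym (par-heap h)) (heapEdge h)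
    go (rest k) = subst (CrgEdge (suc (q + q + k))) (sym (par-tail k)) (tailEdge k)

  childOf : ∀ {y p} → CrgEdge y p → P.ChildOf y p
  childOf (heapEdge {i} h) = subst (P.ChildOf (suc i)) (par-heap h) (P.child i)
  childOf (tailEdge k) = subst (P.ChildOf (suc (q + q + k))) (par-tail k) (P.child (q + q + k))

  l≤n : l ≤ n
  l≤n = subst (l ≤_) (sym n≡l+) (m≤m+n l _)

  tail<n : ∀ {k} → k < n ∸ l + 1 → tail k < n
  tail<n {zero}  _ = ≤-trans (s≤s z≤n) l≤n
  tail<n {suc k} h = subst (suc (q + q + k) <_) (sym n≡l+) (s≤s (+-monoʳ-< (q + q) (s≤s⁻¹ (≤-trans h (≤-reflexive (trans order-K (cong suc (+-suc m m))))))))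

  tail<n⁻ : ∀ {k} → tail (suc k) < n → suc k < n ∸ l + 1
  tail<n⁻ {k} h = ≤-trans (s≤s (+-cancelˡ-< l k (suc (m + m)) (subst (suc (q + q + k) <_) n≡l+ h)))
                    (≤-reflexive (sym (trans order-K (cong suc (+-suc m m)))))

  tail-injective : ∀ {j k} → tail j ≡ tail k → j ≡ k
  tail-injective {zero}  {zero}  _ = refl
  tail-injective {suc j} {suc k} eq = cong suc (+-cancelˡ-≡ (q + q) j k (suc-injective eq))

  inR : Fin l → Fin n
  inR i = P.vertex (toℕ i) (<-≤-trans (toℕ<n i) l≤n)

  inK : Fin (n ∸ l + 1) → Fin n
  inK j = P.vertex (tail (toℕ j)) (tail<n (toℕ<n j))

  toℕ-inR : ∀ i → toℕ (inR i) ≡ toℕ i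
  toℕ-inR i = P.toℕ-vertex (<-≤-trans (toℕ<n i) l≤n)

  toℕ-inK : ∀ j → toℕ (inK j) ≡ tail (toℕ j)
  toℕ-inK j = P.toℕ-vertex (tail<n (toℕ<n j))

  toℕ-end : toℕ K.end ≡ 0
  toℕ-end = K.toℕ-spineAt {0} z≤n

  in-range-R : ∀ v → toℕ v < l → ∃[ i ] inR i ≡ v
  in-range-R v h = R.vertex (toℕ v) h , toℕ-injective (trans (toℕ-inR _) (R.toℕ-vertex h))

  in-range-K : ∀ {v k} → toℕ v ≡ tail k → k < n ∸ l + 1 → ∃[ j ] (toℕ j ≡ k × inK j ≡ v)
  in-range-K {k = k} eq h = K.vertex k h , K.toℕ-vertex h ,
    toℕ-injective (trans (toℕ-inK _) (trans (cong tail (K.toℕ-vertex h)) (sym eq)))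

  disjoint : ∀ {i j} → inR i ≡ inK j → i ≡ R.root₀ × j ≡ K.end
  disjoint {i} {j} eq = go (toℕ j) refl (trans (sym (toℕ-inR i)) (trans (cong toℕ eq) (toℕ-inK j)))
    where
    go : ∀ k → toℕ j ≡ k → toℕ i ≡ tail k → i ≡ R.root₀ × j ≡ K.end
    go zero j≡ i≡ = toℕ-injective i≡ , toℕ-injective (trans j≡ (sym toℕ-end))
    go (suc k) j≡ i≡ = ⊥-elim (<⇒≱ (toℕ<n i) (≤-trans (s≤s (m≤m+n (q + q) k)) (≤-reflexive (sym i≡))))

  covers : ∀ v → (∃[ i ] inR i ≡ v) ⊎ (∃[ j ] inK j ≡ v)
  covers v with toℕ v in eq
  ... | zero = inj₁ (in-range-R v (≤-trans (≤-reflexive (cong suc eq)) (s≤s z≤n)))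
  ... | suc i = go (position-of i) eq
    where
    go : ∀ {i} → Position i → toℕ v ≡ suc i → (∃[ i ] inR i ≡ v) ⊎ (∃[ j ] inK j ≡ v)
    go (heap h) eq = inj₁ (in-range-R v (≤-trans (≤-reflexive (cong suc eq)) (s≤s h)))
    go (rest k) eq with in-range-K {v} {suc k} eq (tail<n⁻ (subst (_< n) eq (toℕ<n v)))
    ... | j , _ , eq′ = inj₂ (j , eq′)

  EdgeFromR EdgeFromK : Fin n → Fin n → Set
  EdgeFromR u v = ∃[ i ] ∃[ i′ ] (inR i ≡ u × inR i′ ≡ v × Adj R.graph i i′)
  EdgeFromK u v = ∃[ j ] ∃[ j′ ] (inK j ≡ u × inK j′ ≡ v × Adj K.graph j j′)

  edge-from : ∀ {u v} → CrgEdge (toℕ u) (toℕ v) → EdgeFromR u v ⊎ EdgeFromK u v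
  edge-from {u} {v} e = go e refl refl
    where
    go : ∀ {y p} → CrgEdge y p → y ≡ toℕ u → p ≡ toℕ v → EdgeFromR u v ⊎ EdgeFromK u v
    go (heapEdge {i} h) y≡ p≡ =
      let a , a≡u = in-range-R u (subst (_< l) y≡ (s≤s h))
          b , b≡v = in-range-R v (subst (_< l) p≡ (s≤s (≤-trans (⌊n/2⌋≤n i) (<⇒≤ h))))
      in inj₁ (a , b , a≡u , b≡v , R.up {u = a} {v = b} (subst₂ R.ChildOf
           (trans y≡ (trans (cong toℕ (sym a≡u)) (toℕ-inR a))) (trans p≡ (trans (cong toℕ (sym b≡v)) (toℕ-inR b))) (R.child i)))
    go (tailEdge k) y≡ p≡ =
      let k< = tail<n⁻ (subst (_< n) (sym y≡) (toℕ<n u))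
          a , a≡ , a≡u = in-range-K {u} {suc k} (sym y≡) k<
          b , b≡ , b≡v = in-range-K {v} {catPar k} (sym p≡) (≤-<-trans (catPar≤ k) (<⇒≤ k<))
      in inj₂ (a , b , a≡u , b≡v , K.up {u = a} {v = b} (subst₂ K.ChildOf (sym a≡) (sym b≡) (K.child k)))

  R-child : ∀ {y p} → y < l → R.ChildOf y p → CrgEdge y p
  R-child (s≤s h) (R.child i) = heapEdge h

  K-child : ∀ {y p} → K.ChildOf y p → CrgEdge (tail y) (tail p)
  K-child (K.child k) = tailEdge k

  isIdentification : IsIdentification R.graph R.root₀ K.graph K.end graph
  isIdentification = record
    { inA = inR ; inB = inK
    ; inA-inj = λ {i} {j} eq → toℕ-injective (trans (sym (toℕ-inR i)) (trans (cong toℕ eq) (toℕ-inR j)))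
    ; inB-inj = λ {i} {j} eq → toℕ-injective (tail-injective (trans (sym (toℕ-inK i)) (trans (cong toℕ eq) (toℕ-inK j))))
    ; identified = toℕ-injective (trans (toℕ-inR R.root₀) (sym (trans (toℕ-inK K.end) (cong tail toℕ-end))))
    ; disjoint = disjoint
    ; covers = covers
    ; edges = λ u v → mk⇔ (to u v) from }
    where
    to : ∀ u v → Adj graph u v → EdgeFromR u v ⊎ EdgeFromK u v
    to u v e with P.Adj⁻ {u} {v} e
    ... | inj₁ c = edge-from (crgEdge c)
    ... | inj₂ c with edge-from (crgEdge c)
    ...   | inj₁ (i , j , p , q , e′) = inj₁ (j , i , q , p , R.symmetric {u = i} {v = j} e′)
    ...   | inj₂ (i , j , p , q , e′) = inj₂ (j , i , q , p , K.symmetric {u = i} {v = j} e′)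
    from : ∀ {u v} → EdgeFromR u v ⊎ EdgeFromK u v → Adj graph u v
    from (inj₁ (i , j , refl , refl , e)) with R.Adj⁻ {i} {j} e
    ... | inj₁ c = P.up {u = inR i} {v = inR j} (childOf (subst₂ CrgEdge (sym (toℕ-inR i)) (sym (toℕ-inR j)) (R-child (toℕ<n i) c)))
    ... | inj₂ c = P.down {v = inR j} {u = inR i} (childOf (subst₂ CrgEdge (sym (toℕ-inR j)) (sym (toℕ-inR i)) (R-child (toℕ<n j) c)))
    from (inj₂ (i , j , refl , refl , e)) with K.Adj⁻ {i} {j} e
    ... | inj₁ c = P.up {u = inK i} {v = inK j} (childOf (subst₂ CrgEdge (sym (toℕ-inK i)) (sym (toℕ-inK j)) (K-child c)))
    ... | inj₂ c = P.down {v = inK j} {u = inK i} (childOf (subst₂ CrgEdge (sym (toℕ-inK j)) (sym (toℕ-inK i)) (K-child c)))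

  isCrg : IsCrg n l graph
  isCrg = record
    { n-even = divides (q + suc m) (trans n≡ (eq (q + suc m)))
    ; 4≤n = subst (4 ≤_) (sym n≡l+) (subst (4 ≤_) (eq₂ q m) (s≤s (s≤s (≤-trans (+-mono-≤ 1≤q 1≤q) (m≤m+n (q + q) (m + m))))))
    ; l-odd = λ { (divides k eq₁) → odd≢even q k (trans eq₁ (sym (eq k))) }
    ; 3≤l = s≤s (+-mono-≤ 1≤q 1≤q)
    ; l<n = subst (l <_) (sym n≡l+) (m<m+n l (s≤s z≤n))
    ; R = R.graph ; root = R.root₀ ; isRgood = R.isRgood
    ; K = K.graph ; isCaterpillar = K.isCaterpillar ; end = K.end ; end-maxEcc = K.end-maxEcc
    ; isIdentification = isIdentification }
    where
    eq : ∀ k → k + k ≡ k * 2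
    eq = solve-∀
    eq₂ : ∀ q m → suc (suc (q + q + (m + m))) ≡ suc (q + q) + suc (m + m)
    eq₂ = solve-∀

  isBinaryTree : IsBinaryTree graph
  isBinaryTree = P.isTree , cubic
    where
    I = isIdentification
    K-degree : ∀ j → degree K.graph j ≡ 1 ⊎ degree K.graph j ≡ 3
    K-degree j = K.degree-1⊎3 (catView (toℕ j)) j refl
    1⊎3 : ∀ {d e} → d ≡ e → e ≡ 1 ⊎ e ≡ 3 → d ≢ 1 → d ≡ 3
    1⊎3 refl (inj₁ p) ¬1 = ⊥-elim (¬1 p)
    1⊎3 refl (inj₂ p) _ = p
    cubic : ∀ v → ¬ IsPendant graph v → degree graph v ≡ 3
    cubic v ¬1 with covers v
    ... | inj₁ (i , refl) with i ≟ᶠ R.root₀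
    -- The shared vertex has degree 2 in the rgood part and degree 1 in the caterpillar.
    ...   | yes refl = trans (degree-identified I) (cong₂ _+_ R.degree-root K.degree-end)
    ...   | no i≢ = 1⊎3 (degree-inA I i≢) (R.degree-other i i≢) ¬1
    cubic v ¬1 | inj₂ (j , refl) with j ≟ᶠ K.end
    ...   | yes refl = trans (degree-identified (flip-identification I)) (cong₂ _+_ K.degree-end R.degree-root)
    ...   | no j≢ = 1⊎3 (degree-inA (flip-identification I) j≢) (K-degree j) ¬1

-- Weights and distances in the crg trees

module BranchWeight {n : ℕ} (G : Graph n) (isBin : IsBinaryTree G) where
  open BinaryTree G isBin

  private variable
    p c c₁ c₂ : Fin n
    t : Tree (Fin n)

  child-branch : Branch p t → Adj G (root t) c → c ≢ p →
    ∃[ t′ ] (root t′ ≡ c × Branch (root t) t′ × weight t′ ≤ weight t × 5 ≤ weight t)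
  child-branch (leafᵇ _ sole) e c≢p = ⊥-elim (c≢p (sole _ e))
  child-branch (nodeᵇ {s} {l} {r} _ _ _ _ sole bl br) e c≢p with sole _ e
  ... | inj₁ c≡p = ⊥-elim (c≢p c≡p)
  ... | inj₂ (inj₁ refl) = l , refl , bl ,
        ≤-trans (m≤m*n (weight l) (weight r) {{>-nonZero (≤-trans (s≤s z≤n) (weight≥2 r))}}) (n≤1+n _) , weight-node≥5 {a = s} l r
  ... | inj₂ (inj₂ refl) = r , refl , br ,
        ≤-trans (m≤n*m (weight r) (weight l) {{>-nonZero (≤-trans (s≤s z≤n) (weight≥2 l))}}) (n≤1+n _) , weight-node≥5 {a = s} l r

  -- The two branches of a node come in an unspecified order, so they are told apart by their roots.
  children-branches : Branch p t → Adj G (root t) c₁ → c₁ ≢ p → Adj G (root t) c₂ → c₂ ≢ p → c₁ ≢ c₂ →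
    ∃[ t₁ ] ∃[ t₂ ] (root t₁ ≡ c₁ × root t₂ ≡ c₂ × Branch (root t) t₁ × Branch (root t) t₂ ×
                     weight t ≡ 1 + weight t₁ * weight t₂)
  children-branches (leafᵇ _ sole) e₁ c₁≢p _ _ _ = ⊥-elim (c₁≢p (sole _ e₁))
  children-branches (nodeᵇ {s} {l} {r} _ _ _ _ sole bl br) e₁ c₁≢p e₂ c₂≢p c₁≢c₂ with sole _ e₁ | sole _ e₂
  ... | inj₁ q           | _                = ⊥-elim (c₁≢p q)
  ... | _                | inj₁ q           = ⊥-elim (c₂≢p q)
  ... | inj₂ (inj₁ refl) | inj₂ (inj₁ refl) = ⊥-elim (c₁≢c₂ refl)
  ... | inj₂ (inj₂ refl) | inj₂ (inj₂ refl) = ⊥-elim (c₁≢c₂ refl)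
  ... | inj₂ (inj₁ refl) | inj₂ (inj₂ refl) = l , r , refl , refl , bl , br , refl
  ... | inj₂ (inj₂ refl) | inj₂ (inj₁ refl) = r , l , refl , refl , br , bl , cong suc (*-comm (weight l) (weight r))

  pendant-weight : Branch p t → (∀ c → Adj G (root t) c → c ≡ p) → weight t ≡ 2
  pendant-weight (leafᵇ _ _) _ = refl
  pendant-weight (nodeᵇ _ l≢p _ _ _ bl _) sole = ⊥-elim (l≢p (sole _ (branch-edge bl)))

module CrgDistance (q m n : ℕ) (1≤q : 1 ≤ q) (n≡ : n ≡ (q + suc m) + (q + suc m)) where
  open Crg q m n 1≤q n≡ public
  open P using (graph) public
  open BinaryTree graph isBinaryTree
  open Counting graph isBinaryTree
  open BranchWeight graph isBinaryTree
  open Distance graph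

  private
    M = suc m

    variable
      p c s : Fin n
      t : Tree (Fin n)

  child-vertex : ∀ {u y} → y < n → CrgEdge y (toℕ u) → ∃[ c ] (toℕ c ≡ y × Adj graph u c)
  child-vertex {u} y<n e = P.vertex _ y<n , P.toℕ-vertex y<n ,
    P.down {v = P.vertex _ y<n} {u = u} (childOf (subst (λ y → CrgEdge y (toℕ u)) (sym (P.toℕ-vertex y<n)) e))

  parent-of : ∀ {u y} → CrgEdge (toℕ u) y → ∃[ c ] (toℕ c ≡ y × Adj graph u c)
  parent-of {u} {y} e = P.vertex y y<n , P.toℕ-vertex y<n ,
      P.up {u = u} {v = P.vertex y y<n} (childOf (subst (CrgEdge (toℕ u)) (sym (P.toℕ-vertex y<n)) e))
    where y<n = <-trans (P.parent< (childOf e)) (toℕ<n u)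

  tail-edge : ∀ {k b} → CatEdge (suc k) b → CrgEdge (tail (suc k)) (tail b)
  tail-edge {k} e = subst (λ b → CrgEdge (tail (suc k)) (tail b)) (catEdge⇒par e) (tailEdge k)

  tail-edge⁻ : ∀ {y p} b → CrgEdge y p → p ≡ tail (suc b) → ∃[ k ] (y ≡ tail (suc k) × CatEdge (suc k) (suc b))
  tail-edge⁻ b (heapEdge {i} h) eq = ⊥-elim (<⇒≱ h (≤-trans (≤-trans (m≤m+n (q + q) b) (n≤1+n _)) (≤-trans (≤-reflexive (sym eq)) (⌊n/2⌋≤n i))))
  tail-edge⁻ b (tailEdge k) eq = k , refl , subst (CatEdge (suc k)) (tail-injective eq) (catEdge k)

  childless⇒weight≡2 : ∀ b → (∀ {k} → suc k < n ∸ l + 1 → ¬ CatEdge (suc k) (suc b)) →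
                       Branch p t → toℕ (root t) ≡ tail (suc b) → weight t ≡ 2
  childless⇒weight≡2 {p} {t} b childless br eq = pendant-weight br (λ c e → toℕ-injective (P.parent-unique (parental e) (parental (Adj-sym {u = p} {v = root t} (branch-edge br)))))
    where
    parental : ∀ {c} → Adj graph (root t) c → P.ChildOf (toℕ (root t)) (toℕ c)
    parental {c} e with P.Adj⁻ {root t} {c} e
    ... | inj₁ up = up
    ... | inj₂ down with tail-edge⁻ b (crgEdge down) eq
    ...   | k , c≡ , cat = ⊥-elim (childless (tail<n⁻ (subst (_< n) c≡ (toℕ<n c))) cat)

  leg-childless : ∀ i {k} → suc k < n ∸ l + 1 → ¬ CatEdge (suc k) (suc (suc (i + i)))
  leg-childless i _ e = go e refl
    where
    go : ∀ {y p} → CatEdge y p → p ≢ suc (suc (i + i))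
    go (leg j) eq = odd≢even i j (sym (suc-injective eq))
    go (next j) eq = odd≢even i j (sym (suc-injective eq))

  last-childless : ∀ {k} → suc k < n ∸ l + 1 → ¬ CatEdge (suc k) (suc (m + m))
  last-childless h e = go e refl h
    where
    go : ∀ {y p} → CatEdge y p → p ≡ suc (m + m) → y < n ∸ l + 1 → ⊥
    go (leg j) eq h with double-injective {j} {m} (suc-injective eq)
    ... | refl = <-irrefl refl (K.leg< h)
    go (next j) eq h with double-injective {j} {m} (suc-injective eq)
    ... | refl = <-irrefl refl (K.leg< (<⇒≤ h))

  leg-weight : ∀ i → Branch p t → toℕ (root t) ≡ tail (suc (suc (i + i))) → weight t ≡ 2
  leg-weight i = childless⇒weight≡2 (suc (i + i)) (leg-childless i)

  -- Away from the heap the branch is a caterpillar with `f` internal vertices. A leg has weight 2,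
  -- so one more than the weight doubles with each spine vertex: `2 + 2 * w = 2 * suc w`.
  outward-weight : ∀ f i → i + f ≡ m → Branch p t → toℕ (root t) ≡ tail (spineVertex (suc i)) → toℕ p ≡ tail (spineVertex i) →
                   suc (weight t) ≤ 3 * 2 ^ f
  outward-weight zero i i≡ br t≡ _ with trans (sym (+-identityʳ i)) i≡
  ... | refl = ≤-reflexive (cong suc (childless⇒weight≡2 (m + m) last-childless br t≡))
  outward-weight {p} {t} (suc f) i i+f≡ br t≡ p≡ = go
      (child-vertex {root t} (tail<n (<⇒≤ (K.leg<⁻ i<m))) (subst (CrgEdge _) (sym t≡) (tail-edge (leg i))))
      (child-vertex {root t} (tail<n (subst (_< n ∸ l + 1) (cong (suc ∘ suc) (sym (+-suc i i))) (K.leg<⁻ i<m))) (subst (CrgEdge _) (sym t≡) (tail-edge (spine-step (suc i)))))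
    where
    open ≤-Reasoning
    i<m : i < m
    i<m = subst (i <_) i+f≡ (m<m+n i (s≤s z≤n))
    differ : ∀ {u v : Fin n} {j k} → toℕ u ≡ tail j → toℕ v ≡ tail k → k < j → u ≢ v
    differ u≡ v≡ k<j refl = <-irrefl (sym (tail-injective (trans (sym u≡) v≡))) k<j
    before : spineVertex i < suc (suc (i + i))
    before = ≤-trans (K.spineVertex-mono {i} (n<1+n i)) (n≤1+n _)
    go : ∃[ c ] (toℕ c ≡ tail (suc (suc (i + i))) × Adj graph (root t) c) →
         ∃[ c ] (toℕ c ≡ tail (spineVertex (suc (suc i))) × Adj graph (root t) c) → suc (weight t) ≤ 3 * 2 ^ suc f
    go (c₁ , c₁≡ , e₁) (c₂ , c₂≡ , e₂)
      with children-branches br e₁ (differ c₁≡ p≡ before) e₂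
             (differ c₂≡ p≡ (<-trans (K.spineVertex-mono {i} (n<1+n i)) (K.spineVertex-mono {suc i} (n<1+n _))))
             (λ { refl → differ c₂≡ c₁≡ (≤-reflexive (cong (suc ∘ suc) (sym (+-suc i i)))) refl })
    ... | t₁ , t₂ , refl , refl , b₁ , b₂ , w≡ = begin
      suc (weight t)                        ≡⟨ cong suc w≡ ⟩
      2 + weight t₁ * weight t₂             ≡⟨ cong (λ w → 2 + w * weight t₂) (leg-weight i b₁ c₁≡) ⟩
      2 + 2 * weight t₂                     ≡⟨ sym (*-suc 2 (weight t₂)) ⟩
      2 * suc (weight t₂)                   ≤⟨ *-monoʳ-≤ 2 (outward-weight f (suc i) (trans (sym (+-suc i f)) i+f≡) b₂ c₂≡ t≡) ⟩
      2 * (3 * 2 ^ f)                       ≡⟨ eq (2 ^ f) ⟩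
      3 * 2 ^ suc f                         ∎
      where
      eq : ∀ x → 2 * (3 * x) ≡ 3 * (2 * x)
      eq = solve-∀

  module _ (L : Dyadic (suc q)) where
    open Dyadic L renaming (k to bottom; j to excess; j< to excess<; n≡ to dyadic≡)

    2^bottom≤ : 2 ^ bottom ≤ suc q
    2^bottom≤ = subst (2 ^ bottom ≤_) (sym dyadic≡) (m≤m+n _ _)

    -- For a vertex i at level bottom - k, the second argument of X is the number of internal vertices
    -- among its 2 ^ k descendants at level bottom.
    heap-weight : ∀ k i → Branch p t → toℕ (root t) ≡ i → suc (i + i) ≢ toℕ p → suc (suc (i + i)) ≢ toℕ p →
                  (2 + i) * 2 ^ k ≤ 2 ^ suc bottom → X k ((suc q ∸ suc i * 2 ^ k) ⊓ 2 ^ k) ≤ weight t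
    -- The two conditions on `p` say that it is not a child of `i`, so the branch points down the
    -- heap.
    heap-children : ∀ i → i < q → Branch p t → toℕ (root t) ≡ i → suc (i + i) ≢ toℕ p → suc (suc (i + i)) ≢ toℕ p →
      ∃[ t₁ ] ∃[ t₂ ] (toℕ (root t₁) ≡ suc (i + i) × toℕ (root t₂) ≡ suc (suc (i + i)) ×
                       Branch (root t) t₁ × Branch (root t) t₂ × weight t ≡ 1 + weight t₁ * weight t₂)
    heap-children {p} {t} i i<q br t≡ p≢₁ p≢₂ = go
        (child-vertex {root t} (<-≤-trans (s≤s i+i<) l≤n) (edge₁ t≡))
        (child-vertex {root t} (<-≤-trans (s≤s i+i<′) l≤n) (edge₂ t≡))
      where
      i+i<′ : suc (i + i) < q + q
      i+i<′ = double-suc i<q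
      i+i< : i + i < q + q
      i+i< = <⇒≤ i+i<′
      edge₁ : ∀ {j} → j ≡ i → CrgEdge (suc (i + i)) j
      edge₁ refl = subst (CrgEdge (suc (i + i))) (half-double i) (heapEdge i+i<)
      edge₂ : ∀ {j} → j ≡ i → CrgEdge (suc (suc (i + i))) j
      edge₂ refl = subst (CrgEdge (suc (suc (i + i)))) (half-suc-double i) (heapEdge i+i<′)
      go : ∃[ c ] (toℕ c ≡ suc (i + i) × Adj graph (root t) c) →
           ∃[ c ] (toℕ c ≡ suc (suc (i + i)) × Adj graph (root t) c) → _
      go (c₁ , c₁≡ , e₁) (c₂ , c₂≡ , e₂)
        with children-branches br e₁ (λ { refl → p≢₁ (sym c₁≡) }) e₂ (λ { refl → p≢₂ (sym c₂≡) })
               (λ { refl → 1+n≢n (trans (sym c₂≡) c₁≡) })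
      ... | t₁ , t₂ , refl , refl , b₁ , b₂ , w≡ = t₁ , t₂ , c₁≡ , c₂≡ , b₁ , b₂ , w≡
    heap-weight {p} {t} zero i br t≡ p≢₁ p≢₂ _ with i <? q
    ... | no i≮q = ≤-trans (≤-reflexive (cong (λ z → X 0 (z ⊓ 1)) (m≤n⇒m∸n≡0 (s≤s (≤-trans (≮⇒≥ i≮q) (≤-reflexive (sym (*-identityʳ i)))))))) (weight≥2 t)
    ... | yes i<q with heap-children i i<q br t≡ p≢₁ p≢₂
    ...   | t₁ , t₂ , _ , _ , _ , _ , w≡ = ≤-trans (X₀≤5 ((suc q ∸ suc i * 1) ⊓ 1)) (≤-trans (weight-node≥5 {a = root t} t₁ t₂) (≤-reflexive (sym w≡)))
      where
      X₀≤5 : ∀ j → X 0 j ≤ 5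
      X₀≤5 zero    = s≤s (s≤s z≤n)
      X₀≤5 (suc j) = ≤-refl
    heap-weight {p} {t} (suc k) i br t≡ p≢₁ p≢₂ h = go (heap-children i i<q br t≡ p≢₁ p≢₂)
      where
      open ≤-Reasoning
      B = 2 ^ k
      Q = suc q
      N = suc i * 2 ^ suc k
      fits : (2 + i) * (2 * B) ≤ 2 ^ suc bottom
      fits = h
      i<q : i < q
      i<q = s≤s⁻¹ (begin
        2 + i                 ≤⟨ m≤m*n (2 + i) B {{m^n≢0 2 k}} ⟩
        (2 + i) * B           ≤⟨ *-cancelˡ-≤ 2 (subst (_≤ 2 * 2 ^ bottom) (eq i B) fits) ⟩
        2 ^ bottom               ≤⟨ 2^bottom≤ ⟩
        suc q                 ∎)
        where
        eq : ∀ i B → (2 + i) * (2 * B) ≡ 2 * ((2 + i) * B)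
        eq = solve-∀
      N₁ : suc (suc (i + i)) * B ≡ N
      N₁ = eq i B
        where
        eq : ∀ i B → suc (suc (i + i)) * B ≡ suc i * (2 * B)
        eq = solve-∀
      N₂ : suc (suc (suc (i + i))) * B ≡ N + B
      N₂ = eq i B
        where
        eq : ∀ i B → suc (suc (suc (i + i))) * B ≡ suc i * (2 * B) + B
        eq = solve-∀
      fits₁ : (2 + suc (i + i)) * B ≤ 2 ^ suc bottom
      fits₁ = ≤-trans (≤-trans (*-monoˡ-≤ B (n≤1+n (suc (suc (suc (i + i)))))) (≤-reflexive (eq i B))) fits
        where
        eq : ∀ i B → suc (suc (suc (suc (i + i)))) * B ≡ (2 + i) * (2 * B)
        eq = solve-∀
      fits₂ : (2 + suc (suc (i + i))) * B ≤ 2 ^ suc bottom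
      fits₂ = ≤-trans (≤-reflexive (eq i B)) fits
        where
        eq : ∀ i B → suc (suc (suc (suc (i + i)))) * B ≡ (2 + i) * (2 * B)
        eq = solve-∀
      j = (Q ∸ N) ⊓ 2 ^ suc k
      j₁ : j ⊓ B ≡ (Q ∸ suc (suc (i + i)) * B) ⊓ B
      j₁ = trans (⊓-assoc (Q ∸ N) (2 ^ suc k) B) (cong₂ _⊓_ (cong (Q ∸_) (sym N₁)) (m≥n⇒m⊓n≡n (m≤m+n B (B + 0))))
      j₂ : j ∸ B ≡ (Q ∸ suc (suc (suc (i + i))) * B) ⊓ B
      j₂ = trans (∸-distribʳ-⊓ B (Q ∸ N) (2 ^ suc k)) (cong₂ _⊓_
             (trans (∸-+-assoc Q N B) (cong (Q ∸_) (sym N₂)))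
             (trans (cong (_∸ B) (2^suc k)) (m+n∸m≡n B B)))
      beyond : ∀ {a} → i < a → suc (a + a) ≢ toℕ (root t) × suc (suc (a + a)) ≢ toℕ (root t)
      beyond {a} i<a = (λ eq → <⇒≱ (<-≤-trans i<a (m≤m+n a a)) (≤-trans (n≤1+n _) (≤-reflexive (trans eq t≡)))) ,
                       (λ eq → <⇒≱ (<-≤-trans i<a (m≤m+n a a)) (≤-trans (≤-trans (n≤1+n _) (n≤1+n _)) (≤-reflexive (trans eq t≡))))
      i<₁ : i < suc (i + i)
      i<₁ = s≤s (m≤m+n i i)
      go : ∃[ t₁ ] ∃[ t₂ ] (toℕ (root t₁) ≡ suc (i + i) × toℕ (root t₂) ≡ suc (suc (i + i)) ×
             Branch (root t) t₁ × Branch (root t) t₂ × weight t ≡ 1 + weight t₁ * weight t₂) → X (suc k) j ≤ weight t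
      go (t₁ , t₂ , t₁≡ , t₂≡ , b₁ , b₂ , w≡) = begin
        1 + X k (j ⊓ B) * X k (j ∸ B)   ≡⟨ cong₂ (λ a b → 1 + X k a * X k b) j₁ j₂ ⟩
        1 + X k ((Q ∸ suc (suc (i + i)) * B) ⊓ B) * X k ((Q ∸ suc (suc (suc (i + i))) * B) ⊓ B)
          ≤⟨ s≤s (*-mono-≤
               (heap-weight k (suc (i + i)) b₁ t₁≡ (proj₁ (beyond i<₁)) (proj₂ (beyond i<₁)) fits₁)
               (heap-weight k (suc (suc (i + i))) b₂ t₂≡ (proj₁ (beyond (<-trans i<₁ (n<1+n _)))) (proj₂ (beyond (<-trans i<₁ (n<1+n _)))) fits₂)) ⟩
        1 + weight t₁ * weight t₂       ≡⟨ sym w≡ ⟩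
        weight t                        ∎

    whole-heap-weight : Branch p t → toℕ (root t) ≡ 0 → toℕ p ≡ tail 1 → best (suc q) ≤ weight t
    whole-heap-weight {p} {t} br t≡ p≡ = subst (_≤ weight t) (sym best≡)
        (heap-weight bottom 0 br t≡ (λ eq → far (≤-reflexive (trans (sym p≡) (sym eq))) (s≤s z≤n))
          (λ eq → far (≤-reflexive (trans (sym p≡) (sym eq))) ≤-refl) ≤-refl)
      where
      far : ∀ {y} → tail 1 ≤ y → ¬ y ≤ 2
      far h y≤2 = <⇒≱ (s≤s (≤-trans (+-mono-≤ 1≤q 1≤q) (m≤m+n (q + q) 0))) (≤-trans h y≤2)
      best≡ : best (suc q) ≡ X bottom ((suc q ∸ 1 * 2 ^ bottom) ⊓ 2 ^ bottom)
      best≡ = trans (cong best dyadic≡) (trans (best-level bottom (<⇒≤ excess<)) (cong (X bottom) (sym (trans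
        (cong₂ (λ a b → (a ∸ b) ⊓ 2 ^ bottom) dyadic≡ (*-identityˡ (2 ^ bottom)))
        (trans (cong (_⊓ 2 ^ bottom) (m+n∸m≡n (2 ^ bottom) excess)) (m≤n⇒m⊓n≡m (<⇒≤ excess<)))))))

  -- Towards the heap the branch contains the whole rgood part, and weights do not drop in passing
  -- to a larger branch.
  inward-weight : ∀ a → Branch p t → toℕ (root t) ≡ tail (spineVertex a) → toℕ p ≡ tail (spineVertex (suc a)) → best (suc q) ≤ weight t
  inward-weight zero br t≡ p≡ = whole-heap-weight (dyadicForm (suc q) (s≤s z≤n)) br t≡ p≡
  inward-weight {p} {t} (suc a) br t≡ p≡ with parent-of {root t} (subst (λ y → CrgEdge y _) (sym t≡) (tail-edge (spine-step a)))
  ... | c , c≡ , e with child-branch br e (λ { refl → <-irrefl (tail-injective (trans (sym c≡) p≡))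
                           (<-trans (K.spineVertex-mono {a} (n<1+n a)) (K.spineVertex-mono {suc a} (n<1+n _))) })
  ...   | t′ , refl , br′ , w≤ , _ = ≤-trans (inward-weight a br′ c≡ t≡) w≤

  -- Truncated subtraction sends the whole heap to 0 and `tail k` to `k`, so this is `spineIndex`
  -- with the heap collapsed to the end of the caterpillar.
  index : Fin n → ℕ
  index v = spineIndex (toℕ v ∸ (q + q))

  index-tail : ∀ {v k} → toℕ v ≡ tail k → index v ≡ spineIndex k
  index-tail {v} {k} eq = cong spineIndex (trans (cong (_∸ (q + q)) eq) (tail∸ k))
    where
    tail∸ : ∀ k → tail k ∸ (q + q) ≡ k
    tail∸ zero    = 0∸n≡0 (q + q)
    tail∸ (suc k) = trans (cong (_∸ (q + q)) (sym (+-suc (q + q) k))) (m+n∸m≡n (q + q) (suc k))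

  index-heap : ∀ {v} → toℕ v < l → index v ≡ 0
  index-heap h = cong spineIndex (m≤n⇒m∸n≡0 (s≤s⁻¹ h))

  index-edge : ∀ {y p u v} → CrgEdge y p → toℕ u ≡ y → toℕ v ≡ p → index u ≤ suc (index v) × index v ≤ suc (index u)
  index-edge {u = u} {v} (heapEdge {i} h) u≡ v≡
    rewrite index-heap {u} (subst (_< l) (sym u≡) (s≤s h))
          | index-heap {v} (subst (_< l) (sym v≡) (s≤s (≤-trans (⌊n/2⌋≤n i) (<⇒≤ h)))) = z≤n , z≤n
  index-edge {u = u} {v} (tailEdge k) u≡ v≡ rewrite index-tail {u} u≡ | index-tail {v} {catPar k} v≡ = spineIndex-lipschitz (catEdge k)

  index-adj : ∀ {u v} → Adj graph u v → index v ≤ suc (index u)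
  index-adj {u} {v} e with P.Adj⁻ {u} {v} e
  ... | inj₁ c = proj₂ (index-edge {u = u} {v} (crgEdge c) refl refl)
  ... | inj₂ c = proj₁ (index-edge {u = v} {u} (crgEdge c) refl refl)

  module _ (heavy : 3 * 2 ^ m ≤ best (suc q)) where

    lighter⇒¬core : ∀ {p s} → Adj graph p s → (∀ {a b} → root a ≡ p → root b ≡ s → Edge a b → weight b < weight a) →
                    ¬ InSubtreeCore graph s
    lighter⇒¬core {p} {s} e lighter core with edge-at {p} {s} e
    ... | a , b , refl , refl , ed = <⇒≱ (weight<⇒count< (flip-edge ed) (lighter refl refl ed)) (core (root a))

    -- The neighbour towards the heap has the heavier side: inward the weight is at least
    -- `best (suc q)`, outward it is below `3 * 2 ^ m`, and `heavy` separates the two.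
    spine∉core : ∀ i {s} → i ≤ m → toℕ s ≡ tail (spineVertex (suc i)) → ¬ InSubtreeCore graph s
    spine∉core i {s} i≤m s≡ with parent-of {s} (subst (λ y → CrgEdge y _) (sym s≡) (tail-edge (spine-step i)))
    ... | p , p≡ , e = lighter⇒¬core {p} {s} (Adj-sym {u = s} {v = p} e) λ { refl refl (edge f g) →
            ≤-trans (outward-weight (m ∸ i) i (m+[n∸m]≡n i≤m) g s≡ p≡)
              (≤-trans (*-monoʳ-≤ 3 (^-monoʳ-≤ 2 (m∸n≤m m i))) (≤-trans heavy (inward-weight i f p≡ s≡))) }

    -- A leg has weight 2, whereas the root of the other side is internal, which makes that weight
    -- at least 5.
    leg∉core : ∀ i {s} → toℕ s ≡ tail (suc (suc (i + i))) → ¬ InSubtreeCore graph s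
    leg∉core i {s} s≡ with parent-of {s} (subst (λ y → CrgEdge y _) (sym s≡) (tail-edge (leg i)))
    ... | p , p≡ , e with parent-of {p} (subst (λ y → CrgEdge y _) (sym p≡) (tail-edge (spine-step i)))
    ...   | c , c≡ , e′ = lighter⇒¬core {p} {s} (Adj-sym {u = s} {v = p} e) λ { refl refl (edge f g) → lighter f g {{refl}} {{refl}} }
      where
      c≢s : c ≢ s
      c≢s refl = <-irrefl (tail-injective (trans (sym c≡) s≡)) (≤-trans (K.spineVertex-mono {i} (n<1+n i)) (n≤1+n _))
      lighter : ∀ {a b} → Branch s a → Branch (root a) b → {{root a ≡ p}} → {{root b ≡ s}} → weight b < weight a
      lighter {a} {b} f g {{refl}} {{refl}} with child-branch f e′ c≢s
      ... | _ , _ , _ , _ , 5≤w = ≤-trans (s≤s (≤-reflexive (leg-weight i g s≡))) (≤-trans (s≤s (s≤s (s≤s z≤n))) 5≤w)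

    core⇒index≡0 : ∀ s → InSubtreeCore graph s → index s ≡ 0
    core⇒index≡0 s core with toℕ s <? l
    ... | yes h = index-heap h
    ... | no h = ⊥-elim (go (catView (suc k)) refl)
      where
      k = toℕ s ∸ l
      s≡ : toℕ s ≡ tail (suc k)
      s≡ = sym (m+[n∸m]≡n (≮⇒≥ h))
      go : ∀ {j} → CatView j → j ≡ suc k → ⊥
      go base ()
      go (spine i) eq = spine∉core i (K.spine≤ (subst (_< n ∸ l + 1) (sym eq) (tail<n⁻ {k} (subst (_< n) s≡ (toℕ<n s)))))
                          (trans s≡ (cong tail (sym eq))) core
      go (leg i) eq = leg∉core i (trans s≡ (cong tail (sym eq))) core

    module _ (d H : ℕ) (long : d + d + H ≤ M) (shallow : suc q ≤ 2 ^ H) where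

      d+H≤ : d + H ≤ M ∸ d
      d+H≤ = m+n≤o⇒m≤o∸n (d + H) (≤-trans (≤-reflexive (eq d H)) long)
        where
        eq : ∀ d H → (d + H) + d ≡ d + d + H
        eq = solve-∀

      d≤M∸d : d ≤ M ∸ d
      d≤M∸d = ≤-trans (m≤m+n d H) d+H≤

      d≤M : d ≤ M
      d≤M = ≤-trans d≤M∸d (m∸n≤m M d)

      M≤n : M ≤ n
      M≤n = subst (M ≤_) (sym n≡) (≤-trans (m≤n+m M q) (m≤m+n (q + M) _))

      level-of≤H : ∀ H i → suc i < 2 ^ suc H → level-of i ≤ H
      level-of≤H H zero _ = z≤n
      level-of≤H zero (suc i) (s≤s (s≤s ()))
      level-of≤H (suc H) (suc i) h = ≤-trans (≤-reflexive (level-of-child i)) (s≤s (level-of≤H H ⌊ i /2⌋ half<))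
        where
        half< : suc ⌊ i /2⌋ < 2 ^ suc H
        half< = ≤-trans (≤-reflexive refl) (≰⇒> λ big → <⇒≱ h (≤-trans (≤-reflexive (2^suc (suc H)))
                  (≤-trans (+-mono-≤ big big) (≤-trans (≤-reflexive (cong suc (+-suc ⌊ i /2⌋ ⌊ i /2⌋))) (s≤s (s≤s (half+half≤ i)))))))

      -- The levels up to `H` have room for `2 ^ suc H - 1` vertices, and `suc q ≤ 2 ^ H` makes the
      -- `suc (q + q)` vertices of the heap fit in.
      heap-level≤H : ∀ i → level-of (toℕ {l} i) ≤ H
      heap-level≤H i = level-of≤H H (toℕ i) (begin-strict
        suc (toℕ i)      ≤⟨ toℕ<n i ⟩
        suc (q + q)      <⟨ s≤s (≤-reflexive (sym (+-suc q q))) ⟩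
        suc q + suc q    ≤⟨ +-mono-≤ shallow shallow ⟩
        2 ^ H + 2 ^ H    ≡⟨ sym (2^suc H) ⟩
        2 ^ suc H        ∎)
        where open ≤-Reasoning

      private
        I = isIdentification
        near = K.spineAt d d≤M
        far = inK (K.spineAt M ≤-refl)

      -- The heap lies within `d + H` of `near` and the caterpillar within `M ∸ d`; `long` says that
      -- the first bound does not exceed the second.
      ecc-near : ecc graph (inK near) ≤ M ∸ d
      ecc-near = ecc≤ {v = inK near} bound
        where
        walk-to-heap : ∀ i → Walk graph (d + level-of (toℕ i)) (inK near) (inR i)
        walk-to-heap i = walk-inA (flip-identification I) d
            (K.walk-up d 0 (trans (K.toℕ-spineAt d≤M) (cong spineVertex (sym (+-identityʳ d)))) toℕ-end)
          ++ʷ subst (λ v → Walk graph (level-of (toℕ i)) v (inR i)) (IsIdentification.identified I)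
                (walk-inA I (level-of (toℕ i)) (R.walk-from-root i))
        go : ∀ {x} → (∃[ i ] inR i ≡ x) ⊎ (∃[ j ] inK j ≡ x) → dist graph (inK near) x ≤ M ∸ d
        go (inj₁ (i , refl)) = ≤-trans (dist≤ {u = inK near} {v = inR i} (walk-to-heap i))
            (≤-trans (+-monoʳ-≤ d (heap-level≤H i)) d+H≤)
        go (inj₂ (j , refl)) = within (K.reach d d≤M near (K.toℕ-spineAt d≤M) j)
          where
          within : ∃[ k ] (k ≤ d ⊔ (M ∸ d) × Walk K.graph k near j) → dist graph (inK near) (inK j) ≤ M ∸ d
          within (k , k≤ , walk) = ≤-trans (dist≤ {u = inK near} {v = inK j} (walk-inA (flip-identification I) k walk))
            (≤-trans k≤ (⊔-lub d≤M∸d ≤-refl))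
        bound : ∀ x → dist graph (inK near) x ≤ M ∸ d
        bound x = go (covers x)

      index-far : index far ≡ M
      index-far = trans (index-tail (toℕ-inK (K.spineAt M ≤-refl))) (trans (cong spineIndex (K.toℕ-spineAt {M} ≤-refl)) (spineIndex-spineVertex M))

      ecc≥ : ∀ c → M ∸ index c ≤ ecc graph c
      ecc≥ c = ≤-trans (≤dist {u = c} {v = far} (≤-trans (m∸n≤m M (index c)) M≤n)
          (λ {k} walk → m≤n+o⇒m∸n≤o M (index c) (subst₂ _≤_ index-far (+-comm k (index c)) (lipschitz index (λ {u} {v} → index-adj {u} {v}) walk))))
        (dist≤ecc {v = c} {u = far})

      -- A vertex of index below `d` is farther than `M ∸ d` from `far`, so its eccentricity exceeds
      -- that of `near`.
      center⇒d≤index : ∀ c → InCenter graph c → d ≤ index c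
      center⇒d≤index c cc = ≮⇒≥ λ i<d → <⇒≱ (∸-monoʳ-< i<d d≤M) (≤-trans (ecc≥ c) (≤-trans (cc (inK near)) ecc-near))

      d≤centerCoreDist : d ≤ centerCoreDist graph
      d≤centerCoreDist = ≤centerCoreDist (≤-trans d≤M M≤n) bound
        where
        bound : ∀ {c s k} → InCenter graph c → InSubtreeCore graph s → Walk graph k c s → d ≤ k
        bound {c} {s} {k} cc ss walk = ≤-trans (center⇒d≤index c cc)
          (subst (index c ≤_) (trans (cong (k +_) (core⇒index≡0 s ss)) (+-identityʳ k)) (lipschitz index (λ {u} {v} → index-adj {u} {v}) (reverseʷ walk)))

-- The internal vertices of the two parts, `q = suc i` and `m = spine-length i`, add up to `N′`,
-- which leaves one tree for each `i` below `N′`.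
module CrgFamily (n N′ : ℕ) (n≡ : n ≡ suc N′ + suc N′) where

  spine-length : ℕ → ℕ
  spine-length i = N′ ∸ suc i

  order : ∀ i → i < N′ → n ≡ (suc i + suc (spine-length i)) + (suc i + suc (spine-length i))
  order i i<N′ = trans n≡ (cong₂ _+_ N≡ N≡)
    where
    N≡ : suc N′ ≡ suc i + suc (spine-length i)
    N≡ = trans (cong suc (sym (m+[n∸m]≡n i<N′))) (cong suc (sym (+-suc i (spine-length i))))

  module At (i : Fin N′) = CrgDistance (suc (toℕ i)) (spine-length (toℕ i)) n (s≤s z≤n) (order (toℕ i) (toℕ<n i))

  crg : Fin N′ → Graph n
  crg i = At.graph i

  dominated : ∀ T → IsBinaryTree T → 1 ≤ n → 1 ≤ N′ → ∃[ i ] centerCoreDist T ≤ centerCoreDist (crg i)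
  dominated T isBin 1≤n 1≤N′ = go (1 ≤? centerCoreDist T)
    where
    from-parameters : Extremal.Parameters T isBin (centerCoreDist T) → ∃[ i ] centerCoreDist T ≤ centerCoreDist (crg i)
    from-parameters record { q = suc r ; m = m ; H = H ; order = order′ ; long = long ; shallow = shallow ; heavy = heavy } =
      i , At.d≤centerCoreDist i
            (subst₂ (λ a b → 3 * 2 ^ a ≤ best (suc (suc b))) m≡ (sym i≡) heavy) (centerCoreDist T) H
            (subst (λ a → centerCoreDist T + centerCoreDist T + H ≤ suc a) m≡ long)
            (subst (λ b → suc (suc b) ≤ 2 ^ H) (sym i≡) shallow)
      where
      N≡ : N′ ≡ suc r + m
      N≡ = suc-injective (trans (double-injective (trans (sym n≡) order′)) (cong suc (+-suc r m)))
      r<N′ : r < N′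
      r<N′ = subst (r <_) (sym N≡) (s≤s (m≤m+n r m))
      i = fromℕ< r<N′
      i≡ : toℕ i ≡ r
      i≡ = toℕ-fromℕ< r<N′
      m≡ : m ≡ spine-length (toℕ i)
      m≡ = sym (trans (cong₂ (λ a b → a ∸ suc b) N≡ i≡) (m+n∸m≡n (suc r) m))
    go : Dec (1 ≤ centerCoreDist T) → ∃[ i ] centerCoreDist T ≤ centerCoreDist (crg i)
    -- Distance 0 yields no core edge, but any member of the family dominates it.
    go (no ¬1≤d) = fromℕ< 1≤N′ , ≤-trans (s≤s⁻¹ (≰⇒> ¬1≤d)) z≤n
    go (yes 1≤d) = from-parameters (Extremal.parameters T isBin 1≤n 1≤d)

theorem3p4 : (n : ℕ) → 12 ≤ n → 2 ∣ n →
    Σ[ T* ∈ Graph n ] (IsCrgTree T* ×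
    (∀ (T : Graph n) → IsBinaryTree T → centerCoreDist T ≤ centerCoreDist T*))
theorem3p4 n 12≤n (divides zero refl) with 12≤n
... | ()
theorem3p4 n 12≤n (divides (suc N′) n≡) = best-of (maximiser 1≤N′ (λ i → centerCoreDist (crg i)))
  where
  eq : ∀ N → N * 2 ≡ N + N
  eq = solve-∀
  open CrgFamily n N′ (trans n≡ (eq (suc N′)))
  1≤N′ : 1 ≤ N′
  1≤N′ = positive N′ (≤-trans 12≤n (≤-reflexive n≡))
    where
    positive : ∀ k → 12 ≤ suc k * 2 → 1 ≤ k
    positive zero (s≤s (s≤s ()))
    positive (suc k) _ = s≤s z≤n
  best-of : ∃[ i ] (∀ j → centerCoreDist (crg j) ≤ centerCoreDist (crg i)) → _
  best-of (i , maximal) = crg i , (_ , At.isCrg i) , λ T isBin →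
    let j , d≤ = dominated T isBin (≤-trans (s≤s z≤n) 12≤n) 1≤N′ in ≤-trans d≤ (maximal j)
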